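{- Let $n$ be finite with $n>2$. Any class $\mathsf K$ (of cylindric algebras of dimension $n$) that contains the class of completely representable algebras in $\mathsf{CA}_n$ and is contained in $S_c\mathfrak{Nr}_n\mathsf{CA}_{n+3}$ is not elementary. In particular, the class of completely representable $\mathsf{CA}_n$s is not elementary.
   Context: $\mathsf{CA}_n$ is the class of cylindric algebras of dimension $n$. For $\mathfrak B\in\mathsf{CA}_m$ with $m\ge n$, the neat reduct $\mathfrak{Nr}_n\mathfrak B\in\mathsf{CA}_n$ has universe $\{b\in B:c_ib=b\text{ for all }n\le i<m\}$ and the operations of $\mathfrak B$ with indices $<n$; $\mathfrak{Nr}_n\mathsf{CA}_m=\{\mathfrak{Nr}_n\mathfrak B:\mathfrak B\in\mathsf{CA}_m\}$. $\mathfrak A$ is a strong (complete) subalgebra of $\mathfrak B$ if $\mathfrak A$ is a subalgebra of $\mathfrak B$ and whenever $X\subseteq A$ satisfies $\sum^{\mathfrak A}X=1$, then $\sum^{\mathfrak B}X=1$; $S_c\mathsf L$ is the class of (isomorphic copies of) strong subalgebras of algebras in $\mathsf L$. A complete representation of $\mathfrak A\in\mathsf{CA}_n$ is an injective homomorphism $f:\mathfrak A\to\wp(V)$, where $V$ is a disjoint union of cartesian squares ${}^nU_i$ and $\wp(V)$ carries the concrete set-theoretic cylindric operations, such that $f$ carries arbitrary existing suprema in $\mathfrak A$ to unions. $\mathfrak A$ is completely representable if it has a complete representation. A class is elementary if it is the class of models of a first order theory. -}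

module Defs where

open import Level using (Level; 0ℓ; _⊔_) renaming (suc to lsuc)
open import Algebra.Core using (Op₁; Op₂)
open import Algebra.Definitions using (Congruent₁)
open import Algebra.Lattice.Bundles using (BooleanAlgebra)
import Algebra.Lattice.Properties.BooleanAlgebra as BooleanProperties
open import Algebra.Lattice.Structures using (IsBooleanAlgebra)
open import Data.Fin.Base using (Fin; toℕ; inject≤)
open import Data.Fin.Properties using (inject≤-injective; toℕ-inject≤; toℕ<n)
open import Data.Nat.Base using (ℕ; suc; _≤_)
open import Data.Nat.Properties using (<⇒≱)
open import Data.Product.Base using (Σ; Σ-syntax; ∃; ∃-syntax; _×_; _,_; proj₁; proj₂)
open import Data.Sum.Base using (_⊎_)
open import Data.Vec.Base using (Vec; []; _∷_; lookup)
open import Function.Base using (_∘_)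
open import Function.Bundles using (_⇔_)
open import Function.Definitions using (Congruent; Injective; Bijective)
open import Relation.Binary.Core using (Rel)
open import Relation.Binary.Definitions using (_Respects_)
import Relation.Binary.Construct.NaturalOrder.Left as NaturalOrder
open import Relation.Binary.PropositionalEquality.Core as ≡ using (_≡_; _≢_)
import Relation.Binary.Reasoning.Setoid as ≈-Reasoning
open import Relation.Nullary.Negation.Core using () renaming (¬_ to Not)
open import Relation.Unary using (Pred; _⊆_; _≐_; _∪_; _∩_; ∁; ∅; U)

------------------------------------------------------------------------
-- Cylindric algebras of finite dimension

record RawCylindricAlgebra (n : ℕ) (a ℓ : Level) : Set (lsuc (a ⊔ ℓ)) where
  infix  8 ¬_
  infixr 7 _∧_
  infixr 6 _∨_
  infix  4 _≈_
  field
    Carrier : Set a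
    _≈_     : Rel Carrier ℓ
    _∨_     : Op₂ Carrier
    _∧_     : Op₂ Carrier
    ¬_      : Op₁ Carrier
    ⊤       : Carrier
    ⊥       : Carrier
    c       : Fin n → Op₁ Carrier
    d       : Fin n → Fin n → Carrier

  -- x ≤ᴬ y unfolds to x ≈ x ∧ y.
  open NaturalOrder _≈_ _∧_ public using () renaming (_≤_ to _≤ᴬ_)

  IsSupremum : ∀ {p} → Pred Carrier p → Carrier → Set (a ⊔ ℓ ⊔ p)
  IsSupremum X s =
    (∀ {x} → X x → x ≤ᴬ s) × (∀ u → (∀ {x} → X x → x ≤ᴬ u) → s ≤ᴬ u)

record IsCylindricAlgebra {n a ℓ} (A : RawCylindricAlgebra n a ℓ) : Set (a ⊔ ℓ) where
  open RawCylindricAlgebra A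
  field
    isBooleanAlgebra : IsBooleanAlgebra _≈_ _∨_ _∧_ ¬_ ⊤ ⊥
    c-cong           : ∀ i → Congruent₁ _≈_ (c i)
    c-⊥              : ∀ i → c i ⊥ ≈ ⊥
    c-increasing     : ∀ i x → x ≤ᴬ c i x
    c-∧-c            : ∀ i x y → c i (x ∧ c i y) ≈ c i x ∧ c i y
    c-comm           : ∀ i j x → c i (c j x) ≈ c j (c i x)
    d-refl           : ∀ i → d i i ≈ ⊤
    d-trans          : ∀ i j k → k ≢ i → k ≢ j → d i j ≈ c k (d i k ∧ d k j)
    c-d-∧            : ∀ i j x → i ≢ j → c i (d i j ∧ x) ∧ c i (d i j ∧ ¬ x) ≈ ⊥

  open IsBooleanAlgebra isBooleanAlgebra public

-- Set plays the part of the universe of sets: algebras have carriers in Set,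
-- while classes of algebras are predicates valued in an arbitrary Set k.
record CylindricAlgebra (n : ℕ) : Set₁ where
  field
    raw                : RawCylindricAlgebra n 0ℓ 0ℓ
    isCylindricAlgebra : IsCylindricAlgebra raw

  open RawCylindricAlgebra raw public
  open IsCylindricAlgebra isCylindricAlgebra public

  booleanAlgebra : BooleanAlgebra 0ℓ 0ℓ
  booleanAlgebra = record { isBooleanAlgebra = isBooleanAlgebra }

------------------------------------------------------------------------
-- Homomorphisms

module _ {n a₁ ℓ₁ a₂ ℓ₂}
         (A : RawCylindricAlgebra n a₁ ℓ₁) (B : RawCylindricAlgebra n a₂ ℓ₂) where
  private
    module A = RawCylindricAlgebra A
    module B = RawCylindricAlgebra B

  record IsHomomorphism (f : A.Carrier → B.Carrier) : Set (a₁ ⊔ ℓ₁ ⊔ ℓ₂) where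
    field
      cong   : Congruent A._≈_ B._≈_ f
      ∨-homo : ∀ x y → f (x A.∨ y) B.≈ (f x B.∨ f y)
      ∧-homo : ∀ x y → f (x A.∧ y) B.≈ (f x B.∧ f y)
      ¬-homo : ∀ x → f (A.¬ x) B.≈ (B.¬ f x)
      ⊤-homo : f A.⊤ B.≈ B.⊤
      ⊥-homo : f A.⊥ B.≈ B.⊥
      c-homo : ∀ i x → f (A.c i x) B.≈ B.c i (f x)
      d-homo : ∀ i j → f (A.d i j) B.≈ B.d i j

infix 4 _≅_

_≅_ : ∀ {n} → CylindricAlgebra n → CylindricAlgebra n → Set
A ≅ B = ∃[ f ] IsHomomorphism A.raw B.raw f × Bijective A._≈_ B._≈_ f
  where
  module A = CylindricAlgebra A
  module B = CylindricAlgebra B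

------------------------------------------------------------------------
-- Subalgebras

record Subuniverse {n} (B : CylindricAlgebra n) : Set₁ where
  open CylindricAlgebra B
  field
    Member   : Pred Carrier 0ℓ
    resp     : Member Respects _≈_
    ∨-closed : ∀ {x y} → Member x → Member y → Member (x ∨ y)
    ∧-closed : ∀ {x y} → Member x → Member y → Member (x ∧ y)
    ¬-closed : ∀ {x} → Member x → Member (¬ x)
    ⊤-closed : Member ⊤
    ⊥-closed : Member ⊥
    c-closed : ∀ i {x} → Member x → Member (c i x)
    d-closed : ∀ i j → Member (d i j)

subalgebra : ∀ {n} (B : CylindricAlgebra n) → Subuniverse B → CylindricAlgebra n
subalgebra B S = record
  { raw = record
    { Carrier = Σ Carrier Member
    ; _≈_     = λ (x , _) (y , _) → x ≈ y
    ; _∨_     = λ (x , p) (y , q) → x ∨ y , ∨-closed p q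
    ; _∧_     = λ (x , p) (y , q) → x ∧ y , ∧-closed p q
    ; ¬_      = λ (x , p) → ¬ x , ¬-closed p
    ; ⊤       = ⊤ , ⊤-closed
    ; ⊥       = ⊥ , ⊥-closed
    ; c       = λ i (x , p) → c i x , c-closed i p
    ; d       = λ i j → d i j , d-closed i j
    }
  ; isCylindricAlgebra = record
    { isBooleanAlgebra = record
      { isDistributiveLattice = record
        { isLattice = record
          { isEquivalence = record { refl = refl ; sym = sym ; trans = trans }
          ; ∨-comm     = λ _ _ → ∨-comm _ _
          ; ∨-assoc    = λ _ _ _ → ∨-assoc _ _ _
          ; ∨-cong     = ∨-cong
          ; ∧-comm     = λ _ _ → ∧-comm _ _
          ; ∧-assoc    = λ _ _ _ → ∧-assoc _ _ _
          ; ∧-cong     = ∧-cong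
          ; absorptive = (λ _ _ → ∨-absorbs-∧ _ _) , (λ _ _ → ∧-absorbs-∨ _ _)
          }
        ; ∨-distrib-∧ = (λ _ _ _ → ∨-distribˡ-∧ _ _ _) , (λ _ _ _ → ∨-distribʳ-∧ _ _ _)
        ; ∧-distrib-∨ = (λ _ _ _ → ∧-distribˡ-∨ _ _ _) , (λ _ _ _ → ∧-distribʳ-∨ _ _ _)
        }
      ; ∨-complement = (λ _ → ∨-complementˡ _) , (λ _ → ∨-complementʳ _)
      ; ∧-complement = (λ _ → ∧-complementˡ _) , (λ _ → ∧-complementʳ _)
      ; ¬-cong       = ¬-cong
      }
    ; c-cong       = λ i → c-cong i
    ; c-⊥          = c-⊥
    ; c-increasing = λ _ _ → c-increasing _ _
    ; c-∧-c        = λ _ _ _ → c-∧-c _ _ _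
    ; c-comm       = λ _ _ _ → c-comm _ _ _
    ; d-refl       = d-refl
    ; d-trans      = d-trans
    ; c-d-∧        = λ _ _ _ → c-d-∧ _ _ _
    }
  }
  where
  open CylindricAlgebra B
  open Subuniverse S

IsStrong : ∀ {n} {B : CylindricAlgebra n} → Subuniverse B → Set₁
IsStrong {B = B} S =
  ∀ (X : Pred B.Carrier 0ℓ) → X ⊆ Member →
  A.IsSupremum (X ∘ proj₁) A.⊤ → B.IsSupremum X B.⊤
  where
  open Subuniverse S
  module A = CylindricAlgebra (subalgebra B S)
  module B = CylindricAlgebra B

Sc : ∀ {n k} → Pred (CylindricAlgebra n) k → Pred (CylindricAlgebra n) (lsuc 0ℓ ⊔ k)
Sc L A = ∃[ B ] L B × (Σ[ S ∈ Subuniverse B ] IsStrong S × A ≅ subalgebra B S)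

------------------------------------------------------------------------
-- Neat reducts

reduct : ∀ {n m} → n ≤ m → CylindricAlgebra m → CylindricAlgebra n
reduct n≤m B = record
  { raw = record
    { Carrier = Carrier
    ; _≈_ = _≈_ ; _∨_ = _∨_ ; _∧_ = _∧_ ; ¬_ = ¬_ ; ⊤ = ⊤ ; ⊥ = ⊥
    ; c = λ i → c (ι i)
    ; d = λ i j → d (ι i) (ι j)
    }
  ; isCylindricAlgebra = record
    { isBooleanAlgebra = isBooleanAlgebra
    ; c-cong       = λ i → c-cong (ι i)
    ; c-⊥          = λ i → c-⊥ (ι i)
    ; c-increasing = λ i → c-increasing (ι i)
    ; c-∧-c        = λ i → c-∧-c (ι i)
    ; c-comm       = λ i j → c-comm (ι i) (ι j)
    ; d-refl       = λ i → d-refl (ι i)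
    ; d-trans      = λ i j k k≢i k≢j →
                       d-trans (ι i) (ι j) (ι k) (k≢i ∘ ι-injective) (k≢j ∘ ι-injective)
    ; c-d-∧        = λ i j x i≢j → c-d-∧ (ι i) (ι j) x (i≢j ∘ ι-injective)
    }
  }
  where
  open CylindricAlgebra B
  ι = λ i → inject≤ i n≤m

  ι-injective : ∀ {i j} → ι i ≡ ι j → i ≡ j
  ι-injective = inject≤-injective n≤m n≤m _ _

module _ {n} (B : CylindricAlgebra n) where
  open CylindricAlgebra B
  open BooleanProperties booleanAlgebra
    using (∧-identityˡ; ∧-identityʳ; ∨-identityˡ; deMorgan₁; ¬-involutive)
  open ≈-Reasoning (BooleanAlgebra.setoid booleanAlgebra)

  c-⊤ : ∀ i → c i ⊤ ≈ ⊤
  c-⊤ i = begin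
    c i ⊤      ≈⟨ ∧-identityˡ _ ⟨
    ⊤ ∧ c i ⊤  ≈⟨ c-increasing i ⊤ ⟨
    ⊤          ∎

  c-idem : ∀ i x → c i (c i x) ≈ c i x
  c-idem i x = begin
    c i (c i x)      ≈⟨ c-cong i (∧-identityˡ _) ⟨
    c i (⊤ ∧ c i x)  ≈⟨ c-∧-c i ⊤ x ⟩
    c i ⊤ ∧ c i x    ≈⟨ ∧-cong (c-⊤ i) refl ⟩
    ⊤ ∧ c i x        ≈⟨ ∧-identityˡ _ ⟩
    c i x            ∎

  c-fixed-∧ : ∀ i {x y} → c i x ≈ x → c i y ≈ y → c i (x ∧ y) ≈ x ∧ y
  c-fixed-∧ i {x} {y} p q = begin
    c i (x ∧ y)      ≈⟨ c-cong i (∧-cong refl q) ⟨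
    c i (x ∧ c i y)  ≈⟨ c-∧-c i x y ⟩
    c i x ∧ c i y    ≈⟨ ∧-cong p q ⟩
    x ∧ y            ∎

  c-fixed-¬ : ∀ i {x} → c i x ≈ x → c i (¬ x) ≈ ¬ x
  c-fixed-¬ i {x} p = begin
    c i (¬ x)                          ≈⟨ ∧-identityʳ _ ⟨
    c i (¬ x) ∧ ⊤                      ≈⟨ ∧-cong refl (∨-complementʳ x) ⟨
    c i (¬ x) ∧ (x ∨ ¬ x)              ≈⟨ ∧-distribˡ-∨ _ _ _ ⟩
    (c i (¬ x) ∧ x) ∨ (c i (¬ x) ∧ ¬ x) ≈⟨ ∨-cong disjoint (∧-comm _ _) ⟩
    ⊥ ∨ (¬ x ∧ c i (¬ x))              ≈⟨ ∨-identityˡ _ ⟩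
    ¬ x ∧ c i (¬ x)                    ≈⟨ c-increasing i (¬ x) ⟨
    ¬ x                                ∎
    where
    disjoint : c i (¬ x) ∧ x ≈ ⊥
    disjoint = begin
      c i (¬ x) ∧ x      ≈⟨ ∧-cong refl p ⟨
      c i (¬ x) ∧ c i x  ≈⟨ c-∧-c i (¬ x) x ⟨
      c i (¬ x ∧ c i x)  ≈⟨ c-cong i (∧-cong refl p) ⟩
      c i (¬ x ∧ x)      ≈⟨ c-cong i (∧-complementˡ x) ⟩
      c i ⊥              ≈⟨ c-⊥ i ⟩
      ⊥                  ∎

  c-fixed-∨ : ∀ i {x y} → c i x ≈ x → c i y ≈ y → c i (x ∨ y) ≈ x ∨ y
  c-fixed-∨ i {x} {y} p q = begin
    c i (x ∨ y)          ≈⟨ c-cong i x∨y≈ ⟩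
    c i (¬ (¬ x ∧ ¬ y))  ≈⟨ c-fixed-¬ i (c-fixed-∧ i (c-fixed-¬ i p) (c-fixed-¬ i q)) ⟩
    ¬ (¬ x ∧ ¬ y)        ≈⟨ x∨y≈ ⟨
    x ∨ y                ∎
    where
    x∨y≈ : x ∨ y ≈ ¬ (¬ x ∧ ¬ y)
    x∨y≈ = begin
      x ∨ y            ≈⟨ ∨-cong (¬-involutive x) (¬-involutive y) ⟨
      ¬ ¬ x ∨ ¬ ¬ y    ≈⟨ deMorgan₁ (¬ x) (¬ y) ⟨
      ¬ (¬ x ∧ ¬ y)    ∎

  c-fixed-c : ∀ i j {x} → c i x ≈ x → c i (c j x) ≈ c j x
  c-fixed-c i j {x} p = begin
    c i (c j x)  ≈⟨ c-comm i j x ⟩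
    c j (c i x)  ≈⟨ c-cong j p ⟩
    c j x        ∎

  c-fixed-d : ∀ i j k → i ≢ j → i ≢ k → c i (d j k) ≈ d j k
  c-fixed-d i j k i≢j i≢k = begin
    c i (d j k)                  ≈⟨ c-cong i (d-trans j k i i≢j i≢k) ⟩
    c i (c i (d j i ∧ d i k))    ≈⟨ c-idem i _ ⟩
    c i (d j i ∧ d i k)          ≈⟨ d-trans j k i i≢j i≢k ⟨
    d j k                        ∎

neatSubuniverse : ∀ {n m} (n≤m : n ≤ m) (B : CylindricAlgebra m) →
                  Subuniverse (reduct n≤m B)
neatSubuniverse {n} {m} n≤m B = record
  { Member   = λ b → ∀ (i : Fin m) → n ≤ toℕ i → c i b ≈ b
  ; resp     = λ x≈y p i n≤i → trans (c-cong i (sym x≈y)) (trans (p i n≤i) x≈y)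
  ; ∨-closed = λ p q i n≤i → c-fixed-∨ B i (p i n≤i) (q i n≤i)
  ; ∧-closed = λ p q i n≤i → c-fixed-∧ B i (p i n≤i) (q i n≤i)
  ; ¬-closed = λ p i n≤i → c-fixed-¬ B i (p i n≤i)
  ; ⊤-closed = λ i _ → c-⊤ B i
  ; ⊥-closed = λ i _ → c-⊥ i
  ; c-closed = λ j p i n≤i → c-fixed-c B i (inject≤ j n≤m) (p i n≤i)
  ; d-closed = λ j k i n≤i → c-fixed-d B i _ _ (new i n≤i j) (new i n≤i k)
  }
  where
  open CylindricAlgebra B

  new : ∀ (i : Fin m) → n ≤ toℕ i → ∀ j → i ≢ inject≤ j n≤m
  new _ n≤i j ≡.refl = <⇒≱ (toℕ<n j) (≡.subst (n ≤_) (toℕ-inject≤ j n≤m) n≤i)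

neatReduct : ∀ {n m} → n ≤ m → CylindricAlgebra m → CylindricAlgebra n
neatReduct n≤m B = subalgebra (reduct n≤m B) (neatSubuniverse n≤m B)

-- The class Nrₙ CAₘ; membership is up to isomorphism, which Sc absorbs.
Nr : ∀ {n m} → n ≤ m → Pred (CylindricAlgebra n) (lsuc 0ℓ)
Nr {m = m} n≤m A = Σ[ B ∈ CylindricAlgebra m ] A ≅ neatReduct n≤m B

------------------------------------------------------------------------
-- Complete representations

-- The disjoint union of the cartesian squares ⁿUᵢ, with points as vectors so
-- that equality of points is extensional.
Squares : ℕ → {I : Set} → (I → Set) → Set
Squares n {I} Uᵢ = Σ[ i ∈ I ] Vec (Uᵢ i) n

-- A point agreeing with s off k lies in the same square as s, since the bases
-- are disjoint and n ≥ 2.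
℘ : ∀ n {I : Set} → (I → Set) → RawCylindricAlgebra n (lsuc 0ℓ) 0ℓ
℘ n Uᵢ = record
  { Carrier = Pred (Squares n Uᵢ) 0ℓ
  ; _≈_     = _≐_
  ; _∨_     = _∪_
  ; _∧_     = _∩_
  ; ¬_      = ∁
  ; ⊤       = U
  ; ⊥       = ∅
  ; c       = λ k X (i , s) →
                ∃[ t ] (∀ j → j ≢ k → lookup t j ≡ lookup s j) × X (i , t)
  ; d       = λ j k (_ , s) → lookup s j ≡ lookup s k
  }

module _ {n} (A : CylindricAlgebra n) where
  open CylindricAlgebra A

  record CompleteRepresentation : Set₁ where
    field
      {Index} : Set
      Base    : Index → Set
      rep     : Carrier → Pred (Squares n Base) 0ℓ
      homo    : IsHomomorphism raw (℘ n Base) rep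
      inj     : Injective _≈_ _≐_ rep
      sup-⋃   : ∀ (X : Pred Carrier 0ℓ) s → IsSupremum X s →
                rep s ≐ (λ v → ∃[ x ] X x × rep x v)

  CompletelyRepresentable : Set₁
  CompletelyRepresentable = CompleteRepresentation

------------------------------------------------------------------------
-- First order logic in the signature of CAₙ

data Term (n v : ℕ) : Set where
  var     : Fin v → Term n v
  _∨ᵗ_    : Term n v → Term n v → Term n v
  _∧ᵗ_    : Term n v → Term n v → Term n v
  ¬ᵗ_     : Term n v → Term n v
  ⊤ᵗ ⊥ᵗ   : Term n v
  cᵗ      : Fin n → Term n v → Term n v
  dᵗ      : Fin n → Fin n → Term n v

-- Variables are de Bruijn indices: a Formula n v has free variables among v.
data Formula (n v : ℕ) : Set where
  _≈ᶠ_           : Term n v → Term n v → Formula n v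
  ¬ᶠ_            : Formula n v → Formula n v
  _∧ᶠ_ _∨ᶠ_ _⇒ᶠ_ : Formula n v → Formula n v → Formula n v
  ∀ᶠ_ ∃ᶠ_        : Formula n (suc v) → Formula n v

Sentence : ℕ → Set
Sentence n = Formula n 0

Theory : ℕ → Set₁
Theory n = Pred (Sentence n) 0ℓ

module _ {n} (A : CylindricAlgebra n) where
  open CylindricAlgebra A

  ⟦_⟧ᵗ : ∀ {v} → Term n v → Vec Carrier v → Carrier
  ⟦ var x  ⟧ᵗ ρ = lookup ρ x
  ⟦ s ∨ᵗ t ⟧ᵗ ρ = ⟦ s ⟧ᵗ ρ ∨ ⟦ t ⟧ᵗ ρ
  ⟦ s ∧ᵗ t ⟧ᵗ ρ = ⟦ s ⟧ᵗ ρ ∧ ⟦ t ⟧ᵗ ρ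
  ⟦ ¬ᵗ t   ⟧ᵗ ρ = ¬ ⟦ t ⟧ᵗ ρ
  ⟦ ⊤ᵗ     ⟧ᵗ ρ = ⊤
  ⟦ ⊥ᵗ     ⟧ᵗ ρ = ⊥
  ⟦ cᵗ i t ⟧ᵗ ρ = c i (⟦ t ⟧ᵗ ρ)
  ⟦ dᵗ i j ⟧ᵗ ρ = d i j

  ⟦_⟧ᶠ : ∀ {v} → Formula n v → Vec Carrier v → Set
  ⟦ s ≈ᶠ t ⟧ᶠ ρ = ⟦ s ⟧ᵗ ρ ≈ ⟦ t ⟧ᵗ ρ
  ⟦ ¬ᶠ φ   ⟧ᶠ ρ = Not (⟦ φ ⟧ᶠ ρ)
  ⟦ φ ∧ᶠ ψ ⟧ᶠ ρ = ⟦ φ ⟧ᶠ ρ × ⟦ ψ ⟧ᶠ ρ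
  ⟦ φ ∨ᶠ ψ ⟧ᶠ ρ = ⟦ φ ⟧ᶠ ρ ⊎ ⟦ ψ ⟧ᶠ ρ
  ⟦ φ ⇒ᶠ ψ ⟧ᶠ ρ = ⟦ φ ⟧ᶠ ρ → ⟦ ψ ⟧ᶠ ρ
  ⟦ ∀ᶠ φ   ⟧ᶠ ρ = ∀ a → ⟦ φ ⟧ᶠ (a ∷ ρ)
  ⟦ ∃ᶠ φ   ⟧ᶠ ρ = ∃[ a ] ⟦ φ ⟧ᶠ (a ∷ ρ)

infix 4 _⊨_

_⊨_ : ∀ {n} → CylindricAlgebra n → Theory n → Set
A ⊨ T = ∀ φ → T φ → ⟦_⟧ᶠ A φ []

-- Models are taken among the CAₙs.  For finite n the axioms of CAₙ are a finite
-- set of sentences that can be added to T, so this agrees with ranging over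
-- all structures of the signature.
Elementary : ∀ {n k} → Pred (CylindricAlgebra n) k → Set (lsuc 0ℓ ⊔ k)
Elementary {n} K = Σ[ T ∈ Theory n ] (∀ A → K A ⇔ A ⊨ T)

{-# OPTIONS --safe #-}
-- Both algebras of the proof consist of n-ary relations on one countable structure M. Its nodes are base nodes
-- and apexes; a hub is a tuple of n − 1 base nodes carrying a hidden branch of a tree, and two apexes of tints
-- s and t attached to it are labelled by the node of level s ⊔ t on that branch. A tuple of length n sees the
-- label, or the hub with one of the apexes, but never all of them together, so M can be built by one-point
-- extensions in which every visible configuration recurs whatever labels it carries.
--
-- The tree nodes have ranks that decrease along branches: ordinals below ω³, or ∞, which may repeat. 𝔄 consists
-- of the relations that depend, up to some finite stage of an Ehrenfeucht–Fraïssé game, on finitely many tree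
-- nodes, 𝔅 of those for which these nodes have finite (ordinal) rank. Exact types of tuples are atoms of 𝔄, so
-- 𝔄 is completely represented on M. Ranks beyond a threshold cannot be distinguished, and by lowering them 𝔅 is
-- seen to be an elementary subalgebra of 𝔄, and the labels of ordinal rank to have supremum 1 in 𝔅. But if 𝔅 is
-- a strong subalgebra of a neat reduct of C ∈ CA_{n+3}, then over a hub of infinite height in C one can keep
-- choosing apexes of increasing tint whose labels have ordinal ranks; three apexes at a time suffice to see that
-- these ranks descend forever.

module Submission where

open import Defs
open import Algebra.Lattice.Bundles using (BooleanAlgebra)
import Algebra.Lattice.Properties.BooleanAlgebra as BooleanProperties
open import Data.Fin.Base using (Fin)
open import Data.Nat.Base using (ℕ)
open import Relation.Binary.PropositionalEquality.Core as ≡ using (_≡_; _≢_)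
import Relation.Binary.Reasoning.Setoid as ≈-Reasoning

-- The ranks extend to ω³ because of what the moves cost. Matching one more tree node lowers the
-- threshold by a step of ω, since a descending chain of unknown finite length must fit between the
-- old threshold and the new one. Matching one more relation costs a step of ω², since neither the
-- number of nodes that support it nor its depth is bounded in advance. Quantifier depth is
-- arbitrary, so all finite multiples of ω² serve as thresholds. The white labels decouple apexes:
-- two apexes without common neighbours of all kinds can be labelled without regard to the tree.
-- Only a complete hub forces a label, and its n - 1 nodes are exactly what a face of an n-tuple
-- holds, so the forced labels of a new apex never compete with the labels prescribed over the face.
-- This is why prescribed labels may be arbitrary up to coherence of triangles. In dimension n + 3 a
-- hub and three apexes fit into one tuple, and there the labels are forced after all.

-- Arithmetic of cylindrifications, diagonals and substitutions.

module Calculus {N : ℕ} (C : CylindricAlgebra N) where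
  open CylindricAlgebra C
  open BooleanProperties booleanAlgebra
    using (∧-identityˡ; ∧-identityʳ; ∨-identityˡ; ∧-zeroʳ; ∧-idem)
  open ≈-Reasoning (BooleanAlgebra.setoid booleanAlgebra)

  Fixed : Fin N → Carrier → Set
  Fixed i x = c i x ≈ x

  ≤ᴬ-reflexive : ∀ {x y} → x ≈ y → x ≤ᴬ y
  ≤ᴬ-reflexive {x} {y} p = trans (sym (∧-idem x)) (∧-cong refl p)

  ≤ᴬ-trans : ∀ {x y z} → x ≤ᴬ y → y ≤ᴬ z → x ≤ᴬ z
  ≤ᴬ-trans {x} {y} {z} p q = begin
    x            ≈⟨ p ⟩
    x ∧ y        ≈⟨ ∧-cong refl q ⟩
    x ∧ (y ∧ z)  ≈⟨ ∧-assoc x y z ⟨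
    (x ∧ y) ∧ z  ≈⟨ ∧-cong p refl ⟨
    x ∧ z        ∎

  ∧-lowerʳ : ∀ x y → x ∧ y ≤ᴬ y
  ∧-lowerʳ x y = trans (∧-cong refl (sym (∧-idem y))) (sym (∧-assoc x y y))

  ∧-lowerˡ : ∀ x y → x ∧ y ≤ᴬ x
  ∧-lowerˡ x y = ≤ᴬ-trans (≤ᴬ-reflexive (∧-comm x y)) (∧-lowerʳ y x)

  ∧-greatest : ∀ {x y z} → z ≤ᴬ x → z ≤ᴬ y → z ≤ᴬ x ∧ y
  ∧-greatest {x} {y} {z} p q = trans q (trans (∧-cong p refl) (∧-assoc z x y))

  ∧-mono : ∀ {x y u v} → x ≤ᴬ y → u ≤ᴬ v → x ∧ u ≤ᴬ y ∧ v
  ∧-mono p q = ∧-greatest (≤ᴬ-trans (∧-lowerˡ _ _) p) (≤ᴬ-trans (∧-lowerʳ _ _) q)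

  ≤⊥ : ∀ {x y} → x ≤ᴬ y → y ≈ ⊥ → x ≈ ⊥
  ≤⊥ {x} p q = trans p (trans (∧-cong refl q) (∧-zeroʳ x))

  disjoint⇒≤¬ : ∀ {x y} → x ∧ y ≈ ⊥ → y ≤ᴬ ¬ x
  disjoint⇒≤¬ {x} {y} p = begin
    y                    ≈⟨ ∧-identityʳ y ⟨
    y ∧ ⊤                ≈⟨ ∧-cong refl (∨-complementʳ x) ⟨
    y ∧ (x ∨ ¬ x)        ≈⟨ ∧-distribˡ-∨ y x (¬ x) ⟩
    (y ∧ x) ∨ (y ∧ ¬ x)  ≈⟨ ∨-cong (trans (∧-comm y x) p) refl ⟩
    ⊥ ∨ (y ∧ ¬ x)        ≈⟨ ∨-identityˡ _ ⟩
    y ∧ ¬ x              ∎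

  ¬≈⊤⇒≈⊥ : ∀ {x} → ¬ x ≈ ⊤ → x ≈ ⊥
  ¬≈⊤⇒≈⊥ {x} p = begin
    x        ≈⟨ ∧-identityʳ x ⟨
    x ∧ ⊤    ≈⟨ ∧-cong refl p ⟨
    x ∧ ¬ x  ≈⟨ ∧-complementʳ x ⟩
    ⊥        ∎

  c-mono : ∀ i {x y} → x ≤ᴬ y → c i x ≤ᴬ c i y
  c-mono i {x} {y} p = trans (c-cong i (≤ᴬ-trans p (c-increasing i y))) (c-∧-c i x y)

  c-∧-fixed : ∀ i {x y} → Fixed i y → c i (x ∧ y) ≈ c i x ∧ y
  c-∧-fixed i {x} {y} p = trans (c-cong i (∧-cong refl (sym p))) (trans (c-∧-c i x y) (∧-cong refl p))

  c-fixed-∧ˡ : ∀ i {x y} → Fixed i x → c i (x ∧ y) ≈ x ∧ c i y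
  c-fixed-∧ˡ i {x} {y} p = trans (c-cong i (∧-comm x y)) (trans (c-∧-fixed i p) (∧-comm _ _))

  ≈⊥⇐c : ∀ i {x} → c i x ≈ ⊥ → x ≈ ⊥
  ≈⊥⇐c i {x} p = ≤⊥ (c-increasing i x) p

  -- Cylindrifications are self-conjugate: the meet lies below `c i x ∧ c i y`, which is
  -- `c i (x ∧ c i y)`.
  c-conjugate : ∀ i {x y} → x ∧ c i y ≈ ⊥ → c i x ∧ y ≈ ⊥
  c-conjugate i {x} {y} p = ≤⊥ (∧-mono (≤ᴬ-reflexive refl) (c-increasing i y))
      (trans (sym (c-∧-c i x y)) (trans (c-cong i p) (c-⊥ i)))

  ⊤-below : ∀ {x} → ⊤ ≤ᴬ x → x ≈ ⊤
  ⊤-below {x} p = trans (sym (∧-identityˡ x)) (sym p)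

  c-dˡ : ∀ i j → i ≢ j → c i (d i j) ≈ ⊤
  c-dˡ i j i≢j = ⊤-below (≤ᴬ-trans (≤ᴬ-reflexive (trans (sym (d-refl j)) (d-trans j j i i≢j i≢j)))
      (c-mono i (∧-lowerʳ _ _)))

  c-dʳ : ∀ i j → i ≢ j → c j (d i j) ≈ ⊤
  c-dʳ i j i≢j = ⊤-below (≤ᴬ-trans (≤ᴬ-reflexive (trans (sym (d-refl i)) (d-trans i i j j≢i j≢i)))
      (c-mono j (∧-lowerˡ _ _)))
    where
    j≢i : j ≢ i
    j≢i p = i≢j (≡.sym p)

  infix 9 _⟨_≔_⟩

  -- The substitution operator usually written s with upper index `a` and lower index `b`: for
  -- `a ≢ b` a tuple belongs to it if it belongs to `x` once its entry at `a` is replaced by its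
  -- entry at `b`.
  _⟨_≔_⟩ : Carrier → Fin N → Fin N → Carrier
  x ⟨ a ≔ b ⟩ = c a (d a b ∧ x)

  s-cong : ∀ {a b x y} → x ≈ y → x ⟨ a ≔ b ⟩ ≈ y ⟨ a ≔ b ⟩
  s-cong p = c-cong _ (∧-cong refl p)

  s-mono : ∀ {a b x y} → x ≤ᴬ y → x ⟨ a ≔ b ⟩ ≤ᴬ y ⟨ a ≔ b ⟩
  s-mono p = c-mono _ (∧-mono (≤ᴬ-reflexive refl) p)

  s-fixed : ∀ {a b x} → Fixed a (x ⟨ a ≔ b ⟩)
  s-fixed {a} = c-idem C a _

  s-fixed-off : ∀ {a b e x} → e ≢ a → e ≢ b → Fixed e x → Fixed e (x ⟨ a ≔ b ⟩)
  s-fixed-off {a} {b} {e} e≢a e≢b p = c-fixed-c C e a (c-fixed-∧ C e (c-fixed-d C e a b e≢a e≢b) p)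

  s-disjoint : ∀ {a b x y} → a ≢ b → x ∧ y ≈ ⊥ → x ⟨ a ≔ b ⟩ ∧ y ⟨ a ≔ b ⟩ ≈ ⊥
  s-disjoint {a} {b} {x} a≢b p = ≤⊥ (∧-mono (≤ᴬ-reflexive refl) (s-mono (disjoint⇒≤¬ p))) (c-d-∧ a b x a≢b)

  s-∧-fixed : ∀ {a b x y} → Fixed a x → (x ∧ y) ⟨ a ≔ b ⟩ ≈ x ∧ y ⟨ a ≔ b ⟩
  s-∧-fixed {a} {b} {x} {y} p = trans (c-cong a swap) (c-fixed-∧ˡ a p)
    where
    swap : d a b ∧ (x ∧ y) ≈ x ∧ (d a b ∧ y)
    swap = trans (sym (∧-assoc _ _ _)) (trans (∧-cong (∧-comm _ _) refl) (∧-assoc _ _ _))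

  -- An element that does not depend on `a` can be pulled inside the substitution. In this way a
  -- disjointness of three elements is carried to the spare dimensions one coordinate at a time.
  s-triple : ∀ {a b x y z} → a ≢ b → Fixed a x → x ∧ (y ∧ z) ≈ ⊥ → x ∧ (y ⟨ a ≔ b ⟩ ∧ z ⟨ a ≔ b ⟩) ≈ ⊥
  s-triple {a} {b} {x} {y} {z} a≢b p q = begin
    x ∧ (y ⟨ a ≔ b ⟩ ∧ z ⟨ a ≔ b ⟩)  ≈⟨ ∧-assoc _ _ _ ⟨
    (x ∧ y ⟨ a ≔ b ⟩) ∧ z ⟨ a ≔ b ⟩  ≈⟨ ∧-cong (s-∧-fixed p) refl ⟨
    (x ∧ y) ⟨ a ≔ b ⟩ ∧ z ⟨ a ≔ b ⟩  ≈⟨ s-disjoint a≢b (trans (∧-assoc _ _ _) q) ⟩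
    ⊥                                ∎

  rotate : ∀ {x y z} → x ∧ (y ∧ z) ≈ ⊥ → z ∧ (x ∧ y) ≈ ⊥
  rotate p = trans (∧-comm _ _) (trans (∧-assoc _ _ _) p)

  s-cancel : ∀ {a b x} → a ≢ b → c a x ∧ d a b ≈ ⊥ → x ≈ ⊥
  s-cancel {a} {b} {x} a≢b p = ≈⊥⇐c a (begin
    c a x              ≈⟨ ∧-identityʳ _ ⟨
    c a x ∧ ⊤          ≈⟨ ∧-cong refl (c-dˡ a b a≢b) ⟨
    c a x ∧ c a (d a b)  ≈⟨ c-fixed-∧ˡ a (c-idem C a x) ⟨
    c a (c a x ∧ d a b)  ≈⟨ c-cong a p ⟩
    c a ⊥              ≈⟨ c-⊥ a ⟩
    ⊥                  ∎)

  -- The map from `x` to `c a x ∧ d a b` is conjugate to the substitution, so a disjointness from a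
  -- substituted element turns into one from the element itself.
  s-conjugate : ∀ {a b x y} → x ∧ y ⟨ a ≔ b ⟩ ≈ ⊥ → (c a x ∧ d a b) ∧ y ≈ ⊥
  s-conjugate p = trans (∧-assoc _ _ _) (c-conjugate _ p)

  s-move : ∀ {a b e x} → a ≢ b → b ≢ e → a ≢ e → Fixed b x → x ⟨ a ≔ b ⟩ ⟨ b ≔ e ⟩ ≈ x ⟨ a ≔ e ⟩
  s-move {a} {b} {e} {x} a≢b b≢e a≢e p = begin
    c b (d b e ∧ c a (d a b ∧ x))    ≈⟨ c-cong b (c-fixed-∧ˡ a (c-fixed-d C a b e a≢b a≢e)) ⟨
    c b (c a (d b e ∧ (d a b ∧ x)))  ≈⟨ c-comm b a _ ⟩
    c a (c b (d b e ∧ (d a b ∧ x)))  ≈⟨ c-cong a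
        (c-cong b (trans (sym (∧-assoc _ _ _)) (∧-cong (∧-comm _ _) refl))) ⟩
    c a (c b ((d a b ∧ d b e) ∧ x))  ≈⟨ c-cong a (c-∧-fixed b p) ⟩
    c a (c b (d a b ∧ d b e) ∧ x)    ≈⟨ c-cong a (∧-cong (d-trans a e b (λ q → a≢b (≡.sym q)) b≢e) refl) ⟨
    c a (d a e ∧ x)                  ∎

  s-comm : ∀ {a α b β x} → a ≢ b → a ≢ β → b ≢ α → x ⟨ b ≔ β ⟩ ⟨ a ≔ α ⟩ ≈ x ⟨ a ≔ α ⟩ ⟨ b ≔ β ⟩
  s-comm {a} {α} {b} {β} {x} a≢b a≢β b≢α = begin
    c a (d a α ∧ c b (d b β ∧ x))    ≈⟨ c-cong a (c-fixed-∧ˡ b (c-fixed-d C b a α (λ p → a≢b (≡.sym p)) b≢α)) ⟨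
    c a (c b (d a α ∧ (d b β ∧ x)))  ≈⟨ c-comm a b _ ⟩
    c b (c a (d a α ∧ (d b β ∧ x)))  ≈⟨ c-cong b
        (c-cong a (trans (sym (∧-assoc _ _ _)) (trans (∧-cong (∧-comm _ _) refl) (∧-assoc _ _ _)))) ⟩
    c b (c a (d b β ∧ (d a α ∧ x)))  ≈⟨ c-cong b (c-fixed-∧ˡ a (c-fixed-d C a b β a≢b a≢β)) ⟩
    c b (d b β ∧ c a (d a α ∧ x))    ∎

  c-s : ∀ {a e x} → a ≢ e → Fixed e x → c e (x ⟨ a ≔ e ⟩) ≈ c a x
  c-s {a} {e} {x} a≢e p = begin
    c e (c a (d a e ∧ x))  ≈⟨ c-comm e a _ ⟩
    c a (c e (d a e ∧ x))  ≈⟨ c-cong a (c-∧-fixed e p) ⟩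
    c a (c e (d a e) ∧ x)  ≈⟨ c-cong a (∧-cong (c-dʳ a e a≢e) refl) ⟩
    c a (⊤ ∧ x)            ≈⟨ c-cong a (∧-identityˡ x) ⟩
    c a x                  ∎

  meets : ∀ {e x y} → Fixed e x → x ≤ᴬ c e y → x ∧ y ≈ ⊥ → x ≈ ⊥
  meets {e} {x} {y} p q r = begin
    x            ≈⟨ q ⟩
    x ∧ c e y    ≈⟨ c-fixed-∧ˡ e p ⟨
    c e (x ∧ y)  ≈⟨ c-cong e r ⟩
    c e ⊥        ≈⟨ c-⊥ e ⟩
    ⊥            ∎

open import Axiom.ExcludedMiddle using (ExcludedMiddle)
open import Data.Bool.Base using (Bool; false; not; true)
import Data.Bool.Properties as Bool
open import Data.Empty using (⊥; ⊥-elim)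
open import Data.Fin.Base
  using (Fin; combine; fromℕ<; inject≤; punchIn; punchOut; reduce≥; remQuot; splitAt; suc; toℕ; zero; _↑ʳ_;
    _↑ˡ_)
open import Data.Fin.Properties as Fin
  using (fromℕ<-toℕ; injective⇒≤; inject≤-injective; punchIn-punchOut; remQuot-combine; splitAt-↑ʳ; splitAt-↑ˡ;
    toℕ-inject≤; toℕ-↑ʳ; toℕ<n)
open import Data.List.Base using (List; allFin; drop; length; map; replicate; take; []; _++_; _∷_)
open import Data.List.Membership.Propositional using (_∈_)
open import Data.List.Membership.Propositional.Properties using (∈-allFin)
open import Data.List.Properties using (length-replicate; length-take; take++drop≡id)
open import Data.List.Relation.Binary.Pointwise as Pointwise using (Pointwise; []; _∷_)
open import Data.List.Relation.Unary.All as All using (All; []; _∷_)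
open import Data.List.Relation.Unary.All.Properties as All using ()
open import Data.List.Relation.Unary.Any using (here; there)
open import Data.Maybe.Base as Maybe using (Maybe; just; nothing)
open import Data.Maybe.Properties using (just-injective)
open import Data.Nat.Base using (suc; s≤s; zero; z≤n; ℕ; _*_; _+_; _<_; _>_; _≤_; _⊓_; _⊔_)
open import Data.Nat.Induction using (<-wellFounded)
open import Data.Nat.Properties as ℕ
open import Data.Product.Base using (proj₁; proj₂; Σ; Σ-syntax; ∃-syntax; _,_; _×_)
open import Data.Product.Relation.Binary.Lex.Strict using (×-Lex; ×-compare; ×-transitive; ×-wellFounded)
open import Data.Sum.Base using (inj₁; inj₂; [_,_]′; _⊎_)
open import Data.Unit.Base using (tt; ⊤)
open import Data.Vec.Base as Vec using (Vec; lookup; tabulate; []; _[_]≔_; _∷_)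
open import Data.Vec.Functional using () renaming (_∷_ to _◂_)
open import Data.Vec.Properties as Vec
  using (++-injectiveˡ; lookup-map; lookup-replicate; lookup-take-inject≤; lookup∘tabulate; lookup∘update;
    lookup∘update′; map-cong; map-∘; tabulate-cong; tabulate-∘; tabulate∘lookup)
open import Function.Base using (const; id; _∘_)
open import Function.Bundles using (Equivalence)
open import Induction.WellFounded using (Acc; acc)
open import Level using (0ℓ; Level)
open import Relation.Binary.Core using (Rel)
open import Relation.Binary.Definitions using (tri<; tri>; tri≈)
open import Relation.Binary.PropositionalEquality
  using (cong; cong₂; isEquivalence; refl; resp₂; subst; subst₂; sym; trans; _≡_; _≢_)
open import Relation.Nullary.Decidable.Core using (Dec; does; no; yes)
open import Relation.Nullary.Negation.Core using (contradiction; ¬_)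
open import Relation.Unary using (Pred; _⊆_)

-- Ranks and thresholds.

-- fin (k , r) d stands for the ordinal ω²·k + ω·r + d, and the threshold (k , r) for ω²·k + ω·r; the rank
-- ∞ lies above all of them and, unlike them, below itself.
Threshold : Set
Threshold = ℕ × ℕ

infix 4 _<ᵗ_ _≤ᵗ_ _≺_

_<ᵗ_ _≤ᵗ_ : Rel Threshold 0ℓ
_<ᵗ_ = ×-Lex _≡_ _<_ _<_
γ ≤ᵗ δ = γ ≡ δ ⊎ γ <ᵗ δ

<ᵗ-trans : ∀ {γ δ η} → γ <ᵗ δ → δ <ᵗ η → γ <ᵗ η
<ᵗ-trans = ×-transitive {_<₂_ = _<_} isEquivalence (resp₂ _<_) <-trans <-trans

≤ᵗ-<ᵗ-trans : ∀ {γ δ η} → γ ≤ᵗ δ → δ <ᵗ η → γ <ᵗ η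
≤ᵗ-<ᵗ-trans (inj₁ refl) q = q
≤ᵗ-<ᵗ-trans (inj₂ p) q = <ᵗ-trans p q

<ᵗ-≤ᵗ-trans : ∀ {γ δ η} → γ <ᵗ δ → δ ≤ᵗ η → γ <ᵗ η
<ᵗ-≤ᵗ-trans p (inj₁ refl) = p
<ᵗ-≤ᵗ-trans p (inj₂ q) = <ᵗ-trans p q

≤ᵗ-trans : ∀ {γ δ η} → γ ≤ᵗ δ → δ ≤ᵗ η → γ ≤ᵗ η
≤ᵗ-trans (inj₁ refl) q = q
≤ᵗ-trans (inj₂ p) q = inj₂ (<ᵗ-≤ᵗ-trans p q)

≰ᵗ⇒>ᵗ : ∀ {γ δ} → ¬ (γ ≤ᵗ δ) → δ <ᵗ γ
≰ᵗ⇒>ᵗ {γ} {δ} γ≰δ with ×-compare sym <-cmp <-cmp γ δ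
... | tri< γ<δ _ _ = contradiction (inj₂ γ<δ) γ≰δ
... | tri≈ _ (refl , refl) _ = contradiction (inj₁ refl) γ≰δ
... | tri> _ _ δ<γ = δ<γ

data Rank : Set where
  ∞   : Rank
  fin : Threshold → ℕ → Rank

_≺_ : Rel Rank 0ℓ
ρ       ≺ ∞       = ⊤
∞       ≺ fin _ _ = ⊥
fin γ d ≺ fin δ e = ×-Lex _≡_ _<ᵗ_ _<_ (γ , d) (δ , e)

Finite : Rank → Set
Finite ∞         = ⊥
Finite (fin _ _) = ⊤

≺-finite : ∀ {ρ σ} → Finite σ → ρ ≺ σ → Finite ρ
≺-finite {fin _ _} _ _ = tt
≺-finite {∞} {fin _ _} _ ()

≺-acc : ∀ {ρ} → Finite ρ → Acc _≺_ ρ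
≺-acc {fin γ d} _ = go (×-wellFounded (×-wellFounded <-wellFounded <-wellFounded) <-wellFounded (γ , d))
  where
  go : ∀ {γ d} → Acc (×-Lex _≡_ _<ᵗ_ _<_) (γ , d) → Acc _≺_ (fin γ d)
  go (acc h) = acc λ { {∞} () ; {fin _ _} p → go (h p) }

High : Threshold → Rank → Set
High γ ∞         = ⊤
High γ (fin δ _) = γ ≤ᵗ δ

High-≤ : ∀ {γ δ} ρ → δ ≤ᵗ γ → High γ ρ → High δ ρ
High-≤ ∞         _ _ = tt
High-≤ (fin _ _) p q = ≤ᵗ-trans p q

High-≺ : ∀ {γ} ρ σ → ρ ≺ σ → High γ ρ → High γ σ
High-≺ ρ ∞ _ _ = tt
High-≺ (fin _ _) (fin _ _) (inj₁ p) q = inj₂ (≤ᵗ-<ᵗ-trans q p)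
High-≺ (fin _ _) (fin _ _) (inj₂ (refl , _)) q = q

-- A record rather than a bare sum, because `High` computes and the ranks and the threshold could
-- not be recovered from its unfolding.
record _≈[_]_ (ρ : Rank) (γ : Threshold) (σ : Rank) : Set where
  constructor mk≈
  field
    unlessHigh : ρ ≡ σ ⊎ High γ ρ × High γ σ
open _≈[_]_

≈-refl : ∀ {γ ρ} → ρ ≈[ γ ] ρ
≈-refl = mk≈ (inj₁ refl)

≈-sym : ∀ {γ ρ σ} → ρ ≈[ γ ] σ → σ ≈[ γ ] ρ
≈-sym (mk≈ (inj₁ p)) = mk≈ (inj₁ (sym p))
≈-sym (mk≈ (inj₂ (p , q))) = mk≈ (inj₂ (q , p))

≈-trans : ∀ {γ ρ σ τ} → ρ ≈[ γ ] σ → σ ≈[ γ ] τ → ρ ≈[ γ ] τ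
≈-trans (mk≈ (inj₁ refl)) q = q
≈-trans p (mk≈ (inj₁ refl)) = p
≈-trans (mk≈ (inj₂ (p , _))) (mk≈ (inj₂ (_ , q))) = mk≈ (inj₂ (p , q))

≈-weaken : ∀ {γ δ ρ σ} → δ ≤ᵗ γ → ρ ≈[ γ ] σ → ρ ≈[ δ ] σ
≈-weaken _ (mk≈ (inj₁ p)) = mk≈ (inj₁ p)
≈-weaken {ρ = ρ} {σ} l (mk≈ (inj₂ (p , q))) = mk≈ (inj₂ (High-≤ ρ l p , High-≤ σ l q))

-- Nodes of the tree and similarity of families of nodes.

-- The number beside the rank gives every node infinitely many children of each admissible rank, so
-- that a child avoiding finitely many given ones always exists.
Entry Node : Set
Entry = Rank × ℕ
Node = List Entry

rank : Entry → Rank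
rank = proj₁

copy : Entry → ℕ
copy = proj₂

Similar : Threshold → Rel Node 0ℓ
Similar γ = Pointwise (λ x y → rank x ≈[ γ ] rank y)

data Descends (ρ : Rank) : Node → Set where
  []  : Descends ρ []
  _∷_ : ∀ {x xs} → rank x ≺ ρ → Descends (rank x) xs → Descends ρ (x ∷ xs)

Valid : Node → Set
Valid = Descends ∞

NoInf : Node → Set
NoInf = All (Finite ∘ rank)

Copies< : ℕ → Node → Set
Copies< c = All (λ x → copy x < c)

data Agree : ℕ → Node → Node → Set where
  zero : ∀ {xs ys} → Agree zero xs ys
  suc  : ∀ {ℓ x xs ys} → Agree ℓ xs ys → Agree (suc ℓ) (x ∷ xs) (x ∷ ys)

Agree-refl : ∀ {ℓ xs} → ℓ ≤ length xs → Agree ℓ xs xs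
Agree-refl {zero} _ = zero
Agree-refl {suc _} {_ ∷ _} (s≤s p) = suc (Agree-refl p)

Agree-sym : ∀ {ℓ xs ys} → Agree ℓ xs ys → Agree ℓ ys xs
Agree-sym zero = zero
Agree-sym (suc p) = suc (Agree-sym p)

Agree-trans : ∀ {ℓ xs ys zs} → Agree ℓ xs ys → Agree ℓ ys zs → Agree ℓ xs zs
Agree-trans zero zero = zero
Agree-trans (suc p) (suc q) = suc (Agree-trans p q)

Agree-≤ : ∀ {ℓ k xs ys} → k ≤ ℓ → Agree ℓ xs ys → Agree k xs ys
Agree-≤ z≤n _ = zero
Agree-≤ (s≤s k≤ℓ) (suc p) = suc (Agree-≤ k≤ℓ p)

Agree-length : ∀ {ℓ xs ys} → Agree ℓ xs ys → ℓ ≤ length xs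
Agree-length zero = z≤n
Agree-length (suc p) = s≤s (Agree-length p)

Agree-lengthʳ : ∀ {ℓ xs ys} → Agree ℓ xs ys → ℓ ≤ length ys
Agree-lengthʳ = Agree-length ∘ Agree-sym

Agree⇒≡ : ∀ {xs ys} → length xs ≡ length ys → Agree (length xs) xs ys → xs ≡ ys
Agree⇒≡ {[]} {[]} _ _ = refl
Agree⇒≡ {_ ∷ _} {_ ∷ _} p (suc q) = cong (_ ∷_) (Agree⇒≡ (suc-injective p) q)

Agree-take : ∀ {ℓ} xs → ℓ ≤ length xs → Agree ℓ xs (take ℓ xs)
Agree-take {zero} xs _ = zero
Agree-take {suc _} (_ ∷ xs) (s≤s p) = suc (Agree-take xs p)

Agree-++ : ∀ xs zs → Agree (length xs) xs (xs ++ zs)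
Agree-++ [] zs = zero
Agree-++ (_ ∷ xs) zs = suc (Agree-++ xs zs)

Descends-take : ∀ {ρ xs} ℓ → Descends ρ xs → Descends ρ (take ℓ xs)
Descends-take zero _ = []
Descends-take (suc ℓ) [] = []
Descends-take (suc ℓ) (p ∷ ps) = p ∷ Descends-take ℓ ps

-- The nodes are read from the root; two families are similar if they span the same subtree and their
-- ranks agree as far as they lie below the threshold.
record _~[_]_ {I : Set} (p : I → Node) (γ : Threshold) (q : I → Node) : Set where
  field
    agree→ : ∀ i j ℓ → Agree ℓ (p i) (p j) → Agree ℓ (q i) (q j)
    agree← : ∀ i j ℓ → Agree ℓ (q i) (q j) → Agree ℓ (p i) (p j)
    ranks  : ∀ i → Similar γ (p i) (q i)
open _~[_]_ public

module _ {I : Set} where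
  ~-refl : ∀ {γ} {p : I → Node} → p ~[ γ ] p
  ~-refl = record { agree→ = λ _ _ _ a → a ; agree← = λ _ _ _ a → a ; ranks = λ _ → Pointwise.refl ≈-refl }

  ~-sym : ∀ {γ} {p q : I → Node} → p ~[ γ ] q → q ~[ γ ] p
  ~-sym h = record { agree→ = agree← h ; agree← = agree→ h ; ranks = λ i → Pointwise.symmetric ≈-sym
      (ranks h i) }

  ~-trans : ∀ {γ} {p q r : I → Node} → p ~[ γ ] q → q ~[ γ ] r → p ~[ γ ] r
  ~-trans g h = record
    { agree→ = λ i j ℓ → agree→ h i j ℓ ∘ agree→ g i j ℓ
    ; agree← = λ i j ℓ → agree← g i j ℓ ∘ agree← h i j ℓ
    ; ranks  = λ i → Pointwise.transitive ≈-trans (ranks g i) (ranks h i)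
    }

  ~-weaken : ∀ {γ δ} {p q : I → Node} → δ ≤ᵗ γ → p ~[ γ ] q → p ~[ δ ] q
  ~-weaken l h = record { agree→ = agree→ h ; agree← = agree← h ; ranks = λ i → Pointwise.map (≈-weaken l)
      (ranks h i) }

  ~-length : ∀ {γ} {p q : I → Node} → p ~[ γ ] q → ∀ i → length (p i) ≡ length (q i)
  ~-length h i = Pointwise.Pointwise-length (ranks h i)

  ~-reindex : ∀ {J : Set} {γ} {p q : I → Node} {p′ q′ : J → Node} (f : J → I) →
              (∀ j → p′ j ≡ p (f j)) → (∀ j → q′ j ≡ q (f j)) → p ~[ γ ] q → p′ ~[ γ ] q′
  ~-reindex f p≡ q≡ h = record
    { agree→ = λ i j ℓ a → cast (sym (q≡ i)) (sym (q≡ j)) (agree→ h (f i) (f j) ℓ (cast (p≡ i) (p≡ j) a))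
    ; agree← = λ i j ℓ a → cast (sym (p≡ i)) (sym (p≡ j)) (agree← h (f i) (f j) ℓ (cast (q≡ i) (q≡ j) a))
    ; ranks  = λ j → castᴾ (sym (p≡ j)) (sym (q≡ j)) (ranks h (f j))
    }
    where
    cast : ∀ {ℓ xs xs′ ys ys′} → xs ≡ xs′ → ys ≡ ys′ → Agree ℓ xs ys → Agree ℓ xs′ ys′
    cast refl refl a = a
    castᴾ : ∀ {γ xs xs′ ys ys′} → xs ≡ xs′ → ys ≡ ys′ →
            Similar γ xs ys → Similar γ xs′ ys′
    castᴾ refl refl a = a

  -- The agreements of p i with itself determine its length, so equality of nodes is preserved.
  ~-≡ : ∀ {γ} {p q : I → Node} → p ~[ γ ] q → ∀ {i j} → p i ≡ p j → q i ≡ q j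
  ~-≡ {p = p} {q} h {i} {j} e = Agree⇒≡ len
    (agree→ h i j _ (subst (Agree _ (p i)) e (Agree-refl (≤-reflexive (sym (~-length h i))))))
    where
    len : length (q i) ≡ length (q j)
    len = trans (sym (~-length h i)) (trans (cong length e) (~-length h j))

-- Extending a similarity by one node.

module Extension (em : ExcludedMiddle 0ℓ) where

  -- The ranks from δ up to δ + ω are the room in which a descending chain of any finite length can
  -- be placed; ranks below δ are visible and stay as they are.
  lower : Threshold → ℕ → Rank → Rank
  lower δ m ρ with em {High δ ρ}
  ... | yes _ = fin δ m
  ... | no  _ = ρ

  lower-finite : ∀ δ m ρ → Finite (lower δ m ρ)
  lower-finite δ m ρ with em {High δ ρ}
  lower-finite δ m ρ | yes _ = tt
  lower-finite δ m ∞ | no ¬h = ¬h tt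
  lower-finite δ m (fin _ _) | no _ = tt

  lower-≈ : ∀ δ m ρ → ρ ≈[ δ ] lower δ m ρ
  lower-≈ δ m ρ with em {High δ ρ}
  ... | yes h = mk≈ (inj₂ (h , inj₁ refl))
  ... | no  _ = ≈-refl

  lower-mono : ∀ {δ m m′} ρ σ → m < m′ → ρ ≺ σ → lower δ m ρ ≺ lower δ m′ σ
  lower-mono {δ} ρ σ m<m′ ρ≺σ with em {High δ ρ} | em {High δ σ}
  lower-mono ρ σ m<m′ ρ≺σ | yes _ | yes _ = inj₂ (refl , m<m′)
  lower-mono ρ σ m<m′ ρ≺σ | yes h | no ¬h = contradiction (High-≺ ρ σ ρ≺σ h) ¬h
  lower-mono ∞ σ m<m′ ρ≺σ | no ¬h | yes _ = contradiction tt ¬h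
  lower-mono (fin _ _) σ m<m′ ρ≺σ | no ¬h | yes _ = inj₁ (≰ᵗ⇒>ᵗ ¬h)
  lower-mono ρ σ m<m′ ρ≺σ | no _ | no _ = ρ≺σ

  lower-top : ∀ {γ δ m} ρ σ → δ <ᵗ γ → High γ σ → lower δ m ρ ≺ σ
  lower-top ρ ∞ _ _ = tt
  lower-top {δ = δ} ρ (fin _ _) δ<γ h with em {High δ ρ}
  ... | yes _ = inj₁ (<ᵗ-≤ᵗ-trans δ<γ h)
  lower-top ∞ (fin _ _) δ<γ h | no ¬h = contradiction tt ¬h
  lower-top (fin _ _) (fin _ _) δ<γ h | no ¬h = inj₁ (<ᵗ-trans (≰ᵗ⇒>ᵗ ¬h) (<ᵗ-≤ᵗ-trans δ<γ h))

  module _ (c : ℕ) where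
    Fresh : Node → Set
    Fresh = All (λ x → copy x ≡ c)

    lowerAll : Threshold → Node → Node
    lowerAll δ []       = []
    -- The number of remaining entries is the finite part of the new rank, so lowered ranks still
    -- descend.
    lowerAll δ (x ∷ xs) = (lower δ (suc (length xs)) (rank x) , c) ∷ lowerAll δ xs

    lowerAll-descends : ∀ {δ ρ σ} xs → Descends ρ xs →
                        (∀ {τ} → τ ≺ ρ → lower δ (length xs) τ ≺ σ) → Descends σ (lowerAll δ xs)
    lowerAll-descends [] [] _ = []
    lowerAll-descends (x ∷ xs) (p ∷ ps) below =
      below p ∷ lowerAll-descends xs ps (λ {τ} → lower-mono τ (rank x) ≤-refl)

    lowerAll-≈ : ∀ δ xs → Similar δ xs (lowerAll δ xs)
    lowerAll-≈ δ []       = []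
    lowerAll-≈ δ (x ∷ xs) = lower-≈ δ _ _ ∷ lowerAll-≈ δ xs

    lowerAll-noInf : ∀ δ xs → NoInf (lowerAll δ xs)
    lowerAll-noInf δ []       = []
    lowerAll-noInf δ (x ∷ xs) = lower-finite δ _ _ ∷ lowerAll-noInf δ xs

    lowerAll-fresh : ∀ δ xs → Fresh (lowerAll δ xs)
    lowerAll-fresh δ []       = []
    lowerAll-fresh δ (x ∷ xs) = refl ∷ lowerAll-fresh δ xs

    recopy : Node → Node
    recopy = map (λ x → rank x , c)

    recopy-descends : ∀ {ρ} xs → Descends ρ xs → Descends ρ (recopy xs)
    recopy-descends [] [] = []
    recopy-descends (x ∷ xs) (p ∷ ps) = p ∷ recopy-descends xs ps

    recopy-≈ : ∀ δ xs → Similar δ xs (recopy xs)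
    recopy-≈ δ []       = []
    recopy-≈ δ (x ∷ xs) = ≈-refl ∷ recopy-≈ δ xs

    recopy-noInf : ∀ {ρ} xs → Finite ρ → Descends ρ xs → NoInf (recopy xs)
    recopy-noInf [] _ [] = []
    recopy-noInf {ρ} (x ∷ xs) f (p ∷ ps) = ≺-finite f p ∷ recopy-noInf xs (≺-finite f p) ps

    recopy-fresh : ∀ xs → Fresh (recopy xs)
    recopy-fresh []       = []
    recopy-fresh (x ∷ xs) = refl ∷ recopy-fresh xs

    record Graft (δ : Threshold) (σ : Rank) (stem tail : Node) : Set where
      field
        scion     : Node
        descends  : Descends σ (stem ++ scion)
        similar   : Similar δ tail scion
        fresh     : Fresh scion
        noInf     : NoInf stem → NoInf scion

    -- Below a high rank there is room to lower all high ranks of the tail to δ and a bit;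
    -- below a low rank both sides have the same ranks, so the tail can be copied.
    graft : ∀ {γ δ ρ σ} xs ys tail → δ <ᵗ γ → ρ ≈[ γ ] σ → (High γ σ ⊎ Finite σ) →
            Descends ρ (xs ++ tail) → Descends σ ys →
            Similar γ xs ys → Graft δ σ ys tail
    graft {γ} {δ} {ρ} {σ} [] [] tail δ<γ ρ≈σ _ ds [] [] with em {High γ σ}
    ... | yes h = record
      { descends = lowerAll-descends tail ds (λ {τ} _ → lower-top τ σ δ<γ h)
      ; similar = lowerAll-≈ δ tail ; fresh = lowerAll-fresh δ tail ; noInf = λ _ → lowerAll-noInf δ tail }
    graft [] [] tail δ<γ (mk≈ (inj₂ (_ , h))) _ ds [] [] | no ¬h = contradiction h ¬h
    graft [] [] tail δ<γ _ (inj₁ h) ds [] [] | no ¬h = contradiction h ¬h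
    graft {δ = δ} [] [] tail δ<γ (mk≈ (inj₁ refl)) (inj₂ f) ds [] [] | no ¬h = record
      { descends = recopy-descends tail ds
      ; similar = recopy-≈ δ tail ; fresh = recopy-fresh tail ; noInf = λ _ → recopy-noInf tail f ds }
    graft (x ∷ xs) (y ∷ ys) tail δ<γ ρ≈σ _ (p ∷ ps) (q ∷ qs) (x≈y ∷ xs≈ys) = record
      { descends = q ∷ Graft.descends rest
      ; similar = Graft.similar rest ; fresh = Graft.fresh rest
      ; noInf = λ { (_ ∷ f) → Graft.noInf rest f } }
      where
      split : ∀ ρ → High _ ρ ⊎ Finite ρ
      split ∞ = inj₁ tt
      split (fin _ _) = inj₂ tt
      rest = graft xs ys tail δ<γ x≈y (split (rank y)) ps qs xs≈ys

    -- The copy number `c` exceeds all those in `ys`, so the two nodes part at the first entry of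
    -- the scion at the latest.
    no-agreement : ∀ {ys k} xs zs → Copies< c ys → Fresh zs → length xs < k → ¬ Agree k (xs ++ zs) ys
    no-agreement [] [] _ _ (s≤s _) ()
    no-agreement [] (z ∷ zs) (p ∷ _) (refl ∷ _) _ (suc _) = <-irrefl refl p
    no-agreement (x ∷ xs) zs (_ ∷ ps) fs (s≤s l) (suc a) = no-agreement xs zs ps fs l a

  Longest : {I : Set} (p : I → Node) (a : Node) → Set
  Longest p a = Σ[ ℓ ∈ ℕ ] ℓ ≤ length a × (ℓ ≡ 0 ⊎ ∃[ i ] Agree ℓ a (p i)) × (∀ j k → Agree k a (p j) → k ≤ ℓ)

  longest : ∀ {I : Set} (p : I → Node) a → Longest p a
  longest p a = go (length a) ≤-refl (λ _ _ → Agree-length)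
    where
    go : ∀ ℓ → ℓ ≤ length a → (∀ j k → Agree k a (p j) → k ≤ ℓ) → Longest p a
    go zero l b = zero , l , inj₁ refl , b
    go (suc ℓ) l b with em {∃[ i ] Agree (suc ℓ) a (p i)}
    ... | yes h = suc ℓ , l , inj₂ h , b
    ... | no ¬h = go ℓ (<⇒≤ l) λ j k h → ≤-pred (≤∧≢⇒< (b j k h) λ { refl → ¬h (j , h) })

  infixl 5 _▹_
  _▹_ : ∀ {I : Set} → (I → Node) → Node → I ⊎ ⊤ → Node
  p ▹ a = [ p , const a ]′

  extend : ∀ {I : Set} {p q : I → Node} {γ δ c} → δ <ᵗ γ → p ~[ γ ] q → (∀ i → Valid (q i)) →
           (∀ i → Copies< c (q i)) → ∀ a → Valid a →
           Σ[ b ∈ Node ] Valid b × ((p ▹ a) ~[ δ ] (q ▹ b)) × ((∀ i → NoInf (q i)) → NoInf b)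
  extend {I} {p} {q} {γ} {δ} {c} δ<γ p~q vq cq a va = b , G.descends , similarity , noInf
    where
    top = longest p a
    ℓ = proj₁ top
    ℓ≤a = proj₁ (proj₂ top)
    bound = proj₂ (proj₂ (proj₂ top))

    record Stem : Set where
      field
        stem   : Node
        len    : length stem ≡ ℓ
        valid  : Valid stem
        head≈  : Similar γ (take ℓ a) stem
        stem→  : ∀ j k → k ≤ ℓ → Agree k a (p j) → Agree k stem (q j)
        stem←  : ∀ j k → k ≤ ℓ → Agree k stem (q j) → Agree k a (p j)
        finite : (∀ i → NoInf (q i)) → NoInf stem

    mkStem : ∀ {m} → m ≡ ℓ → m ≡ 0 ⊎ ∃[ i ] Agree m a (p i) → Stem
    mkStem e (inj₁ refl) = record
      { stem = [] ; len = e ; valid = []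
      ; head≈ = subst (λ l → Similar γ (take l a) []) e []
      ; stem→ = λ _ k k≤ _ → nil e k≤
      ; stem← = λ _ k k≤ _ → nil e k≤
      ; finite = λ _ → [] }
      where
      nil : ∀ {k xs ys} → 0 ≡ ℓ → k ≤ ℓ → Agree k xs ys
      nil {k} {xs} {ys} e k≤ = subst (λ m → Agree m xs ys) (sym (n≤0⇒n≡0 (subst (k ≤_) (sym e) k≤))) zero
    mkStem refl (inj₂ (i , h)) = record
      { stem = take ℓ (q i)
      ; len = trans (length-take ℓ (q i)) (m≤n⇒m⊓n≡m ℓ≤q)
      ; valid = Descends-take ℓ (vq i)
      ; head≈ = Pointwise-take (ranks p~q i) h
      ; stem→ = λ j k k≤ g → Agree-trans (Agree-≤ k≤ (Agree-sym (Agree-take (q i) ℓ≤q)))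
                               (agree→ p~q i j k (Agree-trans (Agree-≤ k≤ (Agree-sym h)) g))
      ; stem← = λ j k k≤ g → Agree-trans (Agree-≤ k≤ h)
                               (agree← p~q i j k (Agree-trans (Agree-≤ k≤ (Agree-take (q i) ℓ≤q)) g))
      ; finite = λ f → All.take⁺ ℓ (f i) }
      where
      ℓ≤q : ℓ ≤ length (q i)
      ℓ≤q = subst (ℓ ≤_) (~-length p~q i) (Agree-lengthʳ h)
      Pointwise-take : ∀ {γ ℓ xs ys zs} → Similar γ ys zs → Agree ℓ xs ys →
                       Similar γ (take ℓ xs) (take ℓ zs)
      Pointwise-take _ zero = []
      Pointwise-take (x ∷ xs) (suc h) = x ∷ Pointwise-take xs h

    open Stem (mkStem refl (proj₁ (proj₂ (proj₂ top))))

    module G = Graft (graft c (take ℓ a) stem (drop ℓ a) δ<γ ≈-refl (inj₁ tt)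
                       (subst Valid (sym (take++drop≡id ℓ a)) va) valid head≈)

    b = stem ++ G.scion

    b→ : ∀ j k → Agree k a (p j) → Agree k b (q j)
    b→ j k h = Agree-trans (Agree-sym (Agree-≤ (subst (k ≤_) (sym len) k≤ℓ) (Agree-++ stem G.scion)))
        (stem→ j k k≤ℓ h)
      where k≤ℓ = bound j k h

    b← : ∀ j k → Agree k b (q j) → Agree k a (p j)
    b← j k h with k ≤? ℓ
    ... | yes k≤ℓ = stem← j k k≤ℓ (Agree-trans (Agree-≤ (subst (k ≤_) (sym len) k≤ℓ) (Agree-++ stem G.scion)) h)
    ... | no  k≰ℓ = ⊥-elim (no-agreement c stem G.scion (cq j) G.fresh (subst (_< k) (sym len) (≰⇒> k≰ℓ)) h)

    b≈ : Similar δ a b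
    b≈ = subst (λ xs → Similar δ xs b) (take++drop≡id ℓ a)
           (Pointwise.++⁺ (Pointwise.map (≈-weaken (inj₂ δ<γ)) head≈) G.similar)

    noInf : (∀ i → NoInf (q i)) → NoInf b
    noInf f = All.++⁺ (finite f) (G.noInf (finite f))

    similarity : (p ▹ a) ~[ δ ] (q ▹ b)
    similarity = record { agree→ = to ; agree← = from ; ranks = rk }
      where
      len≡ = Pointwise.Pointwise-length b≈
      to : ∀ i j ℓ → Agree ℓ ((p ▹ a) i) ((p ▹ a) j) → Agree ℓ ((q ▹ b) i) ((q ▹ b) j)
      to (inj₁ i) (inj₁ j) k = agree→ p~q i j k
      to (inj₁ i) (inj₂ _) k = Agree-sym ∘ b→ i k ∘ Agree-sym
      to (inj₂ _) (inj₁ j) k = b→ j k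
      to (inj₂ _) (inj₂ _) k h = Agree-refl (subst (k ≤_) len≡ (Agree-length h))
      from : ∀ i j ℓ → Agree ℓ ((q ▹ b) i) ((q ▹ b) j) → Agree ℓ ((p ▹ a) i) ((p ▹ a) j)
      from (inj₁ i) (inj₁ j) k = agree← p~q i j k
      from (inj₁ i) (inj₂ _) k = Agree-sym ∘ b← i k ∘ Agree-sym
      from (inj₂ _) (inj₁ j) k = b← j k
      from (inj₂ _) (inj₂ _) k h = Agree-refl (subst (k ≤_) (sym len≡) (Agree-length h))
      rk : ∀ i → Similar δ ((p ▹ a) i) ((q ▹ b) i)
      rk (inj₁ i) = Pointwise.map (≈-weaken (inj₂ δ<γ)) (ranks p~q i)
      rk (inj₂ _) = b≈

-- Labelled structures and their one-point extensions.

module Model (em : ExcludedMiddle 0ℓ) (m : ℕ) where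

  h n : ℕ
  h = suc (suc m)
  n = suc h

  -- A hub consists of one base node of each kind W j. X t is the kind of apexes of tint t; white j labels
  -- pairs of apexes without a common neighbour of kind W j, and node e pairs that may share a hub.
  data Kind : Set where
    W : Fin h → Kind
    X : ℕ → Kind

  data Label : Set where
    none  : Label
    white : Fin h → Label
    node  : Node → Label

  W-injective : ∀ {i j} → W i ≡ W j → i ≡ j
  W-injective refl = refl

  node-injective : ∀ {e e′} → node e ≡ node e′ → e ≡ e′
  node-injective refl = refl

  -- nothing stands for an infinite branch, all of whose ranks are ∞.
  Branch : Set
  Branch = Maybe Node

  Fits : ℕ → Branch → Set
  Fits t nothing  = ⊤
  Fits t (just e) = t ≤ length e

  restrict : ℕ → Branch → Node
  restrict t nothing  = replicate t (∞ , 0)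
  restrict t (just e) = take t e

  ValidBranch : Branch → Set
  ValidBranch b = ∀ {e} → b ≡ just e → Valid e

  Fits-⊔ : ∀ {s t} b → Fits s b → Fits t b → Fits (s ⊔ t) b
  Fits-⊔ nothing  _ _ = tt
  Fits-⊔ (just e) p q = ⊔-lub p q

  length-restrict : ∀ t b → Fits t b → length (restrict t b) ≡ t
  length-restrict t nothing  _ = length-replicate t
  length-restrict t (just e) p = trans (length-take t e) (m≤n⇒m⊓n≡m p)

  valid-∞ : ∀ t → Valid (replicate t (∞ , 0))
  valid-∞ zero    = []
  valid-∞ (suc t) = tt ∷ valid-∞ t

  valid-restrict : ∀ t b → ValidBranch b → Valid (restrict t b)
  valid-restrict t nothing  _ = valid-∞ t
  valid-restrict t (just e) v = Descends-take t (v refl)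

  Compat : Node → Node → Set
  Compat e e′ = Agree (length e ⊓ length e′) e e′

  Compat-sym : ∀ {e e′} → Compat e e′ → Compat e′ e
  Compat-sym {e} {e′} c = subst (λ ℓ → Agree ℓ e′ e) (⊓-comm (length e) (length e′)) (Agree-sym c)

  Compat⇒≡ : ∀ {e e′} → length e ≡ length e′ → Compat e e′ → e ≡ e′
  Compat⇒≡ {e} {e′} p c = Agree⇒≡ p (subst (λ ℓ → Agree ℓ e e′) (m≤n⇒m⊓n≡m (≤-reflexive p)) c)

  Compat⇒take : ∀ {e e′} → length e ≤ length e′ → Compat e e′ → e ≡ take (length e) e′
  Compat⇒take {e} {e′} p c = Agree⇒≡ (sym (trans (length-take (length e) e′) (m≤n⇒m⊓n≡m p)))
    (Agree-trans (subst (λ ℓ → Agree ℓ e e′) (m≤n⇒m⊓n≡m p) c) (Agree-take e′ p))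

  Compat-restrict : ∀ s t b → Compat (restrict s b) (restrict t b)
  Compat-restrict s t nothing  = go s t
    where
    go : ∀ s t → Compat (replicate s (∞ , 0)) (replicate t (∞ , 0))
    go zero t = zero
    go (suc s) zero = zero
    go (suc s) (suc t) = suc (go s t)
  Compat-restrict s t (just e) = go s t e
    where
    go : ∀ s t e → Compat (take s e) (take t e)
    go zero t e = zero
    go (suc s) zero [] = zero
    go (suc s) zero (_ ∷ _) = zero
    go (suc s) (suc t) [] = zero
    go (suc s) (suc t) (_ ∷ e) = suc (go s t e)

  -- br assigns to a hub the branch from which the apexes attached to it get their labels. Only its height
  -- will be visible to the algebras; a hub with an apex of tint t has height at least t.
  record Structure : Set where
    field
      kind : ℕ → Kind
      adj  : ℕ → ℕ → Bool
      lab  : ℕ → ℕ → Label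
      br   : Vec ℕ h → Branch

    Hub : Vec ℕ h → Set
    Hub u = ∀ j → kind (lookup u j) ≡ W j

    Attached : Vec ℕ h → ℕ → Set
    Attached u x = ∀ j → adj (lookup u j) x ≡ true

  -- By `lab-X` and `lab-adj`, distinct apexes with common neighbours of all kinds are labelled by
  -- nodes. By `lab-tri` the labels of any triangle of such apexes cohere, and this suffices to find
  -- one branch for all of them when a new base node turns their neighbours into a hub.
  record Invariants (S : Structure) : Set where
    open Structure S
    field
      adj-sym  : ∀ a b → adj a b ≡ adj b a
      adj-self : ∀ a → adj a a ≡ false
      lab-sym  : ∀ a b → lab a b ≡ lab b a
      lab-self : ∀ a → lab a a ≡ none
      lab-W    : ∀ {a j} b → kind a ≡ W j → lab a b ≡ none
      lab-X    : ∀ {a b s t} → kind a ≡ X s → kind b ≡ X t → a ≢ b → lab a b ≢ none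
      lab-adj  : ∀ {u j x y} → kind u ≡ W j → adj u x ≡ true → adj u y ≡ true → lab x y ≢ white j
      lab-node : ∀ {x y s t e} → kind x ≡ X s → kind y ≡ X t → lab x y ≡ node e → length e ≡ s ⊔ t × Valid e
      lab-tri  : ∀ {x y z e e′ e″} → lab x y ≡ node e → lab x z ≡ node e′ → lab y z ≡ node e″ → Compat e e′
      hub-fits : ∀ u {x t} → Hub u → Attached u x → kind x ≡ X t → Fits t (br u)
      hub-lab  : ∀ u {x y s t} → Hub u → Attached u x → Attached u y → kind x ≡ X s → kind y ≡ X t →
                 x ≢ y → lab x y ≡ node (restrict (s ⊔ t) (br u))
      br-valid : ∀ u → ValidBranch (br u)

    lab-Wʳ : ∀ {a j} b → kind a ≡ W j → lab b a ≡ none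
    lab-Wʳ {a} b p = trans (lab-sym b a) (lab-W b p)

    lab⇒≢ : ∀ {x y e} → lab x y ≡ node e → x ≢ y
    lab⇒≢ {x} p refl with trans (sym p) (lab-self x)
    ... | ()

    lab⇒X : ∀ {x y e} → lab x y ≡ node e → Σ[ s ∈ ℕ ] kind x ≡ X s
    lab⇒X {x} {y} p with kind x in eq
    ... | X s = s , refl
    ... | W j with trans (sym p) (lab-W y eq)
    ...   | ()

  record OffNode (k : ℕ) (S S′ : Structure) : Set where
    private
      module S  = Structure S
      module S′ = Structure S′
    field
      kind-off : ∀ {a} → a ≢ k → S′.kind a ≡ S.kind a
      adj-off  : ∀ {a b} → a ≢ k → b ≢ k → S′.adj a b ≡ S.adj a b
      lab-off  : ∀ {a b} → a ≢ k → b ≢ k → S′.lab a b ≡ S.lab a b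
      br-off   : ∀ {u} → (∀ j → lookup u j ≢ k) → S′.br u ≡ S.br u

  module _ {A : Set} (k : ℕ) where
    opaque
      update : A → (ℕ → A) → ℕ → A
      update x f a with a ≟ k
      ... | yes _ = x
      ... | no  _ = f a

      update-at : ∀ {x f} → update x f k ≡ x
      update-at with k ≟ k
      ... | yes _ = refl
      ... | no ¬p = contradiction refl ¬p

      update-off : ∀ {x f a} → a ≢ k → update x f a ≡ f a
      update-off {a = a} a≢k with a ≟ k
      ... | yes p = contradiction p a≢k
      ... | no  _ = refl

      update₂ : A → (ℕ → A) → (ℕ → ℕ → A) → ℕ → ℕ → A
      update₂ x r f a b with a ≟ k | b ≟ k
      ... | yes _ | yes _ = x
      ... | yes _ | no  _ = r b
      ... | no  _ | yes _ = r a
      ... | no  _ | no  _ = f a b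

      update₂-at : ∀ {x r f} → update₂ x r f k k ≡ x
      update₂-at with k ≟ k
      ... | yes _ = refl
      ... | no ¬p = contradiction refl ¬p

      update₂-atˡ : ∀ {x r f b} → b ≢ k → update₂ x r f k b ≡ r b
      update₂-atˡ {b = b} b≢k with k ≟ k | b ≟ k
      ... | no ¬p | _     = contradiction refl ¬p
      ... | yes _ | yes p = contradiction p b≢k
      ... | yes _ | no  _ = refl

      update₂-off : ∀ {x r f a b} → a ≢ k → b ≢ k → update₂ x r f a b ≡ f a b
      update₂-off {a = a} {b} a≢k b≢k with a ≟ k | b ≟ k
      ... | yes p | _     = contradiction p a≢k
      ... | no  _ | yes p = contradiction p b≢k
      ... | no  _ | no  _ = refl

      update₂-sym : ∀ {x r f} → (∀ a b → f a b ≡ f b a) → ∀ a b → update₂ x r f a b ≡ update₂ x r f b a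
      update₂-sym f-sym a b with a ≟ k | b ≟ k
      ... | yes _ | yes _ = refl
      ... | yes _ | no  _ = refl
      ... | no  _ | yes _ = refl
      ... | no  _ | no  _ = f-sym a b

  data View (k : ℕ) : ℕ → Set where
    new : View k k
    old : ∀ {a} → a ≢ k → View k a

  view : ∀ k a → View k a
  view k a with a ≟ k
  ... | yes refl = new
  ... | no  a≢k  = old a≢k

  Contains : ℕ → Vec ℕ h → Set
  Contains k u = ∃[ j ] lookup u j ≡ k

  opaque
    updateBr : ℕ → (Vec ℕ h → Branch) → (Vec ℕ h → Branch) → Vec ℕ h → Branch
    updateBr k r f u with em {Contains k u}
    ... | yes _ = r u
    ... | no  _ = f u

    updateBr-on : ∀ {k r f u} → Contains k u → updateBr k r f u ≡ r u
    updateBr-on {k} {u = u} c with em {Contains k u}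
    ... | yes _ = refl
    ... | no ¬c = contradiction c ¬c

    updateBr-off : ∀ {k r f u} → (∀ j → lookup u j ≢ k) → updateBr k r f u ≡ f u
    updateBr-off {k} {u = u} off with em {Contains k u}
    ... | yes (j , p) = contradiction p (off j)
    ... | no  _ = refl

    updateBr-elim : ∀ {k r f} (P : Branch → Set) → (∀ u → P (r u)) → (∀ u → P (f u)) → ∀ u → P
        (updateBr k r f u)
    updateBr-elim {k} P pr pf u with em {Contains k u}
    ... | yes _ = pr u
    ... | no  _ = pf u

  injective⇒surjective : ∀ {k} (q : Fin k → Fin k) → (∀ {i j} → q i ≡ q j → i ≡ j) → ∀ x → ∃[ j ] q j ≡ x
  injective⇒surjective {k} q inj x with em {∃[ j ] q j ≡ x}
  ... | yes p = p
  ... | no ¬p = ⊥-elim (1+n≰n (injective⇒≤ {f = q′} q′-inj))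
    where
    q′ : Fin (suc k) → Fin k
    q′ zero    = x
    q′ (suc j) = q j
    q′-inj : ∀ {i j} → q′ i ≡ q′ j → i ≡ j
    q′-inj {zero}  {zero}  _ = refl
    q′-inj {zero}  {suc j} e = contradiction (j , sym e) ¬p
    q′-inj {suc i} {zero}  e = contradiction (i , e) ¬p
    q′-inj {suc i} {suc j} e = cong suc (inj e)

  true≢false : true ≢ false
  true≢false ()

  module _ (S : Structure) (I : Invariants S) (k : ℕ) (f : Fin h → ℕ) (f≢k : ∀ q → f q ≢ k)
           (α : Fin h → Bool) (α-cong : ∀ {q q′} → f q ≡ f q′ → α q ≡ α q′) where
    open Structure S

    touches : ℕ → Bool
    touches b = does (em {∃[ q ] f q ≡ b × α q ≡ true})

    touches-face : ∀ q → touches (f q) ≡ α q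
    touches-face q with em {∃[ q′ ] f q′ ≡ f q × α q′ ≡ true}
    ... | yes (q′ , e , p) = sym (trans (α-cong (sym e)) p)
    ... | no ¬p with α q in eq
    ...   | true  = contradiction (q , refl , eq) ¬p
    ...   | false = refl

    touches⇒ : ∀ {b} → touches b ≡ true → ∃[ q ] f q ≡ b × α q ≡ true
    touches⇒ {b} p with em {∃[ q ] f q ≡ b × α q ≡ true}
    touches⇒ {b} p | yes w = w

    newAdj : ℕ → ℕ → Bool
    newAdj = update₂ k false touches adj

    newAdj-self : ∀ a → newAdj a a ≡ false
    newAdj-self a with view k a
    ... | new     = update₂-at k
    ... | old a≢k = trans (update₂-off k a≢k a≢k) (Invariants.adj-self I a)

    newAdj-at : ∀ {b} → newAdj k b ≡ true → ∃[ q ] f q ≡ b × α q ≡ true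
    newAdj-at {b} p with view k b
    ... | new     = contradiction (trans (sym p) (update₂-at k)) true≢false
    ... | old b≢k = touches⇒ (trans (sym (update₂-atˡ k b≢k)) p)

    newAdj-sym : ∀ a b → newAdj a b ≡ newAdj b a
    newAdj-sym = update₂-sym k (Invariants.adj-sym I)

    newAdj-face : ∀ q → newAdj k (f q) ≡ α q
    newAdj-face q = trans (update₂-atˡ k (f≢k q)) (touches-face q)

  -- One-point extensions: a new node is prescribed over a face f of h old ones and related to all other
  -- old nodes by default.
  record NewX (S : Structure) (k : ℕ) : Set where
    open Structure S
    field
      f      : Fin h → ℕ
      f≢k    : ∀ q → f q ≢ k
      t      : ℕ
      α      : Fin h → Bool
      l      : Fin h → Label
      -- A tuple through an apex is never a hub, but the height of its branch is compared like that
      -- of any other tuple and so must be prescribable.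
      r      : Vec ℕ h → Branch
      α-cong : ∀ {q q′} → f q ≡ f q′ → α q ≡ α q′
      l-cong : ∀ {q q′} → f q ≡ f q′ → l q ≡ l q′
      l-W    : ∀ {q j} → kind (f q) ≡ W j → l q ≡ none
      l-X    : ∀ {q s} → kind (f q) ≡ X s → l q ≢ none
      l-adj  : ∀ {q q′ j} → kind (f q) ≡ W j → α q ≡ true → adj (f q) (f q′) ≡ true → l q′ ≢ white j
      l-node : ∀ {q s e} → kind (f q) ≡ X s → l q ≡ node e → length e ≡ t ⊔ s × Valid e
      l-tri  : ∀ {q q′ e e′ e″} → l q ≡ node e → l q′ ≡ node e′ → lab (f q) (f q′) ≡ node e″ →
               Compat e e′ × Compat e e″
      α-hub  : ∀ (q : Fin h → Fin h) → (∀ j → kind (f (q j)) ≡ W j) → (∀ j → α (q j) ≡ true) →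
               Fits t (br (tabulate (f ∘ q)))
      r-valid : ∀ u → ValidBranch (r u)

  module AddX {S : Structure} (I : Invariants S) {k : ℕ} (N : NewX S k) where
    open Structure S
    open Invariants I
    open NewX N

    OnHub : (Fin h → Fin h) → ℕ → Set
    OnHub q y = (∀ j → kind (f (q j)) ≡ W j) × (∀ j → α (q j) ≡ true) × (∀ j → adj (f (q j)) y ≡ true)

    -- All neighbours of the new apex lie in the face. Outside the face a missing common neighbour
    -- permits a white label; if none is missing, the neighbours of h different kinds exhaust the
    -- face, which is then a hub and dictates the label.
    data LabelOf (y : ℕ) : Label → Set where
      face  : ∀ q → f q ≡ y → LabelOf y (l q)
      base  : ∀ {j} → kind y ≡ W j → LabelOf y none
      apart : ∀ {s} j → kind y ≡ X s →
              (∀ q → kind (f q) ≡ W j → α q ≡ true → adj (f q) y ≢ true) → LabelOf y (white j)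
      onHub : ∀ {s} q → kind y ≡ X s → OnHub q y →
              LabelOf y (node (restrict (t ⊔ s) (br (tabulate (f ∘ q)))))

    labelOf : ∀ y → Σ Label (LabelOf y)
    labelOf y with em {∃[ q ] f q ≡ y}
    ... | yes (q , p) = _ , face q p
    ... | no _ with kind y in eq
    ...   | W j = _ , base eq
    ...   | X s with em {∃[ j ] (∀ q → kind (f q) ≡ W j → α q ≡ true → adj (f q) y ≢ true)}
    ...     | yes (j , p) = _ , apart j eq p
    ...     | no ¬p = _ , onHub (proj₁ ∘ common) eq
                (proj₁ ∘ proj₂ ∘ common , proj₁ ∘ proj₂ ∘ proj₂ ∘ common , proj₂ ∘ proj₂ ∘ proj₂ ∘ common)
      where
      common : ∀ j → ∃[ q ] kind (f q) ≡ W j × α q ≡ true × adj (f q) y ≡ true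
      common j with em {∃[ q ] kind (f q) ≡ W j × α q ≡ true × adj (f q) y ≡ true}
      ... | yes c = c
      ... | no ¬c = contradiction (j , λ q a b c → ¬c (q , a , b , c)) ¬p

    newLab : ℕ → ℕ → Label
    newLab = update₂ k none (proj₁ ∘ labelOf) lab

    S′ : Structure
    S′ = record
      { kind = update k (X t) kind
      ; adj  = newAdj S I k f f≢k α α-cong
      ; lab  = newLab
      ; br   = updateBr k r br
      }
    module S′ = Structure S′

    adj⇒ : ∀ {a} → S′.adj a k ≡ true → ∃[ q ] f q ≡ a × α q ≡ true
    adj⇒ {a} p = newAdj-at S I k f f≢k α α-cong (trans (newAdj-sym S I k f f≢k α α-cong k a) p)

    adj-off : ∀ {a b} → a ≢ k → b ≢ k → S′.adj a b ≡ adj a b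
    adj-off a≢k b≢k = update₂-off k a≢k b≢k

    hub-cong : ∀ (q q′ : Fin h → Fin h) → (∀ j → q j ≡ q′ j) → tabulate (f ∘ q) ≡ tabulate (f ∘ q′)
    hub-cong q q′ p = tabulate-cong {f = f ∘ q} {f ∘ q′} (λ j → cong f (p j))

    hub-surj : ∀ (q : Fin h → Fin h) → (∀ j → kind (f (q j)) ≡ W j) → ∀ x → ∃[ j ] q j ≡ x
    hub-surj q kd = injective⇒surjective q λ {i} {j} e → W-injective
        (trans (sym (kd i)) (trans (cong (kind ∘ f) e) (kd j)))

    hub-uniq : ∀ (q q′ : Fin h → Fin h) → (∀ j → kind (f (q j)) ≡ W j) → (∀ j → kind (f (q′ j)) ≡ W j) →
        ∀ j → q j ≡ q′ j
    hub-uniq q q′ kd kd′ j with hub-surj q′ kd′ (q j)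
    ... | i , e with W-injective (trans (sym (kd′ i)) (trans (cong (kind ∘ f) e) (kd j)))
    ...   | refl = sym e

    no-face : ∀ (q : Fin h → Fin h) q′ {s} → (∀ j → kind (f (q j)) ≡ W j) → kind (f q′) ≢ X s
    no-face q q′ kd p with hub-surj q kd q′
    ... | j , refl with trans (sym (kd j)) p
    ...   | ()

    kind-off : ∀ {a κ} → a ≢ k → S′.kind a ≡ κ → kind a ≡ κ
    kind-off a≢k p = trans (sym (update-off k a≢k)) p

    kind-at : ∀ {s} → S′.kind k ≡ X s → t ≡ s
    kind-at p with trans (sym (update-at k)) p
    ... | refl = refl

    kind-W : ∀ {a j} → S′.kind a ≡ W j → a ≢ k
    kind-W p refl with trans (sym (update-at k)) p
    ... | ()

    hub-off : ∀ u → S′.Hub u → ∀ j → lookup u j ≢ k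
    hub-off u H j = kind-W (H j)

    hub-old : ∀ u → S′.Hub u → Hub u
    hub-old u H j = kind-off (hub-off u H j) (H j)

    br-old : ∀ u → S′.Hub u → S′.br u ≡ br u
    br-old u H = updateBr-off (hub-off u H)

    att-old : ∀ u {x} → S′.Hub u → x ≢ k → S′.Attached u x → Attached u x
    att-old u H x≢k A j = trans (sym (adj-off (hub-off u H j) x≢k)) (A j)

    hub-face : ∀ u → S′.Hub u → S′.Attached u k →
               Σ[ q ∈ (Fin h → Fin h) ] (∀ j → kind (f (q j)) ≡ W j) × (∀ j → α (q j) ≡ true) × tabulate
                   (f ∘ q) ≡ u
    hub-face u H A = (λ j → proj₁ (adj⇒ {lookup u j} (A j)))
      , (λ j → trans (cong kind (proj₁ (proj₂ (adj⇒ {lookup u j} (A j))))) (hub-old u H j))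
      , (λ j → proj₂ (proj₂ (adj⇒ {lookup u j} (A j))))
      , trans (tabulate-cong (λ j → proj₁ (proj₂ (adj⇒ {lookup u j} (A j))))) (tabulate∘lookup u)

    lab-at : ∀ {b} → b ≢ k → LabelOf b (newLab k b)
    lab-at {b} b≢k = subst (LabelOf b) (sym (update₂-atˡ k b≢k)) (proj₂ (labelOf b))

    newLab-sym : ∀ a b → newLab a b ≡ newLab b a
    newLab-sym = update₂-sym k lab-sym

    newLab-self : ∀ a → newLab a a ≡ none
    newLab-self a with view k a
    ... | new     = update₂-at k
    ... | old a≢k = trans (update₂-off k a≢k a≢k) (lab-self a)

    new-W : ∀ {a j} → a ≢ k → kind a ≡ W j → newLab k a ≡ none
    new-W {a} a≢k ka with newLab k a | lab-at a≢k
    ... | _ | face q refl = l-W ka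
    ... | _ | base _ = refl
    ... | _ | apart _ kx _ = contradiction (trans (sym ka) kx) λ ()
    ... | _ | onHub _ kx _ = contradiction (trans (sym ka) kx) λ ()

    new-X : ∀ {a s} → a ≢ k → kind a ≡ X s → newLab k a ≢ none
    new-X {a} a≢k ka with newLab k a | lab-at a≢k
    ... | _ | face q refl = l-X ka
    ... | _ | base kw = contradiction (trans (sym ka) kw) λ ()
    ... | _ | apart _ _ _ = λ ()
    ... | _ | onHub _ _ _ = λ ()

    new-adj : ∀ {u j y} → u ≢ k → y ≢ k → kind u ≡ W j → S′.adj u k ≡ true → adj u y ≡ true →
        newLab k y ≢ white j
    new-adj {u} {j} {y} u≢k y≢k ku p p′ with newLab k y | lab-at y≢k | adj⇒ {u} p
    ... | _ | face q′ refl | q , refl , αq = l-adj ku αq p′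
    ... | _ | base _ | _ = λ ()
    ... | _ | apart _ _ no-common | q , refl , αq = λ { refl → no-common q ku αq p′ }
    ... | _ | onHub _ _ _ | _ = λ ()

    new-node : ∀ {y s e} → y ≢ k → kind y ≡ X s → newLab k y ≡ node e → length e ≡ t ⊔ s × Valid e
    new-node {y} {s} y≢k ky p with newLab k y | lab-at y≢k
    new-node y≢k ky p | _ | face q refl = l-node ky p
    new-node {y} {s} y≢k ky refl | _ | onHub {s′} q kx (kd , αs , ads) with trans (sym ky) kx
    ... | refl = length-restrict (t ⊔ s) b (Fits-⊔ b (α-hub q kd αs) (hub-fits _ hub att ky)) ,
        valid-restrict (t ⊔ s) b (br-valid _)
      where
      b = br (tabulate (f ∘ q))
      hub : Hub (tabulate (f ∘ q))
      hub j = trans (cong kind (lookup∘tabulate (f ∘ q) j)) (kd j)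
      att : Attached (tabulate (f ∘ q)) y
      att j = trans (cong (λ a → adj a y) (lookup∘tabulate (f ∘ q) j)) (ads j)

    -- A new label on a hub leaves no room for apexes in the face.
    new-tri : ∀ {y z e e′ e″} → y ≢ k → z ≢ k → newLab k y ≡ node e → newLab k z ≡ node e′ → lab y z ≡ node e″ →
              Compat e e′ × Compat e e″
    new-tri {y} {z} y≢k z≢k p p′ p″ with newLab k y | lab-at y≢k | newLab k z | lab-at z≢k
    new-tri y≢k z≢k p p′ p″ | _ | face q refl | _ | face q′ refl = l-tri p p′ p″
    new-tri y≢k z≢k p p′ p″ | _ | face q refl | _ | onHub q′ _ (kd , _) =
      contradiction (proj₂ (lab⇒X p″)) (no-face q′ q kd)
    new-tri {y} y≢k z≢k p p′ p″ | _ | onHub q _ (kd , _) | _ | face q′ refl =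
      contradiction (proj₂ (lab⇒X (trans (lab-sym _ y) p″))) (no-face q q′ kd)
    new-tri {y} {z} y≢k z≢k refl refl p″ | _ | onHub {s} q ky (kd , αs , ads) | _ | onHub {s′} q′ kz
        (kd′ , _ , ads′) =
      subst (λ u → Compat (restrict (t ⊔ s) b) (restrict (t ⊔ s′) (br u))) same
          (Compat-restrict (t ⊔ s) (t ⊔ s′) b) ,
      subst (Compat (restrict (t ⊔ s) b)) (node-injective (trans (sym on) p″))
          (Compat-restrict (t ⊔ s) (s ⊔ s′) b)
      where
      u = tabulate (f ∘ q)
      b = br u
      same : u ≡ tabulate (f ∘ q′)
      same = hub-cong q q′ (hub-uniq q q′ kd kd′)
      hub : Hub u
      hub j = trans (cong kind (lookup∘tabulate (f ∘ q) j)) (kd j)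
      att : ∀ (q : Fin h → Fin h) → (∀ j → adj (f (q j)) y ≡ true) → Attached (tabulate (f ∘ q)) y
      att q ads j = trans (cong (λ a → adj a y) (lookup∘tabulate (f ∘ q) j)) (ads j)
      att′ : Attached u z
      att′ j = trans (cong (λ a → adj a z)
          (trans (lookup∘tabulate (f ∘ q) j) (cong f (hub-uniq q q′ kd kd′ j)))) (ads′ j)
      on : lab y z ≡ node (restrict (s ⊔ s′) b)
      on = hub-lab u hub (att q ads) att′ ky kz (lab⇒≢ p″)

    new-hub : ∀ u {y s} → S′.Hub u → S′.Attached u k → y ≢ k → Attached u y → kind y ≡ X s →
              newLab k y ≡ node (restrict (t ⊔ s) (br u))
    new-hub u {y} H A y≢k A′ ky with newLab k y | lab-at y≢k | hub-face u H A
    ... | _ | face q refl | q′ , kd , _ = contradiction ky (no-face q′ q kd)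
    ... | _ | base kw | _ = contradiction (trans (sym ky) kw) λ ()
    ... | _ | apart j _ no-common | q , kd , αs , refl =
      contradiction (trans (cong (λ a → adj a y) (sym (lookup∘tabulate (f ∘ q) j))) (A′ j))
          (no-common (q j) (kd j) (αs j))
    ... | _ | onHub {s′} q ky′ (kd , _) | q′ , kd′ , _ , refl with trans (sym ky) ky′
    ...   | refl = cong (λ u → node (restrict (t ⊔ s′) (br u))) (hub-cong q q′ (hub-uniq q q′ kd kd′))

    lab-off : ∀ {a b ℓ} → a ≢ k → b ≢ k → newLab a b ≡ ℓ → lab a b ≡ ℓ
    lab-off a≢k b≢k p = trans (sym (update₂-off k a≢k b≢k)) p

    swap : ∀ {a b ℓ} → newLab a b ≡ ℓ → newLab b a ≡ ℓ
    swap {a} {b} p = trans (newLab-sym b a) p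

    self≢node : ∀ {a e} → newLab a a ≢ node e
    self≢node {a} p with trans (sym p) (newLab-self a)
    ... | ()

    newLab-adj : ∀ {u j x y} → S′.kind u ≡ W j → S′.adj u x ≡ true → S′.adj u y ≡ true → newLab x y ≢ white j
    newLab-adj {u} {j} {x} {y} ku p p′ with view k x | view k y
    ... | new | new = λ e → contradiction (trans (sym e) (newLab-self k)) λ ()
    ... | new | old y≢k = new-adj u≢k y≢k (kind-off u≢k ku) p (trans (sym (adj-off u≢k y≢k)) p′)
      where u≢k = kind-W ku
    ... | old x≢k | new = λ e → new-adj u≢k x≢k (kind-off u≢k ku) p′ (trans (sym (adj-off u≢k x≢k)) p) (swap e)
      where u≢k = kind-W ku
    ... | old x≢k | old y≢k = λ e → lab-adj (kind-off u≢k ku) (trans (sym (adj-off u≢k x≢k)) p)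
                                      (trans (sym (adj-off u≢k y≢k)) p′) (lab-off x≢k y≢k e)
      where u≢k = kind-W ku

    newLab-tri : ∀ {x y z e e′ e″} → newLab x y ≡ node e → newLab x z ≡ node e′ → newLab y z ≡ node e″ →
        Compat e e′
    newLab-tri {x} {y} {z} p p′ p″ with view k x | view k y | view k z
    ... | new | new | _ = contradiction p self≢node
    ... | new | _ | new = contradiction p′ self≢node
    ... | _ | new | new = contradiction p″ self≢node
    ... | new | old y≢k | old z≢k = proj₁ (new-tri y≢k z≢k p p′ (lab-off y≢k z≢k p″))
    ... | old x≢k | new | old z≢k = proj₂ (new-tri x≢k z≢k (swap p) p″ (lab-off x≢k z≢k p′))
    ... | old x≢k | old y≢k | new = Compat-sym (proj₂ (new-tri x≢k y≢k (swap p′) (swap p″) (lab-off x≢k y≢k p)))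
    ... | old x≢k | old y≢k | old z≢k = lab-tri (lab-off x≢k y≢k p) (lab-off x≢k z≢k p′) (lab-off y≢k z≢k p″)

    newLab-node : ∀ {x y s t e} → S′.kind x ≡ X s → S′.kind y ≡ X t → newLab x y ≡ node e →
        length e ≡ s ⊔ t × Valid e
    newLab-node {x} {y} kx ky p with view k x | view k y
    ... | new | new = contradiction p self≢node
    newLab-node {s = s} {t′} {e} kx ky p | old x≢k | new with kind-at ky
    ... | refl = subst (length e ≡_) (⊔-comm t′ s) (proj₁ r′) , proj₂ r′
      where r′ = new-node x≢k (kind-off x≢k kx) (swap p)
    newLab-node kx ky p | new | old y≢k with kind-at kx
    ... | refl = new-node y≢k (kind-off y≢k ky) p
    newLab-node kx ky p | old x≢k | old y≢k = lab-node (kind-off x≢k kx) (kind-off y≢k ky) (lab-off x≢k y≢k p)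

    newLab-W : ∀ {a j} b → S′.kind a ≡ W j → newLab a b ≡ none
    newLab-W {a} b ka with view k b
    ... | new     = swap (new-W a≢k (kind-off a≢k ka))
      where a≢k = kind-W ka
    ... | old b≢k = trans (update₂-off k a≢k b≢k) (lab-W b (kind-off a≢k ka))
      where a≢k = kind-W ka

    newLab-X : ∀ {a b s t} → S′.kind a ≡ X s → S′.kind b ≡ X t → a ≢ b → newLab a b ≢ none
    newLab-X {a} {b} ka kb a≢b e with view k a | view k b
    ... | new | new = a≢b refl
    ... | new | old b≢k = new-X b≢k (kind-off b≢k kb) e
    ... | old a≢k | new = new-X a≢k (kind-off a≢k ka) (swap e)
    ... | old a≢k | old b≢k = lab-X (kind-off a≢k ka) (kind-off b≢k kb) a≢b (lab-off a≢k b≢k e)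

    new-fits : ∀ u {x t} → S′.Hub u → S′.Attached u x → S′.kind x ≡ X t → Fits t (S′.br u)
    new-fits u {x} {t′} H A kx with view k x
    ... | old x≢k = subst (Fits t′) (sym (br-old u H))
        (hub-fits u (hub-old u H) (att-old u H x≢k A) (kind-off x≢k kx))
    ... | new with kind-at kx | hub-face u H A
    ...   | refl | q , kd , αs , eq = subst (Fits t′) (trans (cong br eq) (sym (br-old u H))) (α-hub q kd αs)

    newLab-hub : ∀ u {x y s t} → S′.Hub u → S′.Attached u x → S′.Attached u y → S′.kind x ≡ X s →
        S′.kind y ≡ X t →
                 x ≢ y → newLab x y ≡ node (restrict (s ⊔ t) (S′.br u))
    newLab-hub u {x} {y} {s} {t′} H A A′ kx ky x≢y with view k x | view k y
    ... | new | new = contradiction refl x≢y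
    ... | old x≢k | old y≢k = trans (update₂-off k x≢k y≢k)
        (trans (hub-lab u (hub-old u H) (att-old u H x≢k A) (att-old u H y≢k A′) (kind-off x≢k kx)
            (kind-off y≢k ky) x≢y)
               (cong (node ∘ restrict (s ⊔ t′)) (sym (br-old u H))))
    ... | new | old y≢k with kind-at kx
    ...   | refl = trans (new-hub u H A y≢k (att-old u H y≢k A′) (kind-off y≢k ky))
        (cong (node ∘ restrict (s ⊔ t′)) (sym (br-old u H)))
    newLab-hub u {x} {y} {s} {t′} H A A′ kx ky x≢y | old x≢k | new with kind-at ky
    ... | refl = swap (trans (new-hub u H A′ x≢k (att-old u H x≢k A) (kind-off x≢k kx))
                   (cong node (cong₂ restrict (⊔-comm t′ s) (sym (br-old u H)))))

    newBr-valid : ∀ u → ValidBranch (S′.br u)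
    newBr-valid = updateBr-elim ValidBranch r-valid br-valid

    invariants : Invariants S′
    invariants = record
      { adj-sym  = newAdj-sym S I k f f≢k α α-cong
      ; adj-self = newAdj-self S I k f f≢k α α-cong
      ; lab-sym  = newLab-sym
      ; lab-self = newLab-self
      ; lab-W    = newLab-W
      ; lab-X    = newLab-X
      ; lab-adj  = newLab-adj
      ; lab-node = newLab-node
      ; lab-tri  = newLab-tri
      ; hub-fits = new-fits
      ; hub-lab  = newLab-hub
      ; br-valid = newBr-valid
      }

    offNode : OffNode k S S′
    offNode = record
      { kind-off = update-off k
      ; adj-off  = adj-off
      ; lab-off  = update₂-off k
      ; br-off   = updateBr-off
      }

    new-kind : S′.kind k ≡ X t
    new-kind = update-at k

    new-adj-face : ∀ q → S′.adj k (f q) ≡ α q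
    new-adj-face = newAdj-face S I k f f≢k α α-cong

    labelOf-face : ∀ q → proj₁ (labelOf (f q)) ≡ l q
    labelOf-face q with em {∃[ q′ ] f q′ ≡ f q}
    ... | yes (q′ , e) = l-cong e
    ... | no ¬p = contradiction (q , refl) ¬p

    new-lab-face : ∀ q → S′.lab k (f q) ≡ l q
    new-lab-face q = trans (update₂-atˡ k (f≢k q)) (labelOf-face q)

    new-br : ∀ {u} → Contains k u → S′.br u ≡ r u
    new-br = updateBr-on

  record NewW (S : Structure) (k : ℕ) : Set where
    open Structure S
    field
      f      : Fin h → ℕ
      f≢k    : ∀ q → f q ≢ k
      j₀     : Fin h
      α      : Fin h → Bool
      α-cong : ∀ {q q′} → f q ≡ f q′ → α q ≡ α q′
      α-lab  : ∀ {q q′} → α q ≡ true → α q′ ≡ true → lab (f q) (f q′) ≢ white j₀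

    Completed : Vec ℕ h → Set
    Completed u = lookup u j₀ ≡ k × (∀ {j} → j ≢ j₀ → lookup u j ≢ k × kind (lookup u j) ≡ W j)

    Meets : Vec ℕ h → Fin h → Set
    Meets u q = α q ≡ true × (∀ {j} → j ≢ j₀ → adj (lookup u j) (f q) ≡ true)

    -- These are the instances of `hub-fits` and `hub-lab` that concern a hub through the new node.
    GoodFits GoodLab : Vec ℕ h → Branch → Set
    GoodFits u b = ∀ q {t} → Meets u q → kind (f q) ≡ X t → Fits t b
    GoodLab u b = ∀ q q′ {s t} → Meets u q → Meets u q′ → kind (f q) ≡ X s → kind (f q′) ≡ X t →
                  f q ≢ f q′ → lab (f q) (f q′) ≡ node (restrict (s ⊔ t) b)

  -- The branches are a separate parameter because some of them will be copied from elsewhere and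
  -- the others chosen by `CompletedBranch`.
  module AddW {S : Structure} (I : Invariants S) {k : ℕ} (N : NewW S k)
              (r : Vec ℕ h → Branch) (r-valid : ∀ u → ValidBranch (r u))
              (good-fits : ∀ u → NewW.Completed N u → NewW.GoodFits N u (r u))
              (good-lab : ∀ u → NewW.Completed N u → NewW.GoodLab N u (r u)) where
    open Structure S
    open Invariants I
    open NewW N

    S′ : Structure
    S′ = record
      { kind = update k (W j₀) kind
      ; adj  = newAdj S I k f f≢k α α-cong
      ; lab  = update₂ k none (const none) lab
      ; br   = updateBr k r br
      }
    module S′ = Structure S′

    adj-off : ∀ {a b} → a ≢ k → b ≢ k → S′.adj a b ≡ adj a b
    adj-off a≢k b≢k = update₂-off k a≢k b≢k

    kind-off : ∀ {a κ} → a ≢ k → S′.kind a ≡ κ → kind a ≡ κ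
    kind-off a≢k p = trans (sym (update-off k a≢k)) p

    kind-X : ∀ {a t} → S′.kind a ≡ X t → a ≢ k
    kind-X p refl with trans (sym (update-at k)) p
    ... | ()

    kind-at : ∀ {j} → S′.kind k ≡ W j → j₀ ≡ j
    kind-at p with trans (sym (update-at k)) p
    ... | refl = refl

    lab-at : ∀ b → S′.lab k b ≡ none
    lab-at b with view k b
    ... | new     = update₂-at k
    ... | old b≢k = update₂-atˡ k b≢k

    newLab-sym : ∀ a b → S′.lab a b ≡ S′.lab b a
    newLab-sym = update₂-sym k lab-sym

    lab-atʳ : ∀ a → S′.lab a k ≡ none
    lab-atʳ a = trans (newLab-sym a k) (lab-at a)

    lab-off : ∀ {a b ℓ} → a ≢ k → b ≢ k → S′.lab a b ≡ ℓ → lab a b ≡ ℓ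
    lab-off a≢k b≢k p = trans (sym (update₂-off k a≢k b≢k)) p

    lab≢none : ∀ {a b ℓ} → S′.lab a b ≡ ℓ → ℓ ≢ none → a ≢ k × b ≢ k
    lab≢none {a} {b} p ℓ≢none = (λ { refl → ℓ≢none (trans (sym p) (lab-at b)) }) ,
        (λ { refl → ℓ≢none (trans (sym p) (lab-atʳ a)) })

    completed : ∀ u → S′.Hub u → Contains k u → Completed u
    completed u H (j , p) with kind-at (trans (sym (cong S′.kind p)) (H j))
    ... | refl = p , λ {i} i≢j₀ → let i≢k = λ q → i≢j₀ (sym (kind-at (trans (sym (cong S′.kind q)) (H i))))
                                  in i≢k , kind-off i≢k (H i)

    not-contained : ∀ u → ¬ Contains k u → ∀ j → lookup u j ≢ k
    not-contained u ¬c j p = ¬c (j , p)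

    meets : ∀ u {x} → Completed u → S′.Attached u x → x ≢ k → ∃[ q ] f q ≡ x × Meets u q
    meets u {x} (p , others) A x≢k with newAdj-at S I k f f≢k α α-cong
        (trans (cong (λ a → S′.adj a x) (sym p)) (A j₀))
    ... | q , refl , αq = q , refl , αq , λ {j} j≢j₀ → trans (sym (adj-off (proj₁ (others j≢j₀)) x≢k)) (A j)

    newLab-adj : ∀ {u j x y} → S′.kind u ≡ W j → S′.adj u x ≡ true → S′.adj u y ≡ true → S′.lab x y ≢ white j
    newLab-adj {u} {j} {x} {y} ku p p′ e with lab≢none e (λ ())
    ... | x≢k , y≢k with view k u
    ...   | old u≢k = lab-adj (kind-off u≢k ku) (trans (sym (adj-off u≢k x≢k)) p)
                                (trans (sym (adj-off u≢k y≢k)) p′) (lab-off x≢k y≢k e)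
    ...   | new with kind-at ku | newAdj-at S I k f f≢k α α-cong p | newAdj-at S I k f f≢k α α-cong p′
    ...     | refl | q , refl , αq | q′ , refl , αq′ = α-lab αq αq′ (lab-off x≢k y≢k e)

    newLab-W : ∀ {a j} b → S′.kind a ≡ W j → S′.lab a b ≡ none
    newLab-W {a} b ka with view k a | view k b
    ... | new | _ = lab-at b
    ... | old _ | new = lab-atʳ a
    ... | old a≢k | old b≢k = trans (update₂-off k a≢k b≢k) (lab-W b (kind-off a≢k ka))

    newLab-self : ∀ a → S′.lab a a ≡ none
    newLab-self a with view k a
    ... | new     = lab-at k
    ... | old a≢k = trans (update₂-off k a≢k a≢k) (lab-self a)

    newLab-tri : ∀ {x y z e e′ e″} → S′.lab x y ≡ node e → S′.lab x z ≡ node e′ → S′.lab y z ≡ node e″ →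
        Compat e e′
    newLab-tri p p′ p″ with lab≢none p (λ ()) | lab≢none p″ (λ ())
    ... | x≢k , y≢k | _ , z≢k = lab-tri (lab-off x≢k y≢k p) (lab-off x≢k z≢k p′) (lab-off y≢k z≢k p″)

    new-fits : ∀ u {x t} → S′.Hub u → S′.Attached u x → S′.kind x ≡ X t → Fits t (S′.br u)
    new-fits u {x} {t} H A kx with em {Contains k u}
    ... | no ¬c = subst (Fits t) (sym (updateBr-off (not-contained u ¬c)))
                    (hub-fits u (λ j → kind-off (λ p → ¬c (j , p)) (H j))
                       (λ j → trans (sym (adj-off (λ p → ¬c (j , p)) (kind-X kx))) (A j))
                           (kind-off (kind-X kx) kx))
    ... | yes c with meets u (completed u H c) A (kind-X kx)
    ...   | q , refl , M = subst (Fits t) (sym (updateBr-on c))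
        (good-fits u (completed u H c) q M (kind-off (f≢k q) kx))

    newLab-hub : ∀ u {x y s t} → S′.Hub u → S′.Attached u x → S′.Attached u y → S′.kind x ≡ X s →
        S′.kind y ≡ X t →
                 x ≢ y → S′.lab x y ≡ node (restrict (s ⊔ t) (S′.br u))
    newLab-hub u {x} {y} {s} {t} H A A′ kx ky x≢y with em {Contains k u}
    ... | no ¬c = trans (update₂-off k x≢k y≢k) (trans
                    (hub-lab u (λ j → kind-off (u≢k j) (H j)) (λ j → trans (sym (adj-off (u≢k j) x≢k)) (A j))
                       (λ j → trans (sym (adj-off (u≢k j) y≢k)) (A′ j)) (kind-off x≢k kx) (kind-off y≢k ky) x≢y)
                    (cong (node ∘ restrict (s ⊔ t)) (sym (updateBr-off u≢k))))
      where
      x≢k = kind-X kx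
      y≢k = kind-X ky
      u≢k : ∀ j → lookup u j ≢ k
      u≢k = not-contained u ¬c
    ... | yes c with meets u (completed u H c) A (kind-X kx) | meets u (completed u H c) A′ (kind-X ky)
    ...   | q , refl , M | q′ , refl , M′ =
      trans (update₂-off k (f≢k q) (f≢k q′)) (trans
        (good-lab u (completed u H c) q q′ M M′ (kind-off (f≢k q) kx) (kind-off (f≢k q′) ky) x≢y)
        (cong (node ∘ restrict (s ⊔ t)) (sym (updateBr-on c))))

    invariants : Invariants S′
    invariants = record
      { adj-sym  = newAdj-sym S I k f f≢k α α-cong
      ; adj-self = newAdj-self S I k f f≢k α α-cong
      ; lab-sym  = newLab-sym
      ; lab-self = newLab-self
      ; lab-W    = newLab-W
      ; lab-X    = λ ka kb a≢b e → lab-X (kind-off (kind-X ka) ka) (kind-off (kind-X kb) kb) a≢b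
          (lab-off (kind-X ka) (kind-X kb) e)
      ; lab-adj  = newLab-adj
      ; lab-node = λ kx ky e → lab-node (kind-off (kind-X kx) kx) (kind-off (kind-X ky) ky)
          (lab-off (kind-X kx) (kind-X ky) e)
      ; lab-tri  = newLab-tri
      ; hub-fits = new-fits
      ; hub-lab  = newLab-hub
      ; br-valid = updateBr-elim ValidBranch r-valid br-valid
      }

    offNode : OffNode k S S′
    offNode = record
      { kind-off = update-off k
      ; adj-off  = adj-off
      ; lab-off  = update₂-off k
      ; br-off   = updateBr-off
      }

    new-kind : S′.kind k ≡ W j₀
    new-kind = update-at k

    new-adj-face : ∀ q → S′.adj k (f q) ≡ α q
    new-adj-face = newAdj-face S I k f f≢k α α-cong

    new-br : ∀ {u} → Contains k u → S′.br u ≡ r u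
    new-br = updateBr-on

  tint : Kind → ℕ
  tint (W _) = 0
  tint (X t) = t

  argmax : ∀ {k} (P : Fin k → Set) (v : Fin k → ℕ) →
           (∀ q → ¬ P q) ⊎ (∃[ q ] P q × (∀ q′ → P q′ → v q′ ≤ v q))
  argmax {zero} P v = inj₁ λ ()
  argmax {suc k} P v with em {P zero} | argmax (P ∘ suc) (v ∘ suc)
  ... | no ¬p | inj₁ ¬ps = inj₁ λ { zero → ¬p ; (suc q) → ¬ps q }
  ... | yes p | inj₁ ¬ps = inj₂ (zero , p , λ { zero _ → ≤-refl ; (suc q) p′ → contradiction p′ (¬ps q) })
  ... | no ¬p | inj₂ (q , pq , mx) = inj₂ (suc q , pq , λ { zero p → contradiction p ¬p ; (suc q′) → mx q′ })
  ... | yes p | inj₂ (q , pq , mx) with ≤-total (v zero) (v (suc q))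
  ...   | inj₁ l = inj₂ (suc q , pq , λ { zero _ → l ; (suc q′) → mx q′ })
  ...   | inj₂ l = inj₂ (zero , p , λ { zero _ → ≤-refl ; (suc q′) p′ → ≤-trans (mx q′ p′) l })

  -- A hub completed by the new node takes its branch from an edge of highest tint among the
  -- apexes it is attached to; coherence of triangles puts all other edges below that one.
  module CompletedBranch {S : Structure} (I : Invariants S) {k : ℕ} (N : NewW S k) (u : Vec ℕ h) (C : NewW.Completed N u) where
    open Structure S
    open Invariants I
    open NewW N

    Apex : Fin h → Set
    Apex q = Meets u q × kind (f q) ≡ X (tint (kind (f q)))

    apex : ∀ {q t} → Meets u q → kind (f q) ≡ X t → Apex q
    apex {q} M p = M , trans p (cong (X ∘ tint) (sym p))

    -- The new node excludes the label `white j₀`, and the old members of the hub exclude the other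
    -- white labels.
    edge : ∀ q q′ → Apex q → Apex q′ → f q ≢ f q′ → ∃[ e ] lab (f q) (f q′) ≡ node e
    edge q q′ ((α₁ , a₁) , k₁) ((α₂ , a₂) , k₂) f≢ with lab (f q) (f q′) in eq
    ... | none = contradiction eq (lab-X k₁ k₂ f≢)
    ... | node e = e , refl
    ... | white j with j Fin.≟ j₀
    ...   | yes refl = contradiction eq (α-lab α₁ α₂)
    ...   | no j≢j₀ = contradiction eq (lab-adj (proj₂ (proj₂ C j≢j₀)) (a₁ j≢j₀) (a₂ j≢j₀))

    module _ (q₀ q₁ : Fin h) (A₀ : Apex q₀) (A₁ : Apex q₁) (f≢ : f q₁ ≢ f q₀) where
      e₀ = proj₁ (edge q₀ q₁ A₀ A₁ (f≢ ∘ sym))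
      lab₀ = proj₂ (edge q₀ q₁ A₀ A₁ (f≢ ∘ sym))

      compat₀ : ∀ q {e} → Apex q → f q ≢ f q₀ → lab (f q₀) (f q) ≡ node e → Compat e e₀
      compat₀ q {e} A f≢ p with f q ≟ f q₁
      ... | yes eq = subst (λ e′ → Compat e′ e₀)
          (node-injective (trans (sym lab₀) (trans (cong (lab (f q₀)) (sym eq)) p)))
                       (Agree-refl (m⊓n≤m (length e₀) (length e₀)))
      ... | no f≢₁ = lab-tri p lab₀ (proj₂ (edge q q₁ A A₁ f≢₁))

      -- An edge that avoids the highest apex `q₀` is compared with the edge from `q` to `q₀`. The
      -- latter is `e₀` itself: both have the level of the highest tint, and compatible nodes of
      -- equal length coincide.
      compat : ∀ q q′ {e} → (∀ q → Apex q → tint (kind (f q)) ≤ tint (kind (f q₀))) →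
               Apex q → Apex q′ → lab (f q) (f q′) ≡ node e → Compat e e₀
      compat q q′ {e} mx A A′ p with f q ≟ f q₀ | f q′ ≟ f q₀
      ... | yes eq | yes eq′ = contradiction (trans eq (sym eq′)) (lab⇒≢ p)
      ... | yes eq | no f≢′ = compat₀ q′ A′ f≢′ (trans (cong (λ a → lab a (f q′)) (sym eq)) p)
      ... | no f≢ | yes eq′ = compat₀ q A f≢ (trans (lab-sym _ _) (trans (cong (lab (f q)) (sym eq′)) p))
      ... | no f≢₀ | no f≢′ = subst (Compat e) e₂≡e₀ (lab-tri p p₂ (proj₂ (edge q′ q₀ A′ A₀ f≢′)))
        where
        p₂ = proj₂ (edge q q₀ A A₀ f≢₀)
        len : ∀ {q′ e} → Apex q′ → lab (f q₀) (f q′) ≡ node e → length e ≡ tint (kind (f q₀))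
        len {q′} A′ p = trans (proj₁ (lab-node (proj₂ A₀) (proj₂ A′) p)) (m≥n⇒m⊔n≡m (mx q′ A′))
        e₂≡e₀ : proj₁ (edge q q₀ A A₀ f≢₀) ≡ e₀
        e₂≡e₀ = Compat⇒≡ (trans (len A (trans (lab-sym _ _) p₂)) (sym (len A₁ lab₀)))
            (compat₀ q A f≢₀ (trans (lab-sym _ _) p₂))

    exists : ∃[ b ] ValidBranch b × GoodFits u b × GoodLab u b
    exists with argmax Apex (λ q → tint (kind (f q)))
    -- Fewer than two distinct apexes impose no label, and an infinite branch fits every tint.
    ... | inj₁ noApex = nothing , (λ ()) , (λ q M p → tt) , λ q q′ M _ p → contradiction (apex M p) (noApex q)
    ... | inj₂ (q₀ , A₀ , mx) with em {∃[ q₁ ] Apex q₁ × f q₁ ≢ f q₀}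
    ...   | no ¬two = nothing , (λ ()) , (λ q M p → tt) , λ q q′ M M′ p p′ f≢ → contradiction
        (trans (same q M p) (sym (same q′ M′ p′))) f≢
      where
      same : ∀ q {t} → Meets u q → kind (f q) ≡ X t → f q ≡ f q₀
      same q M p with f q ≟ f q₀
      ... | yes e = e
      ... | no ¬e = contradiction (q , apex M p , ¬e) ¬two
    ...   | yes (q₁ , A₁ , f≢) = just e , (λ { refl → proj₂ e-ok }) , fits , labs
      where
      e = e₀ q₀ q₁ A₀ A₁ f≢
      e-ok = lab-node (proj₂ A₀) (proj₂ A₁) (lab₀ q₀ q₁ A₀ A₁ f≢)
      e-len : length e ≡ tint (kind (f q₀))
      e-len = trans (proj₁ e-ok) (m≥n⇒m⊔n≡m (mx q₁ A₁))
      fits : GoodFits u (just e)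
      fits q {t} M p = subst (t ≤_) (sym e-len) (subst (λ κ → tint κ ≤ tint (kind (f q₀))) p (mx q (apex M p)))
      labs : GoodLab u (just e)
      labs q q′ {s} {t} M M′ p p′ f≢′ with edge q q′ (apex M p) (apex M′ p′) f≢′
      ... | e₃ , eq = trans eq (cong node (trans
          (Compat⇒take (subst (_≤ length e) (sym len₃) (⊔-lub (fits q M p) (fits q′ M′ p′)))
            (compat q₀ q₁ A₀ A₁ f≢ q q′ mx (apex M p) (apex M′ p′) eq))
          (cong (λ ℓ → take ℓ e) len₃)))
        where
        len₃ : length e₃ ≡ s ⊔ t
        len₃ = proj₁ (lab-node p p′ eq)

-- Descending ranks inside an algebra of dimension n + 3.

-- The part of membership in S_c Nr_n CA_{n+3} that the argument uses.
record NeatEmbedding {n} (B : CylindricAlgebra n) : Set₁ where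
  private module B = CylindricAlgebra B
  field
    C : CylindricAlgebra (n + 3)
  private module C = CylindricAlgebra C
  field
    f        : B.Carrier → C.Carrier
    homo     : IsHomomorphism B.raw (CylindricAlgebra.raw (reduct (ℕ.m≤m+n n 3) C)) f
    neat     : ∀ x i → n ≤ toℕ i → C.c i (f x) C.≈ f x
    faithful : ∀ {x} → f x C.≈ C.⊥ → x B.≈ B.⊥
    complete : ∀ (X : B.Carrier → Set) → B.IsSupremum X B.⊤ → ∀ u → (∀ {x} → X x → f x C.≤ᴬ u) → u C.≈ C.⊤

-- The argument `ρ` stands for the rank of the root, which has no entry of its own.
lastRank : Rank → Node → Rank
lastRank ρ []      = ρ
lastRank ρ (x ∷ e) = lastRank (rank x) e

lastRank-finite : ∀ {ρ e} → 0 < length e → NoInf e → Finite (lastRank ρ e)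
lastRank-finite {e = x ∷ []} _ (p ∷ []) = p
lastRank-finite {e = x ∷ y ∷ e} _ (_ ∷ p) = lastRank-finite {rank x} {e = y ∷ e} (s≤s z≤n) p

lastRank-≺ : ∀ {ρ e e′} → Descends ρ e′ → Agree (length e) e e′ → length e′ ≡ suc (length e) →
    lastRank ρ e′ ≺ lastRank ρ e
lastRank-≺ {e = []} {x ∷ []} (p ∷ _) _ _ = p
lastRank-≺ {e = x ∷ e} {_ ∷ e′} (_ ∷ ps) (suc a) l = lastRank-≺ ps a (ℕ.suc-injective l)

module ConeSystems (em : ExcludedMiddle 0ℓ) (m : ℕ) where
  open Model em m

  0ᶠ 1ᶠ 2ᶠ : Fin n
  0ᶠ = zero
  1ᶠ = suc zero
  2ᶠ = suc (suc zero)

  Small : Label → Set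
  Small (node e) = Valid e × NoInf e
  Small _        = ⊤

  -- The descent takes place in an abstract algebra that has no points, so everything it uses about
  -- 𝔅 is stated by equations and suprema. Coordinate 0 is the place of an apex, and coordinate
  -- `suc j` that of the member of the hub of kind `W j`.
  record ConeSystem (B : CylindricAlgebra n) : Set₁ where
    open CylindricAlgebra B hiding (⊤; ¬_) renaming (⊥ to ⊥ᴮ)
    open Calculus B using (Fixed; _⟨_≔_⟩)
    field
      Top  : Carrier
      Tint : ℕ → Carrier
      Edge : Fin h → Carrier
      Cone : ℕ → Carrier
      Lab  : ∀ l → Small l → Fin n → Fin n → Carrier

    IsSmallLab : Carrier → Set
    IsSmallLab x = ∃[ l ] Σ[ sl ∈ Small l ] x ≈ Lab l sl 0ᶠ 1ᶠ

    field
      Lab-02          : ∀ l sl → Lab l sl 0ᶠ 2ᶠ ≈ Lab l sl 0ᶠ 1ᶠ ⟨ 1ᶠ ≔ 2ᶠ ⟩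
      Lab-12          : ∀ l sl → Lab l sl 1ᶠ 2ᶠ ≈ Lab l sl 0ᶠ 2ᶠ ⟨ 0ᶠ ≔ 1ᶠ ⟩
      Lab-fixed       : ∀ l sl {a b} k → a ≢ k → b ≢ k → Fixed k (Lab l sl a b)
      Tint-fixed      : ∀ t k → 0ᶠ ≢ k → Fixed k (Tint t)
      Edge-fixed      : ∀ j k → 0ᶠ ≢ k → suc j ≢ k → Fixed k (Edge j)
      Top≉⊥           : ¬ (Top ≈ ⊥ᴮ)
      Top≤Cone        : ∀ t → Top ≤ᴬ c 0ᶠ (Cone t)
      Cone≤Edge       : ∀ t j → Cone t ≤ᴬ Edge j
      Cone≤Tint       : ∀ t → Cone t ≤ᴬ Tint t
      edges-white     : ∀ j k sl → 0ᶠ ≢ k → Edge j ∧ (Edge j ⟨ 0ᶠ ≔ k ⟩ ∧ Lab (white j) sl 0ᶠ k) ≈ ⊥ᴮ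
      tints-none      : ∀ {t t′} sl → t < t′ → Tint t ∧ (Tint t′ ⟨ 0ᶠ ≔ 1ᶠ ⟩ ∧ Lab none sl 0ᶠ 1ᶠ) ≈ ⊥ᴮ
      tints-node      : ∀ {t t′} e sl → t < t′ → length e ≢ t′ → Tint t ∧
          (Tint t′ ⟨ 0ᶠ ≔ 1ᶠ ⟩ ∧ Lab (node e) sl 0ᶠ 1ᶠ) ≈ ⊥ᴮ
      labels-triangle : ∀ e e′ e″ s s′ s″ → ¬ Compat e e′ →
                        Lab (node e′) s′ 1ᶠ 2ᶠ ∧ (Lab (node e) s 0ᶠ 1ᶠ ∧ Lab (node e″) s″ 0ᶠ 2ᶠ) ≈ ⊥ᴮ
      small-labels    : IsSupremum IsSmallLab (CylindricAlgebra.⊤ B)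

  module Descent {B : CylindricAlgebra n} (S : ConeSystem B) (E : NeatEmbedding B) where
    private module 𝔅 = CylindricAlgebra B
    open ConeSystem S
    open Calculus B using () renaming (_⟨_≔_⟩ to _⟪_≔_⟫; Fixed to Fixedᴮ)
    open NeatEmbedding E
    private
      module C = CylindricAlgebra C
      module F = IsHomomorphism homo
    open C using (_≈_; _∧_; _≤ᴬ_)
    open Calculus C

    ι : Fin n → Fin (n + 3)
    ι i = inject≤ i (ℕ.m≤m+n n 3)

    ε : Fin 3 → Fin (n + 3)
    ε = n ↑ʳ_

    ι≢ι : ∀ {i j} → i ≢ j → ι i ≢ ι j
    ι≢ι i≢j p = i≢j (inject≤-injective _ _ _ _ p)

    ι≢ε : ∀ i j → ι i ≢ ε j
    ι≢ε i j p = ℕ.<⇒≱ (toℕ<n i) (subst (n ≤_)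
        (trans (sym (trans (cong toℕ p) (toℕ-↑ʳ n j))) (toℕ-inject≤ i _)) (ℕ.m≤m+n n (toℕ j)))

    ε≢ε : ∀ {i j} → i ≢ j → ε i ≢ ε j
    ε≢ε i≢j p = i≢j (Fin.↑ʳ-injective n _ _ p)

    fixed-ι : ∀ {k} x → Fixedᴮ k x → Fixed (ι k) (f x)
    fixed-ι {k} x p = C.trans (C.sym (F.c-homo k x)) (F.cong p)

    fixed-ε : ∀ x j → Fixed (ε j) (f x)
    fixed-ε x j = neat x (ε j) (subst (n ≤_) (sym (toℕ-↑ʳ n j)) (ℕ.m≤m+n n (toℕ j)))

    f-≤ : ∀ x y → x 𝔅.≤ᴬ y → f x ≤ᴬ f y
    f-≤ x y p = C.trans (F.cong p) (F.∧-homo x y)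

    f-disjoint : ∀ x y z → x 𝔅.∧ (y 𝔅.∧ z) 𝔅.≈ 𝔅.⊥ → f x ∧ (f y ∧ f z) ≈ C.⊥
    f-disjoint x y z p = C.trans (C.∧-cong C.refl (C.sym (F.∧-homo y z)))
        (C.trans (C.sym (F.∧-homo x _)) (C.trans (F.cong p) F.⊥-homo))

    f-s : ∀ x a b → f (x ⟪ a ≔ b ⟫) ≈ f x ⟨ ι a ≔ ι b ⟩
    f-s x a b = C.trans (F.c-homo a _)
        (C.c-cong (ι a) (C.trans (F.∧-homo _ x) (C.∧-cong (F.d-homo a b) C.refl)))

    -- Apexes are moved to the spare dimensions, so that the coordinates from 1 on can go on holding
    -- one and the same hub for all of them.
    At : 𝔅.Carrier → Fin 3 → C.Carrier
    At x α = f x ⟨ ι 0ᶠ ≔ ε α ⟩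

    R : ∀ l → Small l → Fin 3 → Fin 3 → C.Carrier
    R l sl α β = f (Lab l sl 0ᶠ 1ᶠ) ⟨ ι 1ᶠ ≔ ε β ⟩ ⟨ ι 0ᶠ ≔ ε α ⟩

    -- The second end of a label may equally be brought in through coordinate 2. This is used when
    -- coordinate 1 is occupied by a member of the hub or by another apex.
    slide₂ : ∀ l sl β → f (Lab l sl 0ᶠ 2ᶠ) ⟨ ι 2ᶠ ≔ ε β ⟩ ≈ f (Lab l sl 0ᶠ 1ᶠ) ⟨ ι 1ᶠ ≔ ε β ⟩
    slide₂ l sl β = C.trans (s-cong (C.trans (F.cong (Lab-02 l sl)) (f-s (Lab l sl 0ᶠ 1ᶠ) 1ᶠ 2ᶠ)))
      (s-move (ι≢ι λ ()) (ι≢ε 2ᶠ β) (ι≢ε 1ᶠ β) (fixed-ι (Lab l sl 0ᶠ 1ᶠ) (Lab-fixed l sl 2ᶠ (λ ()) (λ ()))))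

    exchange : ∀ {x y z} → x ∧ (y ∧ z) ≈ C.⊥ → y ∧ (x ∧ z) ≈ C.⊥
    exchange p = C.trans (C.sym (C.∧-assoc _ _ _))
        (C.trans (C.∧-cong (C.∧-comm _ _) C.refl) (C.trans (C.∧-assoc _ _ _) p))

    -- Coordinate 0 is moved to `ε α` and coordinate `k` to `ε β`. Each of the two substitutions
    -- leaves one of the three elements alone, as `s-triple` demands: the second apex is not at
    -- coordinate 0, and the first one does not involve `k`.
    pair : ∀ x y k l sl α β → 0ᶠ ≢ k → Fixedᴮ k x → Fixedᴮ k y →
           f (Lab l sl 0ᶠ k) ⟨ ι k ≔ ε β ⟩ ≈ f (Lab l sl 0ᶠ 1ᶠ) ⟨ ι 1ᶠ ≔ ε β ⟩ →
           x 𝔅.∧ (y ⟪ 0ᶠ ≔ k ⟫ 𝔅.∧ Lab l sl 0ᶠ k) 𝔅.≈ 𝔅.⊥ → At x α ∧ (At y β ∧ R l sl α β) ≈ C.⊥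
    pair x y k l sl α β 0≢k fx fy slide p = C.trans (C.∧-cong C.refl (C.∧-cong at-y at-r)) step₂
      where
      y′ r : C.Carrier
      y′ = f y ⟨ ι 0ᶠ ≔ ι k ⟩
      r = f (Lab l sl 0ᶠ k)
      step₀ : f x ∧ (y′ ∧ r) ≈ C.⊥
      step₀ = C.trans (C.∧-cong C.refl (C.∧-cong (C.sym (f-s y 0ᶠ k)) C.refl))
          (f-disjoint x (y ⟪ 0ᶠ ≔ k ⟫) (Lab l sl 0ᶠ k) p)
      step₁ : At x α ∧ (y′ ∧ r ⟨ ι 0ᶠ ≔ ε α ⟩) ≈ C.⊥
      step₁ = exchange (s-triple (ι≢ε 0ᶠ α) s-fixed (exchange step₀))
      step₂ : At x α ∧ (y′ ⟨ ι k ≔ ε β ⟩ ∧ r ⟨ ι 0ᶠ ≔ ε α ⟩ ⟨ ι k ≔ ε β ⟩) ≈ C.⊥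
      step₂ = s-triple (ι≢ε k β) (s-fixed-off (ι≢ι (0≢k ∘ sym)) (ι≢ε k α) (fixed-ι x fx)) step₁
      at-y : At y β ≈ y′ ⟨ ι k ≔ ε β ⟩
      at-y = C.sym (s-move (ι≢ι 0≢k) (ι≢ε k β) (ι≢ε 0ᶠ β) (fixed-ι y fy))
      at-r : R l sl α β ≈ r ⟨ ι 0ᶠ ≔ ε α ⟩ ⟨ ι k ≔ ε β ⟩
      at-r = C.trans (s-cong (C.sym slide)) (s-comm (ι≢ι 0≢k) (ι≢ε 0ᶠ β) (ι≢ε k α))

    -- Coordinates 0, 1 and 2 are moved in turn; at each step the label of the opposite side does
    -- not mention the coordinate concerned.
    triangle : ∀ e e′ e″ s s′ s″ α β γ → ¬ Compat e e′ → R (node e′) s′ β γ ∧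
        (R (node e) s α β ∧ R (node e″) s″ α γ) ≈ C.⊥
    triangle e e′ e″ s s′ s″ α β γ ¬c = C.trans (C.∧-cong at-12 (C.∧-cong at-01 at-02)) (exchange step₃)
      where
      r₀₁ r₀₂ r₁₂ : C.Carrier
      r₀₁ = f (Lab (node e) s 0ᶠ 1ᶠ)
      r₀₂ = f (Lab (node e″) s″ 0ᶠ 2ᶠ)
      r₁₂ = f (Lab (node e′) s′ 1ᶠ 2ᶠ)
      step₁ : r₁₂ ∧ (r₀₁ ⟨ ι 0ᶠ ≔ ε α ⟩ ∧ r₀₂ ⟨ ι 0ᶠ ≔ ε α ⟩) ≈ C.⊥
      step₁ = s-triple (ι≢ε 0ᶠ α) (fixed-ι (Lab (node e′) s′ 1ᶠ 2ᶠ) (Lab-fixed (node e′) s′ 0ᶠ (λ ()) (λ ())))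
        (f-disjoint (Lab (node e′) s′ 1ᶠ 2ᶠ) (Lab (node e) s 0ᶠ 1ᶠ) (Lab (node e″) s″ 0ᶠ 2ᶠ)
            (labels-triangle e e′ e″ s s′ s″ ¬c))
      step₂ : r₀₂ ⟨ ι 0ᶠ ≔ ε α ⟩ ∧ (r₁₂ ⟨ ι 1ᶠ ≔ ε β ⟩ ∧ r₀₁ ⟨ ι 0ᶠ ≔ ε α ⟩ ⟨ ι 1ᶠ ≔ ε β ⟩) ≈ C.⊥
      step₂ = s-triple (ι≢ε 1ᶠ β) (s-fixed-off (ι≢ι λ ()) (ι≢ε 1ᶠ α)
        (fixed-ι (Lab (node e″) s″ 0ᶠ 2ᶠ) (Lab-fixed (node e″) s″ 1ᶠ (λ ()) (λ ())))) (rotate step₁)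
      step₃ : r₀₁ ⟨ ι 0ᶠ ≔ ε α ⟩ ⟨ ι 1ᶠ ≔ ε β ⟩ ∧
          (r₁₂ ⟨ ι 1ᶠ ≔ ε β ⟩ ⟨ ι 2ᶠ ≔ ε γ ⟩ ∧ r₀₂ ⟨ ι 0ᶠ ≔ ε α ⟩ ⟨ ι 2ᶠ ≔ ε γ ⟩) ≈ C.⊥
      step₃ = C.trans (C.∧-cong C.refl (C.∧-comm _ _)) (s-triple (ι≢ε 2ᶠ γ)
        (s-fixed-off (ι≢ι λ ()) (ι≢ε 2ᶠ β) (s-fixed-off (ι≢ι λ ()) (ι≢ε 2ᶠ α)
          (fixed-ι (Lab (node e) s 0ᶠ 1ᶠ) (Lab-fixed (node e) s 2ᶠ (λ ()) (λ ())))))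
        (rotate step₂))
      at-01 : R (node e) s α β ≈ r₀₁ ⟨ ι 0ᶠ ≔ ε α ⟩ ⟨ ι 1ᶠ ≔ ε β ⟩
      at-01 = s-comm (ι≢ι λ ()) (ι≢ε 0ᶠ β) (ι≢ε 1ᶠ α)
      at-02 : R (node e″) s″ α γ ≈ r₀₂ ⟨ ι 0ᶠ ≔ ε α ⟩ ⟨ ι 2ᶠ ≔ ε γ ⟩
      at-02 = C.trans (s-cong (C.sym (slide₂ (node e″) s″ γ))) (s-comm (ι≢ι λ ()) (ι≢ε 0ᶠ γ) (ι≢ε 2ᶠ α))
      at-12 : R (node e′) s′ β γ ≈ r₁₂ ⟨ ι 1ᶠ ≔ ε β ⟩ ⟨ ι 2ᶠ ≔ ε γ ⟩
      at-12 = C.trans (s-cong (C.sym (slide₂ (node e′) s′ γ)))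
          (C.trans (s-comm (ι≢ι λ ()) (ι≢ε 0ᶠ γ) (ι≢ε 2ᶠ β))
        (s-cong (C.sym (C.trans (s-cong
            (C.trans (F.cong (Lab-12 (node e′) s′)) (f-s (Lab (node e′) s′ 0ᶠ 2ᶠ) 0ᶠ 1ᶠ)))
          (s-move (ι≢ι λ ()) (ι≢ε 1ᶠ β) (ι≢ε 0ᶠ β)
              (fixed-ι (Lab (node e′) s′ 0ᶠ 2ᶠ) (Lab-fixed (node e′) s′ 1ᶠ (λ ()) (λ ()))))))))

    -- Over a hub of infinite height there is an apex of every tint, and a spare dimension on which
    -- `Z` does not depend is free to receive it.
    grow : ∀ Z t γ → Fixed (ε γ) Z → Z ≤ᴬ f Top → Z ∧ At (Cone t) γ ≈ C.⊥ → Z ≈ C.⊥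
    grow Z t γ fz Z≤ = meets fz (≤ᴬ-trans Z≤ (≤ᴬ-trans (f-≤ Top (𝔅.c 0ᶠ (Cone t)) (Top≤Cone t))
      (≤ᴬ-reflexive (C.trans (F.c-homo 0ᶠ (Cone t)) (C.sym (c-s (ι≢ε 0ᶠ γ) (fixed-ε (Cone t) γ)))))))

    -- Here completeness of the embedding enters. The conjugates of the two substitutions in `R`
    -- turn `Z` into `w`, which is disjoint from all small labels. As these have supremum 1 in `C`
    -- as well, `w` vanishes, and then so does `Z`.
    split : ∀ Z α β → (∀ l sl → Z ∧ R l sl α β ≈ C.⊥) → Z ≈ C.⊥
    split Z α β dead = ≈⊥-∧ (s-cancel (ι≢ε 1ᶠ β) (¬≈⊤⇒≈⊥ (complete IsSmallLab small-labels (C.¬ w) below)))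
      where
      v w : C.Carrier
      v = C.c (ι 0ᶠ) Z ∧ C.d (ι 0ᶠ) (ε α)
      w = C.c (ι 1ᶠ) v ∧ C.d (ι 1ᶠ) (ε β)
      ≈⊥-∧ : v ≈ C.⊥ → Z ≈ C.⊥
      ≈⊥-∧ = s-cancel (ι≢ε 0ᶠ α)
      below : ∀ {x} → IsSmallLab x → f x ≤ᴬ C.¬ w
      below (l , sl , p) = disjoint⇒≤¬
          (C.trans (C.∧-cong C.refl (F.cong p)) (s-conjugate (s-conjugate (dead l sl))))

    kill : ∀ {Z P Q S : C.Carrier} → Z ≤ᴬ P → Z ≤ᴬ Q → P ∧ (Q ∧ S) ≈ C.⊥ → Z ∧ S ≈ C.⊥
    kill p q = ≤⊥ (∧-greatest (≤ᴬ-trans (∧-lowerˡ _ _) p)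
        (∧-greatest (≤ᴬ-trans (∧-lowerˡ _ _) q) (∧-lowerʳ _ _)))

    Long : ℕ → Label → Set
    Long t (node e) = length e ≡ t
    Long t _        = ⊥

    long? : ∀ t l → Dec (Long t l)
    long? t l = em

    -- Apexes of different tints are distinct, which excludes `none`; their common hub excludes the
    -- white labels; and a node must have the level of the greater tint.
    kill-label : ∀ {Z t t′ α β} l sl → t < t′ → Z ≤ᴬ At (Cone t) α → Z ≤ᴬ At (Cone t′) β → ¬ Long t′ l →
        Z ∧ R l sl α β ≈ C.⊥
    kill-label {Z} {t} {t′} {α} {β} l sl t<t′ p q short = go l sl short
      where
      tints : ∀ l sl → Tint t 𝔅.∧ (Tint t′ ⟪ 0ᶠ ≔ 1ᶠ ⟫ 𝔅.∧ Lab l sl 0ᶠ 1ᶠ) 𝔅.≈ 𝔅.⊥ → Z ∧ R l sl α β ≈ C.⊥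
      tints l sl apart = kill (≤ᴬ-trans p (s-mono (f-≤ (Cone t) (Tint t) (Cone≤Tint t))))
          (≤ᴬ-trans q (s-mono (f-≤ (Cone t′) (Tint t′) (Cone≤Tint t′))))
        (pair (Tint t) (Tint t′) 1ᶠ l sl α β (λ ()) (Tint-fixed t 1ᶠ λ ()) (Tint-fixed t′ 1ᶠ λ ()) C.refl apart)
      edges : ∀ j sl k → 0ᶠ ≢ k → suc j ≢ k → f (Lab (white j) sl 0ᶠ k) ⟨ ι k ≔ ε β ⟩ ≈ f
          (Lab (white j) sl 0ᶠ 1ᶠ) ⟨ ι 1ᶠ ≔ ε β ⟩ →
              Z ∧ R (white j) sl α β ≈ C.⊥
      edges j sl k 0≢k j≢k slide = kill (≤ᴬ-trans p (s-mono (f-≤ (Cone t) (Edge j) (Cone≤Edge t j))))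
          (≤ᴬ-trans q (s-mono (f-≤ (Cone t′) (Edge j) (Cone≤Edge t′ j))))
        (pair (Edge j) (Edge j) k (white j) sl α β 0≢k (Edge-fixed j k 0≢k j≢k)
            (Edge-fixed j k 0≢k j≢k) slide (edges-white j k sl 0≢k))
      go : ∀ l sl → ¬ Long t′ l → Z ∧ R l sl α β ≈ C.⊥
      go none sl _ = tints none sl (tints-none sl t<t′)
      -- Coordinate 1 holds the member of the hub of kind `W zero`, so the other apex comes in
      -- through coordinate 2.
      go (white zero) sl _ = edges zero sl 2ᶠ (λ ()) (λ ()) (slide₂ (white zero) sl β)
      go (white (suc j)) sl _ = edges (suc j) sl 1ᶠ (λ ()) (λ ()) C.refl
      go (node e) sl ¬l = tints (node e) sl (tints-node e sl t<t′ ¬l)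

    -- Two apexes over a hub of infinite height with label e force a third apex, whose label properly
    -- extends e and so has smaller rank.
    descend : ∀ {ρ} → Acc _≺_ ρ → ∀ e sl {t t′} → lastRank ∞ e ≡ ρ → t < t′ → length e ≡ t′ → ∀ {α β γ} →
        α ≢ γ → β ≢ γ → α ≢ β →
              f Top ∧ (At (Cone t) α ∧ (At (Cone t′) β ∧ R (node e) sl α β)) ≈ C.⊥
    descend (acc rec) e sl {t} {t′} refl t<t′ refl {α} {β} {γ} α≢γ β≢γ α≢β = grow Z₀ (suc t′) γ fixed
        (∧-lowerˡ _ _) (split Z₁ β γ third)
      where
      Z₀ Z₁ : C.Carrier
      Z₀ = f Top ∧ (At (Cone t) α ∧ (At (Cone t′) β ∧ R (node e) sl α β))
      Z₁ = Z₀ ∧ At (Cone (suc t′)) γ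
      at-fixed : ∀ x {δ} → δ ≢ γ → Fixed (ε γ) (At x δ)
      at-fixed x {δ} δ≢γ = s-fixed-off (ι≢ε 0ᶠ γ ∘ sym) (ε≢ε (δ≢γ ∘ sym)) (fixed-ε x γ)
      fixed : Fixed (ε γ) Z₀
      fixed = c-fixed-∧ C (ε γ) (fixed-ε Top γ)
          (c-fixed-∧ C (ε γ) (at-fixed (Cone t) α≢γ) (c-fixed-∧ C (ε γ) (at-fixed (Cone t′) β≢γ)
        (s-fixed-off (ι≢ε 0ᶠ γ ∘ sym) (ε≢ε (α≢γ ∘ sym))
            (s-fixed-off (ι≢ε 1ᶠ γ ∘ sym) (ε≢ε (β≢γ ∘ sym)) (fixed-ε (Lab (node e) sl 0ᶠ 1ᶠ) γ)))))
      Z₁≤α : Z₁ ≤ᴬ At (Cone t) α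
      Z₁≤α = ≤ᴬ-trans (∧-lowerˡ _ _) (≤ᴬ-trans (∧-lowerʳ _ _) (∧-lowerˡ _ _))
      Z₁≤βe : Z₁ ≤ᴬ At (Cone t′) β ∧ R (node e) sl α β
      Z₁≤βe = ≤ᴬ-trans (∧-lowerˡ _ _) (≤ᴬ-trans (∧-lowerʳ _ _) (∧-lowerʳ _ _))
      Z₁≤β : Z₁ ≤ᴬ At (Cone t′) β
      Z₁≤β = ≤ᴬ-trans Z₁≤βe (∧-lowerˡ _ _)
      Z₁≤γ : Z₁ ≤ᴬ At (Cone (suc t′)) γ
      Z₁≤γ = ∧-lowerʳ _ _
      third : ∀ l sl′ → Z₁ ∧ R l sl′ β γ ≈ C.⊥
      third l sl′ with long? (suc t′) l
      third l sl′ | no short = kill-label l sl′ (ℕ.n<1+n t′) Z₁≤β Z₁≤γ short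
      third (node e′) sl′ | yes long with em {Compat e e′}
      -- The apex at `α` is given up: those at `β` and `γ` with label `e′` are the next instance,
      -- and `α` becomes the free dimension.
      ... | yes c = ≤⊥ (∧-greatest (≤ᴬ-trans (∧-lowerˡ _ _) (≤ᴬ-trans (∧-lowerˡ _ _) (∧-lowerˡ _ _)))
                      (∧-greatest (≤ᴬ-trans (∧-lowerˡ _ _) Z₁≤β) (∧-mono Z₁≤γ (≤ᴬ-reflexive C.refl))))
          (descend (rec (lastRank-≺ (proj₁ sl′) (subst (λ ℓ → Agree ℓ e e′) shorter c) long)) e′ sl′ refl
              (ℕ.n<1+n t′) long
            (α≢β ∘ sym) (α≢γ ∘ sym) β≢γ)
        where
        shorter : length e ⊓ length e′ ≡ length e
        shorter = ℕ.m≤n⇒m⊓n≡m (subst (length e ≤_) (sym long) (ℕ.n≤1+n _))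
      -- Whatever node labels `α` and `γ`, it closes a triangle in which `e` and `e′` would have to
      -- be compatible.
      ... | no ¬c = split (Z₁ ∧ R (node e′) sl′ β γ) α γ fourth
        where
        fourth : ∀ l sl″ → (Z₁ ∧ R (node e′) sl′ β γ) ∧ R l sl″ α γ ≈ C.⊥
        fourth l sl″ with long? (suc t′) l
        fourth l sl″ | no short = kill-label l sl″ (ℕ.m<n⇒m<1+n t<t′) (≤ᴬ-trans (∧-lowerˡ _ _) Z₁≤α)
            (≤ᴬ-trans (∧-lowerˡ _ _) Z₁≤γ) short
        fourth (node e″) sl″ | yes _ = kill (∧-lowerʳ _ _)
            (≤ᴬ-trans (∧-lowerˡ _ _) (≤ᴬ-trans Z₁≤βe (∧-lowerʳ _ _)))
          (triangle e e′ e″ sl sl′ sl″ α β γ ¬c)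

    -- Tints 0 and 1 make the first label a node of length 1, so that its last rank is an ordinal
    -- and not the ∞ of the root.
    contradictory : ⊥
    contradictory = Top≉⊥ (faithful (grow (f Top) 0 zero (fixed-ε Top zero) (≤ᴬ-reflexive C.refl)
      (grow Z₀ 1 (suc zero) fixed (∧-lowerˡ _ _) (split Z₁ zero (suc zero) second))))
      where
      Z₀ Z₁ : C.Carrier
      Z₀ = f Top ∧ At (Cone 0) zero
      Z₁ = Z₀ ∧ At (Cone 1) (suc zero)
      fixed : Fixed (ε (suc zero)) Z₀
      fixed = c-fixed-∧ C (ε (suc zero)) (fixed-ε Top (suc zero))
        (s-fixed-off (ι≢ε 0ᶠ (suc zero) ∘ sym) (ε≢ε λ ()) (fixed-ε (Cone 0) (suc zero)))
      second : ∀ l sl → Z₁ ∧ R l sl zero (suc zero) ≈ C.⊥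
      second l sl with long? 1 l
      second l sl | no short = kill-label l sl (s≤s z≤n) (≤ᴬ-trans (∧-lowerˡ _ _) (∧-lowerʳ _ _))
          (∧-lowerʳ _ _) short
      second (node e) sl | yes long = ≤⊥
          (∧-greatest (≤ᴬ-trans (∧-lowerˡ _ _) (≤ᴬ-trans (∧-lowerˡ _ _) (∧-lowerˡ _ _)))
          (∧-greatest (≤ᴬ-trans (∧-lowerˡ _ _) (≤ᴬ-trans (∧-lowerˡ _ _) (∧-lowerʳ _ _)))
              (∧-mono (∧-lowerʳ _ _) (≤ᴬ-reflexive C.refl))))
        (descend (≺-acc (lastRank-finite {e = e} (subst (0 <_) (sym long) (s≤s z≤n)) (proj₂ sl))) e sl refl
            (s≤s z≤n) long
          {γ = suc (suc zero)} (λ ()) (λ ()) (λ ()))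

-- Copying a node from one face to another.

module Copy (em : ExcludedMiddle 0ℓ) (m : ℕ) where
  open Model em m

  data SameShape : Label → Label → Set where
    none  : SameShape none none
    white : ∀ {j} → SameShape (white j) (white j)
    node  : ∀ {e e′} → SameShape (node e) (node e′)

  shape-refl : ∀ {l} → SameShape l l
  shape-refl {none}    = none
  shape-refl {white _} = white
  shape-refl {node _}  = node

  shape-sym : ∀ {l l′} → SameShape l l′ → SameShape l′ l
  shape-sym none  = none
  shape-sym white = white
  shape-sym node  = node

  shape-trans : ∀ {l l′ l″} → SameShape l l′ → SameShape l′ l″ → SameShape l l″
  shape-trans none  none  = none
  shape-trans white white = white
  shape-trans node  node  = node

  shape-≡ : ∀ {l l′} → l ≡ l′ → SameShape l l′
  shape-≡ refl = shape-refl

  height : Branch → Maybe ℕ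
  height = Maybe.map length

  Fits-height : ∀ {t} b b′ → height b ≡ height b′ → Fits t b → Fits t b′
  Fits-height nothing  nothing   _ _ = tt
  Fits-height {t} (just e) (just e′) p q = subst (t ≤_) (just-injective p) q

  -- This is the part of a tuple visible to every relation; the nodes on its labels are compared
  -- separately, up to a threshold. Any selection `κ` of entries may form a hub, so the heights of
  -- all of them count.
  record Sh (S : Structure) {p : ℕ} (s t : Fin p → ℕ) : Set where
    open Structure S
    field
      kind≡ : ∀ q → kind (s q) ≡ kind (t q)
      same→ : ∀ q q′ → s q ≡ s q′ → t q ≡ t q′
      same← : ∀ q q′ → t q ≡ t q′ → s q ≡ s q′
      adj≡  : ∀ q q′ → adj (s q) (s q′) ≡ adj (t q) (t q′)
      lab≡  : ∀ q q′ → SameShape (lab (s q) (s q′)) (lab (t q) (t q′))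
      ht≡   : ∀ (κ : Vec (Fin p) h) → height (br (Vec.map s κ)) ≡ height (br (Vec.map t κ))

  module _ {S : Structure} where
    Sh-refl : ∀ {p} {s : Fin p → ℕ} → Sh S s s
    Sh-refl = record { kind≡ = λ _ → refl ; same→ = λ _ _ p → p ; same← = λ _ _ p → p ; adj≡ = λ _ _ → refl
                     ; lab≡ = λ _ _ → shape-refl ; ht≡ = λ _ → refl }

    Sh-sym : ∀ {p} {s t : Fin p → ℕ} → Sh S s t → Sh S t s
    Sh-sym σ = record { kind≡ = λ q → sym (kind≡ q) ; same→ = same← ; same← = same→ ; adj≡ = λ q q′ → sym
        (adj≡ q q′)
                      ; lab≡ = λ q q′ → shape-sym (lab≡ q q′) ; ht≡ = λ κ → sym (ht≡ κ) }
      where open Sh σ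

    Sh-trans : ∀ {p} {s t u : Fin p → ℕ} → Sh S s t → Sh S t u → Sh S s u
    Sh-trans σ τ = record
      { kind≡ = λ q → trans (σ.kind≡ q) (τ.kind≡ q)
      ; same→ = λ q q′ → τ.same→ q q′ ∘ σ.same→ q q′ ; same← = λ q q′ → σ.same← q q′ ∘ τ.same← q q′
      ; adj≡ = λ q q′ → trans (σ.adj≡ q q′) (τ.adj≡ q q′)
      ; lab≡ = λ q q′ → shape-trans (σ.lab≡ q q′) (τ.lab≡ q q′) ; ht≡ = λ κ → trans (σ.ht≡ κ) (τ.ht≡ κ) }
      where
      module σ = Sh σ
      module τ = Sh τ

    Sh-reindex : ∀ {p r} {s t : Fin p → ℕ} {s′ t′ : Fin r → ℕ} (ρ : Fin r → Fin p) →
                 (∀ q → s′ q ≡ s (ρ q)) → (∀ q → t′ q ≡ t (ρ q)) → Sh S s t → Sh S s′ t′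
    Sh-reindex {s = s} {t} {s′} {t′} ρ s≡ t≡ σ = record
      { kind≡ = λ q → trans (cong kind (s≡ q)) (trans (kind≡ (ρ q)) (cong kind (sym (t≡ q))))
      ; same→ = λ q q′ e → trans (t≡ q)
          (trans (same→ (ρ q) (ρ q′) (trans (sym (s≡ q)) (trans e (s≡ q′)))) (sym (t≡ q′)))
      ; same← = λ q q′ e → trans (s≡ q)
          (trans (same← (ρ q) (ρ q′) (trans (sym (t≡ q)) (trans e (t≡ q′)))) (sym (s≡ q′)))
      ; adj≡ = λ q q′ → trans (cong₂ adj (s≡ q) (s≡ q′))
          (trans (adj≡ (ρ q) (ρ q′)) (sym (cong₂ adj (t≡ q) (t≡ q′))))
      ; lab≡ = λ q q′ → shape-trans (shape-≡ (cong₂ lab (s≡ q) (s≡ q′)))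
                          (shape-trans (lab≡ (ρ q) (ρ q′)) (shape-≡ (sym (cong₂ lab (t≡ q) (t≡ q′)))))
      ; ht≡ = λ κ → trans (cong (height ∘ br) (map≡ s≡ κ))
          (trans (ht≡ (Vec.map ρ κ)) (cong (height ∘ br) (sym (map≡ t≡ κ)))) }
      where
      open Structure S
      open Sh σ
      map≡ : ∀ {u : Fin _ → ℕ} {u′ : Fin _ → ℕ} → (∀ q → u′ q ≡ u (ρ q)) → ∀ κ → Vec.map u′ κ ≡ Vec.map u
          (Vec.map ρ κ)
      map≡ {u} p κ = trans (map-cong p κ) (map-∘ u ρ κ)

  Extends : (S : Structure) (k : ℕ) → (Structure → Set) → Set
  Extends S k P = Σ[ S′ ∈ Structure ] Invariants S′ × OffNode k S S′ × P S′

  -- c over g is copied to the new node k over f, with new labels l of the same shape.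
  record Copyable (S : Structure) (k c : ℕ) (g f : Fin h → ℕ) (l : Fin h → Label) : Set where
    open Structure S
    field
      c≢k    : c ≢ k
      g≢k    : ∀ q → g q ≢ k
      f≢k    : ∀ q → f q ≢ k
      g≢c    : ∀ q → g q ≢ c
      sh     : Sh S g f
      shape  : ∀ q → SameShape (lab c (g q)) (l q)
      l-cong : ∀ {q q′} → f q ≡ f q′ → l q ≡ l q′
      l-node : ∀ {q s t e} → kind c ≡ X s → kind (f q) ≡ X t → l q ≡ node e → length e ≡ s ⊔ t × Valid e
      l-tri  : ∀ {q q′ e e′ e″} → l q ≡ node e → l q′ ≡ node e′ → lab (f q) (f q′) ≡ node e″ →
               Compat e e′ × Compat e e″

  Copied : (k c : ℕ) (g f : Fin h → ℕ) (l : Fin h → Label) → Structure → Set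
  Copied k c g f l S = Sh S (c ◂ g) (k ◂ f) × (∀ q → Structure.lab S k (f q) ≡ l q)

  module CopyNode {S : Structure} (I : Invariants S) {k c : ℕ} {g f : Fin h → ℕ} {l : Fin h → Label}
                  (V : Copyable S k c g f l) where
    open Structure S
    open Invariants I
    open Copyable V
    open Sh sh

    source target : Fin n → ℕ
    source = c ◂ g
    target = k ◂ f

    target⇒source : ∀ i j → target i ≡ target j → source i ≡ source j
    target⇒source zero zero _ = refl
    target⇒source zero (suc q) p = contradiction (sym p) (f≢k q)
    target⇒source (suc q) zero p = contradiction p (f≢k q)
    target⇒source (suc q) (suc q′) p = same← q q′ p

    source⇒target : ∀ i j → source i ≡ source j → target i ≡ target j
    source⇒target zero zero _ = refl
    source⇒target zero (suc q) p = contradiction (sym p) (g≢c q)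
    source⇒target (suc q) zero p = contradiction p (g≢c q)
    source⇒target (suc q) (suc q′) p = same→ q q′ p

    source≢k : ∀ i → source i ≢ k
    source≢k zero = c≢k
    source≢k (suc q) = g≢k q

    map-target⇒source : ∀ {r} (κ κ′ : Vec (Fin n) r) → Vec.map target κ ≡ Vec.map target κ′ →
        Vec.map source κ ≡ Vec.map source κ′
    map-target⇒source [] [] _ = refl
    map-target⇒source (i ∷ κ) (j ∷ κ′) p =
      cong₂ _∷_ (target⇒source i j (cong Vec.head p)) (map-target⇒source κ κ′ (cong Vec.tail p))

    opaque
      -- Tuples within the target inherit the branch of their source, which keeps heights equal; the
      -- remaining tuples through the new node are left to `default`.
      declare : (Vec ℕ h → Branch) → Vec ℕ h → Branch
      declare default u with em {∃[ κ ] Vec.map target κ ≡ u}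
      ... | yes (κ , _) = br (Vec.map source κ)
      ... | no  _       = default u

      declare-map : ∀ default κ → declare default (Vec.map target κ) ≡ br (Vec.map source κ)
      declare-map default κ with em {∃[ κ′ ] Vec.map target κ′ ≡ Vec.map target κ}
      ... | yes (κ′ , p) = cong br (map-target⇒source κ′ κ p)
      ... | no  ¬p       = contradiction (κ , refl) ¬p

      declare-elim : ∀ default (P : Vec ℕ h → Branch → Set) →
                     (∀ κ → P (Vec.map target κ) (br (Vec.map source κ))) → (∀ u → P u (default u)) → ∀ u →
                         P u (declare default u)
      declare-elim default P p d u with em {∃[ κ ] Vec.map target κ ≡ u}
      ... | yes (κ , refl) = p κ
      ... | no  _          = d u

    positive : ∀ {r} (κ : Vec (Fin n) r) → (∃[ j ] lookup κ j ≡ zero) ⊎ (∃[ κ′ ] κ ≡ Vec.map suc κ′)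
    positive [] = inj₂ ([] , refl)
    positive (zero ∷ κ) = inj₁ (zero , refl)
    positive (suc i ∷ κ) with positive κ
    ... | inj₁ (j , p) = inj₁ (suc j , p)
    ... | inj₂ (κ′ , p) = inj₂ (i ∷ κ′ , cong (suc i ∷_) p)

    copied : ∀ {S′} → Invariants S′ → OffNode k S S′ → Structure.kind S′ k ≡ kind c →
             (∀ q → Structure.adj S′ k (f q) ≡ adj c (g q)) → (∀ q → Structure.lab S′ k (f q) ≡ l q) →
             (∀ κ → Contains k (Vec.map target κ) → Structure.br S′ (Vec.map target κ) ≡ br
                 (Vec.map source κ)) →
             Copied k c g f l S′
    copied {S′} I′ off kd ad lb bb = record
      { kind≡ = kinds ; same→ = source⇒target ; same← = target⇒source ; adj≡ = adjs ; lab≡ = labs ; ht≡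
          = hts } , lb
      where
      module S′ = Structure S′
      module I′ = Invariants I′
      open OffNode off
      kinds : ∀ i → S′.kind (source i) ≡ S′.kind (target i)
      kinds zero = trans (kind-off c≢k) (sym kd)
      kinds (suc q) = trans (kind-off (g≢k q)) (trans (kind≡ q) (sym (kind-off (f≢k q))))
      adjs : ∀ i j → S′.adj (source i) (source j) ≡ S′.adj (target i) (target j)
      adjs zero zero = trans (I′.adj-self c) (sym (I′.adj-self k))
      adjs zero (suc q) = trans (adj-off c≢k (g≢k q)) (sym (ad q))
      adjs (suc q) zero = trans (I′.adj-sym (g q) c) (trans (adjs zero (suc q)) (I′.adj-sym k (f q)))
      adjs (suc q) (suc q′) = trans (adj-off (g≢k q) (g≢k q′))
          (trans (adj≡ q q′) (sym (adj-off (f≢k q) (f≢k q′))))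
      labs : ∀ i j → SameShape (S′.lab (source i) (source j)) (S′.lab (target i) (target j))
      labs zero zero = shape-≡ (trans (I′.lab-self c) (sym (I′.lab-self k)))
      labs zero (suc q) = shape-trans (shape-≡ (lab-off c≢k (g≢k q)))
          (shape-trans (shape q) (shape-≡ (sym (lb q))))
      labs (suc q) zero = shape-trans (shape-≡ (I′.lab-sym (g q) c))
          (shape-trans (labs zero (suc q)) (shape-≡ (I′.lab-sym k (f q))))
      labs (suc q) (suc q′) = shape-trans (shape-≡ (lab-off (g≢k q) (g≢k q′)))
                                (shape-trans (lab≡ q q′) (shape-≡ (sym (lab-off (f≢k q) (f≢k q′)))))
      br-source : ∀ κ → S′.br (Vec.map source κ) ≡ br (Vec.map source κ)
      br-source κ = br-off λ j p → source≢k (lookup κ j) (trans (sym (lookup-map j source κ)) p)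
      hts : ∀ κ → height (S′.br (Vec.map source κ)) ≡ height (S′.br (Vec.map target κ))
      -- A selection that uses the new node has a declared branch, and any other consists of old
      -- nodes.
      hts κ with positive κ
      ... | inj₁ (j , p) = cong height
          (trans (br-source κ) (sym (bb κ (j , trans (lookup-map j target κ) (cong target p)))))
      ... | inj₂ (κ′ , refl) = trans (cong height (trans (br-source κ) (cong br (sym (map-∘ source suc κ′)))))
                                 (trans (ht≡ κ′) (cong height (sym
                                     (trans (br-off off′) (cong br (sym (map-∘ target suc κ′)))))))
        where
        off′ : ∀ j → lookup (Vec.map target (Vec.map suc κ′)) j ≢ k
        off′ j p = f≢k (lookup κ′ j) (trans
            (sym (trans (lookup-map j target (Vec.map suc κ′)) (cong target (lookup-map j suc κ′)))) p)

    adj-cg : ∀ {q q′} → f q ≡ f q′ → adj c (g q) ≡ adj c (g q′)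
    adj-cg p = cong (adj c) (same← _ _ p)

    label⇒ : ∀ q {j} → l q ≡ white j → lab c (g q) ≡ white j
    label⇒ q p with lab c (g q) | l q | shape q
    label⇒ q refl | _ | _ | white = refl

    label-none : ∀ q → lab c (g q) ≡ none → l q ≡ none
    label-none q p with lab c (g q) | l q | shape q
    ... | _ | _ | none = refl

    none-label : ∀ q → l q ≡ none → lab c (g q) ≡ none
    none-label q p with lab c (g q) | l q | shape q
    ... | _ | _ | none = refl

    copyX : ∀ {t} → kind c ≡ X t → Extends S k (Copied k c g f l)
    copyX {t} kc = A.S′ , A.invariants , A.offNode ,
      copied A.invariants A.offNode (trans A.new-kind (sym kc)) A.new-adj-face A.new-lab-face
        (λ κ C → trans (A.new-br C) (declare-map _ κ))
      where
      -- A hub inside the face `f` corresponds to a hub inside `g` to which `c` is attached, and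
      -- their branches have the same height.
      fits : ∀ (q : Fin h → Fin h) → (∀ j → kind (f (q j)) ≡ W j) → (∀ j → adj c (g (q j)) ≡ true) → Fits t
          (br (tabulate (f ∘ q)))
      fits q kd ads = subst (Fits t ∘ br) (sym (tabulate-∘ f q))
        (Fits-height (br (Vec.map g (tabulate q))) _ (ht≡ (tabulate q))
          (subst (Fits t ∘ br) (tabulate-∘ g q) (hub-fits (tabulate (g ∘ q)) hub att kc)))
        where
        hub : Hub (tabulate (g ∘ q))
        hub j = trans (cong kind (lookup∘tabulate (g ∘ q) j)) (trans (kind≡ (q j)) (kd j))
        att : Attached (tabulate (g ∘ q)) c
        att j = trans (cong (λ a → adj a c) (lookup∘tabulate (g ∘ q) j)) (trans (adj-sym _ c) (ads j))
      N : NewX S k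
      N = record
        { f = f ; f≢k = f≢k ; t = t ; α = λ q → adj c (g q) ; l = l ; r = declare (const nothing)
        ; α-cong = adj-cg
        ; l-cong = l-cong
        ; l-W = λ {q} p → label-none q (lab-Wʳ c (trans (kind≡ q) p))
        ; l-X = λ {q} p e → lab-X kc (trans (kind≡ q) p) (g≢c q ∘ sym) (none-label q e)
        ; l-adj = λ {q} {q′} p a a′ e → lab-adj (trans (kind≡ q) p) (trans (adj-sym _ c) a)
            (trans (adj≡ q q′) a′) (label⇒ q′ e)
        ; l-node = λ p e → l-node kc p e
        ; l-tri = l-tri
        ; α-hub = fits
        ; r-valid = declare-elim _ (λ _ → ValidBranch) (λ κ → br-valid _) (λ _ ())
        }
      module A = AddX I N

    copyW : ∀ {j₀} → kind c ≡ W j₀ → Extends S k (Copied k c g f l)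
    copyW {j₀} kc = A.S′ , A.invariants , A.offNode ,
      copied A.invariants A.offNode (trans A.new-kind (sym kc)) A.new-adj-face
        (λ q → trans (A.lab-at (f q)) (sym (label-none q (lab-W (g q) kc))))
        (λ κ C → trans (A.new-br C) (declare-map _ κ))
      where
      same-white : ∀ {l l′ j} → SameShape l l′ → l′ ≡ white j → l ≡ white j
      same-white white refl = refl
      N : NewW S k
      N = record
        { f = f ; f≢k = f≢k ; j₀ = j₀ ; α = λ q → adj c (g q) ; α-cong = adj-cg
        ; α-lab = λ {q} {q′} a a′ e → lab-adj kc a a′ (same-white (lab≡ q q′) e)
        }
      open NewW N using (Completed; Meets; GoodFits; GoodLab)
      opaque
        default : Vec ℕ h → Branch
        default u with em {Completed u}
        ... | yes C = proj₁ (CompletedBranch.exists I N u C)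
        ... | no  _ = nothing
        default-valid : ∀ u → ValidBranch (default u)
        default-valid u with em {Completed u}
        ... | yes C = proj₁ (proj₂ (CompletedBranch.exists I N u C))
        ... | no  _ = λ ()
        default-fits : ∀ u → Completed u → GoodFits u (default u)
        default-fits u C with em {Completed u}
        ... | yes C = proj₁ (proj₂ (proj₂ (CompletedBranch.exists I N u C)))
        ... | no ¬C = contradiction C ¬C
        default-lab : ∀ u → Completed u → GoodLab u (default u)
        default-lab u C with em {Completed u}
        ... | yes C = proj₂ (proj₂ (proj₂ (CompletedBranch.exists I N u C)))
        ... | no ¬C = contradiction C ¬C
      module _ (κ : Vec (Fin n) h) (C : Completed (Vec.map target κ)) where
        at-j₀ : lookup κ j₀ ≡ zero
        at-j₀ with lookup κ j₀ | trans (sym (lookup-map j₀ target κ)) (proj₁ C)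
        ... | zero  | _ = refl
        ... | suc q | p = contradiction p (f≢k q)
        off-j₀ : ∀ {j} → j ≢ j₀ → ∃[ q ] lookup κ j ≡ suc q × kind (f q) ≡ W j
        off-j₀ {j} j≢ with lookup κ j in eq | proj₂ C j≢
        ... | zero  | p , _ = contradiction (trans (lookup-map j target κ) (cong target eq)) p
        ... | suc q | _ , p = q , refl , trans
            (cong kind (sym (trans (lookup-map j target κ) (cong target eq)))) p
        hub : Hub (Vec.map source κ)
        hub j with j Fin.≟ j₀
        ... | yes refl = trans (cong kind (trans (lookup-map j source κ) (cong source at-j₀))) kc
        ... | no j≢ with off-j₀ j≢
        ...   | q , p , kd = trans (cong kind (trans (lookup-map j source κ) (cong source p)))
            (trans (kind≡ q) kd)
        att : ∀ q → Meets (Vec.map target κ) q → Attached (Vec.map source κ) (g q)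
        att q (a , as) j with j Fin.≟ j₀
        ... | yes refl = trans (cong (λ x → adj x (g q)) (trans (lookup-map j source κ) (cong source at-j₀))) a
        ... | no j≢ with off-j₀ j≢
        ...   | q′ , p , kd = trans (cong (λ x → adj x (g q)) (trans (lookup-map j source κ) (cong source p)))
                  (trans (adj≡ q′ q) (trans (cong (λ x → adj x (f q))
                      (sym (trans (lookup-map j target κ) (cong target p)))) (as j≢)))
        declared-fits : GoodFits (Vec.map target κ) (br (Vec.map source κ))
        declared-fits q M p = hub-fits _ hub (att q M) (trans (kind≡ q) p)
        -- The other members of the hub and one apex fill the face, so there is no room for a second apex.
        module _ (q : Fin h) {s} (kq : kind (f q) ≡ X s) where
          π : Fin h → Fin h
          π j with j Fin.≟ j₀
          ... | yes _ = q
          ... | no j≢ = proj₁ (off-j₀ j≢)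
          π-kind : ∀ j → j ≡ j₀ × π j ≡ q ⊎ kind (f (π j)) ≡ W j
          π-kind j with j Fin.≟ j₀
          ... | yes p = inj₁ (p , refl)
          ... | no j≢ = inj₂ (proj₂ (proj₂ (off-j₀ j≢)))
          X≢W : ∀ {i j} → π i ≡ q → π i ≡ π j → kind (f (π j)) ≢ W j
          X≢W p p′ p″ with trans (sym kq) (trans (cong (kind ∘ f) (trans (sym p) p′)) p″)
          ... | ()
          π-injective : ∀ {i j} → π i ≡ π j → i ≡ j
          π-injective {i} {j} p with π-kind i | π-kind j
          ... | inj₁ (a , _) | inj₁ (b , _) = trans a (sym b)
          ... | inj₁ (_ , a) | inj₂ b = contradiction b (X≢W {i} {j} a p)
          ... | inj₂ a | inj₁ (_ , b) = contradiction a (X≢W {j} {i} b (sym p))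
          ... | inj₂ a | inj₂ b = W-injective (trans (sym a) (trans (cong (kind ∘ f) p) b))
          one-apex : ∀ q′ {t} → kind (f q′) ≡ X t → q′ ≡ q
          one-apex q′ kq′ with injective⇒surjective π π-injective q′
          ... | j , p with π-kind j
          ...   | inj₁ (_ , p′) = trans (sym p) p′
          ...   | inj₂ p′ with trans (sym kq′) (trans (cong (kind ∘ f) (sym p)) p′)
          ...     | ()
      good-fits : ∀ u → Completed u → GoodFits u (declare default u)
      good-fits = declare-elim default (λ u b → Completed u → GoodFits u b) declared-fits default-fits
      good-lab : ∀ u → Completed u → GoodLab u (declare default u)
      good-lab = declare-elim default (λ u b → Completed u → GoodLab u b)
        (λ κ C q q′ M M′ kq kq′ f≢ → contradiction (cong f (sym (one-apex κ C q kq q′ kq′))) f≢) default-lab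
      module A = AddW I N (declare default)
          (declare-elim default (λ _ → ValidBranch) (λ κ → br-valid _) default-valid) good-fits good-lab

    copy-node : Extends S k (Copied k c g f l)
    copy-node with kind c in eq
    ... | X t = copyX eq
    ... | W j = copyW eq

  -- Copying reproduces only configurations that occur already; seeding provides every hub with
  -- apexes of all tints that its height admits.
  record Seedable (S : Structure) (k : ℕ) (u : Vec ℕ h) (t : ℕ) : Set where
    open Structure S
    field
      u≢k  : ∀ j → lookup u j ≢ k
      hub  : Hub u
      fits : Fits t (br u)

  Seeded : (k : ℕ) (u : Vec ℕ h) (t : ℕ) → Structure → Set
  Seeded k u t S = Structure.kind S k ≡ X t × (∀ j → Structure.adj S k (lookup u j) ≡ true)

  seed-node : ∀ {S k u t} → Invariants S → Seedable S k u t → Extends S k (Seeded k u t)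
  seed-node {S} {k} {u} {t} I V = A.S′ , A.invariants , A.offNode , A.new-kind , A.new-adj-face
    where
    open Structure S
    open Seedable V
    W≢X : ∀ {q s} → kind (lookup u q) ≢ X s
    W≢X {q} p with trans (sym (hub q)) p
    ... | ()
    N : NewX S k
    N = record
      { f = lookup u ; f≢k = u≢k ; t = t ; α = const true ; l = const none ; r = const nothing
      ; α-cong = λ _ → refl
      ; l-cong = λ _ → refl
      ; l-W = λ _ → refl
      ; l-X = λ p → contradiction p W≢X
      ; l-adj = λ _ _ _ ()
      ; l-node = λ _ ()
      ; l-tri = λ ()
      ; α-hub = λ q kd _ → subst (Fits t ∘ br) (trans (sym (tabulate∘lookup u))
                  (tabulate-cong (λ j → cong (lookup u)
                      (sym (W-injective (trans (sym (hub (q j))) (kd j))))))) fits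
      ; r-valid = λ _ ()
      }
    module A = AddX I N

-- Countable sets and enumerations with infinite repetition.

Surjection : (A : Set) → (ℕ → A) → Set
Surjection A e = ∀ a → ∃[ k ] e k ≡ a

record Countable (A : Set) : Set where
  constructor countable
  field
    enum : ℕ → A
    hits : Surjection A enum
open Countable

nextPair : ℕ × ℕ → ℕ × ℕ
nextPair (a , zero)  = zero , suc a
nextPair (a , suc b) = suc a , b

unpair : ℕ → ℕ × ℕ
unpair zero    = zero , zero
unpair (suc k) = nextPair (unpair k)

-- The walk takes at least one step per antidiagonal. A pair with a large second component is
-- therefore met late, and this makes every challenge recur.
unpair-hits : ∀ s a b → a + b ≡ s → ∃[ k ] s ≤ k × unpair k ≡ (a , b)
unpair-hits s (suc a) b p with unpair-hits s a (suc b) (trans (+-suc a b) p)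
... | k , s≤k , q = suc k , m≤n⇒m≤1+n s≤k , cong nextPair q
unpair-hits zero zero zero _ = zero , z≤n , refl
unpair-hits (suc s) zero (suc b) p with unpair-hits s b zero (trans (+-identityʳ b) (suc-injective p))
... | k , s≤k , q = suc k , s≤s s≤k , cong nextPair q

image-countable : ∀ {A B : Set} (f : A → B) (g : B → A) → (∀ b → f (g b) ≡ b) → Countable A → Countable B
image-countable f g fg c = countable (f ∘ enum c) λ b → proj₁ (hits c (g b)) , trans
    (cong f (proj₂ (hits c (g b)))) (fg b)

ℕ-countable : Countable ℕ
ℕ-countable = countable id λ k → k , refl

×-countable : ∀ {A B : Set} → Countable A → Countable B → Countable (A × B)
×-countable c d = countable (λ k → enum c (proj₁ (unpair k)) , enum d (proj₂ (unpair k))) λ (a , b) →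
  let i , p = hits c a ; j , q = hits d b ; k , _ , r = unpair-hits (i + j) i j refl
  in k , cong₂ _,_ (trans (cong (enum c ∘ proj₁) r) p) (trans (cong (enum d ∘ proj₂) r) q)

⊎-countable : ∀ {A B : Set} → Countable A → Countable B → Countable (A ⊎ B)
⊎-countable {A} {B} c d = countable (λ k → choose (unpair k)) λ
  { (inj₁ a) → let i , p = hits c a ; k , _ , r = unpair-hits i 0 i refl in k , trans (cong choose r) (cong inj₁ p)
  ; (inj₂ b) → let j , q = hits d b ; k , _ , r = unpair-hits (suc j) 1 j refl in k , trans (cong choose r) (cong inj₂ q) }
  where
  choose : ℕ × ℕ → A ⊎ B
  choose (zero  , k) = inj₁ (enum c k)
  choose (suc _ , k) = inj₂ (enum d k)

⊤-countable : Countable ⊤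
⊤-countable = countable (const tt) λ _ → zero , refl

Vec-countable : ∀ {A : Set} n → Countable A → Countable (Vec A n)
Vec-countable zero    c = image-countable (const []) (const tt) (λ { [] → refl }) ⊤-countable
Vec-countable (suc n) c = image-countable (λ (x , xs) → x ∷ xs) (λ { (x ∷ xs) → x , xs })
    (λ { (x ∷ xs) → refl })
                            (×-countable c (Vec-countable n c))

List-countable : ∀ {A : Set} → Countable A → Countable (List A)
List-countable c = countable (λ k → decode (unpair k)) λ xs →
  let j , q = hits (Vec-countable _ c) (Vec.fromList xs) ; k , _ , r = unpair-hits _ (length xs) j refl
  in k , trans (cong decode r) (trans (cong Vec.toList q) (toList∘fromList xs))
  where
  open import Data.Vec.Properties using (toList∘fromList)
  decode : ℕ × ℕ → List _
  decode (n , k) = Vec.toList (enum (Vec-countable n c) k)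

Fin-countable : ∀ n → Countable (Fin (suc n))
Fin-countable zero = image-countable (const zero) (const tt) (λ { zero → refl }) ⊤-countable
Fin-countable (suc n) = image-countable to from (λ { zero → refl ; (suc _) → refl })
    (⊎-countable ⊤-countable (Fin-countable n))
  where
  to : ⊤ ⊎ Fin (suc n) → Fin (suc (suc n))
  to (inj₁ _) = zero
  to (inj₂ i) = suc i
  from : Fin (suc (suc n)) → ⊤ ⊎ Fin (suc n)
  from zero = inj₁ tt
  from (suc i) = inj₂ i

Node-countable : Countable Node
Node-countable = List-countable (×-countable Rank-countable ℕ-countable)
  where
  Rank-countable : Countable Rank
  Rank-countable = image-countable to from (λ { ∞ → refl ; (fin _ _) → refl })
                     (⊎-countable ⊤-countable (×-countable (×-countable ℕ-countable ℕ-countable) ℕ-countable))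
    where
    to : ⊤ ⊎ (Threshold × ℕ) → Rank
    to (inj₁ _) = ∞
    to (inj₂ (γ , d)) = fin γ d
    from : Rank → ⊤ ⊎ (Threshold × ℕ)
    from ∞ = inj₁ tt
    from (fin γ d) = inj₂ (γ , d)

infinitely-often : ∀ {A : Set} (c : Countable A) a K → ∃[ k ] K ≤ k × enum c (proj₁ (unpair k)) ≡ a
infinitely-often c a K with hits c a
... | i , p with unpair-hits (i + K) i K refl
...   | k , l , q = k , ≤-trans (m≤n+m K i) l , trans (cong (enum c ∘ proj₁) q) p

maximum : ∀ {n} → Vec ℕ n → ℕ
maximum = Vec.foldr _ _⊔_ 0

lookup≤maximum : ∀ {n} (u : Vec ℕ n) j → lookup u j ≤ maximum u
lookup≤maximum (x ∷ u) zero    = m≤m⊔n x _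
lookup≤maximum (x ∷ u) (suc j) = ≤-trans (lookup≤maximum u j) (m≤n⊔m x _)

-- The countable limit structure.

module Limit (em : ExcludedMiddle 0ℓ) (m : ℕ) where
  open Model em m
  open Copy em m

  Label-countable : Countable Label
  Label-countable = image-countable to from (λ { none → refl ; (white _) → refl ; (node _) → refl })
                      (⊎-countable ⊤-countable (⊎-countable (Fin-countable (suc m)) Node-countable))
    where
    to : ⊤ ⊎ Fin h ⊎ Node → Label
    to (inj₁ _) = none
    to (inj₂ (inj₁ j)) = white j
    to (inj₂ (inj₂ e)) = node e
    from : Label → ⊤ ⊎ Fin h ⊎ Node
    from none = inj₁ tt
    from (white j) = inj₂ (inj₁ j)
    from (node e) = inj₂ (inj₂ e)

  Challenge : Set
  Challenge = (ℕ × Vec ℕ h × Vec ℕ h × Vec Label h) ⊎ (Vec ℕ h × ℕ)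

  opaque
    Challenge-countable : Countable Challenge
    Challenge-countable = ⊎-countable
      (×-countable ℕ-countable (×-countable ℕ^h (×-countable ℕ^h (Vec-countable h Label-countable))))
      (×-countable ℕ^h ℕ-countable)
      where
      ℕ^h : Countable (Vec ℕ h)
      ℕ^h = Vec-countable h ℕ-countable

    challenge : ℕ → Challenge
    challenge k = enum Challenge-countable (proj₁ (unpair k))

    challenge-recurs : ∀ χ K → ∃[ k ] K ≤ k × challenge k ≡ χ
    challenge-recurs = infinitely-often Challenge-countable

  Possible : Structure → ℕ → Challenge → Set
  Possible S k (inj₁ (c , g , f , l)) = Copyable S k c (lookup g) (lookup f) (lookup l)
  Possible S k (inj₂ (u , t))         = Seedable S k u t

  Met : ℕ → Challenge → Structure → Set
  Met k (inj₁ (c , g , f , l)) = Copied k c (lookup g) (lookup f) (lookup l)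
  Met k (inj₂ (u , t))         = Seeded k u t

  opaque
    meet : ∀ {S k} χ → Invariants S → Possible S k χ → Extends S k (Met k χ)
    meet (inj₁ _) I V = CopyNode.copy-node I V
    meet (inj₂ _) I V = seed-node I V

  index : ℕ → Fin h
  index a with a <? h
  ... | yes p = fromℕ< p
  ... | no  _ = zero

  index-toℕ : ∀ j → index (toℕ j) ≡ j
  index-toℕ j with toℕ j <? h
  ... | yes p = fromℕ<-toℕ j p
  ... | no ¬p = contradiction (toℕ<n j) ¬p

  -- The first h nodes form a hub of infinite height. All further nodes are isolated base nodes, and
  -- remain so if the challenge of their step turns out to be impossible.
  start : Structure
  start = record { kind = W ∘ index ; adj = λ _ _ → false ; lab = λ _ _ → none ; br = const nothing }

  start-invariants : Invariants start
  start-invariants = record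
    { adj-sym = λ _ _ → refl ; adj-self = λ _ → refl ; lab-sym = λ _ _ → refl ; lab-self = λ _ →
        refl ; lab-W = λ _ _ → refl
    ; lab-X = λ () ; lab-adj = λ _ () ; lab-node = λ () ; lab-tri = λ () ; hub-fits = λ _ _ _ () ; hub-lab =
        λ _ _ _ _ ()
    ; br-valid = λ _ () }

  opaque
    attempt : ∀ t (s : Σ Structure Invariants) → Dec (Possible (proj₁ s) (h + t) (challenge t)) →
        Σ Structure Invariants
    attempt t (S , I) (yes V) = let S′ , I′ , _ = meet {S} {h + t} (challenge t) I V in S′ , I′
    attempt t s       (no  _) = s

    attempt-off : ∀ t s d → OffNode (h + t) (proj₁ s) (proj₁ (attempt t s d))
    attempt-off t (S , I) (yes V) = let _ , _ , off , _ = meet {S} {h + t} (challenge t) I V in off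
    attempt-off t s (no _) = record
        { kind-off = λ _ → refl ; adj-off = λ _ _ → refl ; lab-off = λ _ _ → refl ; br-off = λ _ → refl }

    attempt-met : ∀ t s d → Possible (proj₁ s) (h + t) (challenge t) → Met (h + t) (challenge t)
        (proj₁ (attempt t s d))
    attempt-met t (S , I) (yes V) _ = let _ , _ , _ , met = meet {S} {h + t} (challenge t) I V in met
    attempt-met t s (no ¬V) P = contradiction P ¬V

  step : ℕ → Σ Structure Invariants → Σ Structure Invariants
  step t s = attempt t s em

  step-off : ∀ t s → OffNode (h + t) (proj₁ s) (proj₁ (step t s))
  step-off t s = attempt-off t s em

  step-met : ∀ t s → Possible (proj₁ s) (h + t) (challenge t) → Met (h + t) (challenge t) (proj₁ (step t s))
  step-met t s = attempt-met t s em

  stages : ℕ → Σ Structure Invariants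
  stages zero    = start , start-invariants
  stages (suc t) = step t (stages t)

  stage : ℕ → Structure
  stage t = proj₁ (stages t)

  stage-invariants : ∀ t → Invariants (stage t)
  stage-invariants t = proj₂ (stages t)

  module _ {A : Set} (F : Structure → A) (T : ℕ)
           (settled : ∀ {k S S′} → h + T ≤ k → OffNode k S S′ → F S′ ≡ F S) where
    stable : ∀ d → F (stage (d + T)) ≡ F (stage T)
    stable zero    = refl
    stable (suc d) = trans (settled (+-monoʳ-≤ h (m≤n+m T d)) (step-off (d + T) (stages (d + T)))) (stable d)

    stable-≤ : ∀ {T′} → T ≤ T′ → F (stage T′) ≡ F (stage T)
    stable-≤ {T′} l = subst (λ t → F (stage t) ≡ F (stage T)) (m∸n+n≡m l) (stable (T′ Data.Nat.Base.∸ T))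

  module _ {A : Set} (F : Structure → A) (top : ℕ)
           (settled : ∀ {k S S′} → top < k → OffNode k S S′ → F S′ ≡ F S) where
    limit-≡ : ∀ {T} → top < h + T → F (stage (suc top)) ≡ F (stage T)
    limit-≡ {T} l with ≤-total T (suc top)
    ... | inj₁ T≤ = stable-≤ F T (λ k≥ → settled (<-≤-trans l k≥)) T≤
    ... | inj₂ T≥ = sym (stable-≤ F (suc top)
        (λ k≥ → settled (<-≤-trans (<-≤-trans (n<1+n top) (m≤n+m (suc top) h)) k≥)) T≥)

  opaque
    -- A step changes only what involves its own node `h + t`, so the value at `a` is final at every
    -- stage `T` with `a < h + T`; `suc a` is such a stage for all `a` alike.
    M : Structure
    M = record
      { kind = λ a → Structure.kind (stage (suc a)) a
      ; adj  = λ a b → Structure.adj (stage (suc (a ⊔ b))) a b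
      ; lab  = λ a b → Structure.lab (stage (suc (a ⊔ b))) a b
      ; br   = λ u → Structure.br (stage (suc (maximum u))) u
      }
  module M = Structure M

  record Below (B : ℕ) (S S′ : Structure) : Set where
    private
      module S  = Structure S
      module S′ = Structure S′
    field
      kind-on : ∀ {a} → a < B → S.kind a ≡ S′.kind a
      adj-on  : ∀ {a b} → a < B → b < B → S.adj a b ≡ S′.adj a b
      lab-on  : ∀ {a b} → a < B → b < B → S.lab a b ≡ S′.lab a b
      br-on   : ∀ u → (∀ j → lookup u j < B) → S.br u ≡ S′.br u

    sh-on : ∀ {p} {s t : Fin p → ℕ} → (∀ q → s q < B) → (∀ q → t q < B) → Sh S s t → Sh S′ s t
    sh-on {s = s} {t} s< t< σ = record
      { kind≡ = λ q → trans (sym (kind-on (s< q))) (trans (kind≡ q) (kind-on (t< q)))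
      ; same→ = same→ ; same← = same←
      ; adj≡ = λ q q′ → trans (sym (adj-on (s< q) (s< q′))) (trans (adj≡ q q′) (adj-on (t< q) (t< q′)))
      ; lab≡ = λ q q′ → shape-trans (shape-≡ (sym (lab-on (s< q) (s< q′))))
          (shape-trans (lab≡ q q′) (shape-≡ (lab-on (t< q) (t< q′))))
      ; ht≡ = λ κ → trans (cong height (sym (br-on _ (map< s s< κ))))
          (trans (ht≡ κ) (cong height (br-on _ (map< t t< κ)))) }
      where
      open Sh σ
      map< : ∀ (u : Fin _ → ℕ) → (∀ q → u q < B) → ∀ κ j → lookup (Vec.map u κ) j < B
      map< u u< κ j = subst (_< B) (sym (lookup-map j u κ)) (u< (lookup κ j))

  below-sym : ∀ {B S S′} → Below B S S′ → Below B S′ S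
  below-sym β = record { kind-on = λ a → sym (kind-on a) ; adj-on = λ a b → sym (adj-on a b) ; lab-on =
      λ a b → sym (lab-on a b)
                       ; br-on = λ u l → sym (br-on u l) }
    where open Below β

  opaque
    unfolding M
    M≈stage : ∀ T → Below (h + T) M (stage T)
    M≈stage T = record
      { kind-on = λ {a} l → limit-≡ (λ S → Structure.kind S a) a (λ a<k o → OffNode.kind-off o (<⇒≢ a<k)) l
      ; adj-on = λ {a} {b} l l′ → limit-≡ (λ S → Structure.adj S a b) (a ⊔ b)
          (λ k> o → OffNode.adj-off o (<⇒≢ (m⊔n<o⇒m<o a b k>)) (<⇒≢ (m⊔n<o⇒n<o a b k>))) (⊔-pres-<m l l′)
      ; lab-on = λ {a} {b} l l′ → limit-≡ (λ S → Structure.lab S a b) (a ⊔ b)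
          (λ k> o → OffNode.lab-off o (<⇒≢ (m⊔n<o⇒m<o a b k>)) (<⇒≢ (m⊔n<o⇒n<o a b k>))) (⊔-pres-<m l l′)
      ; br-on = λ u l → limit-≡ (λ S → Structure.br S u) (maximum u)
          (λ k> o → OffNode.br-off o (λ j → <⇒≢ (≤-<-trans (lookup≤maximum u j) k>))) (maximum< u l)
      }
      where
      maximum< : ∀ {n B} (u : Vec ℕ n) → (∀ j → lookup u j < suc B) → maximum u < suc B
      maximum< [] _ = s≤s z≤n
      maximum< (x ∷ u) l = ⊔-pres-<m (l zero) (maximum< u (l ∘ suc))

  -- Every instance of an invariant lives in some stage.
  M-invariants : Invariants M
  M-invariants = record
    { adj-sym  = λ a b → let T = a + b ; a< = bound₁ a b ; b< = bound₂ a b in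
                   trans (adj-on (M≈stage T) a< b<)
                       (trans (adj-sym (inv T) a b) (sym (adj-on (M≈stage T) b< a<)))
    ; adj-self = λ a → let a< = bound₂ 0 a in trans (adj-on (M≈stage a) a< a<) (adj-self (inv a) a)
    ; lab-sym  = λ a b → let T = a + b ; a< = bound₁ a b ; b< = bound₂ a b in
                   trans (lab-on (M≈stage T) a< b<)
                       (trans (lab-sym (inv T) a b) (sym (lab-on (M≈stage T) b< a<)))
    ; lab-self = λ a → let a< = bound₂ 0 a in trans (lab-on (M≈stage a) a< a<) (lab-self (inv a) a)
    ; lab-W    = λ {a} b ka → let T = a + b ; a< = bound₁ a b ; b< = bound₂ a b in
                   trans (lab-on (M≈stage T) a< b<) (lab-W (inv T) b (kind← T a< ka))
    ; lab-X    = λ {a} {b} ka kb a≢b e → let T = a + b ; a< = bound₁ a b ; b< = bound₂ a b in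
                   lab-X (inv T) (kind← T a< ka) (kind← T b< kb) a≢b (lab← T a< b< e)
    ; lab-adj  = λ {u} {j} {x} {y} ku a a′ e →
                   let T = u + (x + y) ; u< = bound₁ u (x + y) ; x< = bound₂₁ u x y ; y< = bound₂₂ u x y in
                   lab-adj (inv T) (kind← T u< ku) (adj← T u< x< a) (adj← T u< y< a′) (lab← T x< y< e)
    ; lab-node = λ {x} {y} kx ky e → let T = x + y ; x< = bound₁ x y ; y< = bound₂ x y in
                   lab-node (inv T) (kind← T x< kx) (kind← T y< ky) (lab← T x< y< e)
    ; lab-tri  = λ {x} {y} {z} p q r →
                   let T = x + (y + z) ; x< = bound₁ x (y + z) ; y< = bound₂₁ x y z ; z< = bound₂₂ x y z in
                   lab-tri (inv T) (lab← T x< y< p) (lab← T x< z< q) (lab← T y< z< r)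
    ; hub-fits = λ u {x} {t} H A kx →
                   let T = x + maximum u ; x< = bound₁ x (maximum u) ; u< = λ j → bound₂≤ x (lookup≤maximum u j) in
                   subst (Fits t) (sym (br-on (M≈stage T) u u<))
                     (hub-fits (inv T) u (λ j → kind← T (u< j) (H j)) (λ j → adj← T (u< j) x< (A j))
                         (kind← T x< kx))
    ; hub-lab  = λ u {x} {y} {s} {t} H A A′ kx ky x≢y →
                   let T = x + (y + maximum u) ; x< = bound₁ x (y + maximum u) ; y< = bound₂₁ x y (maximum u)
                       u< = λ j → bound₂≤ x (≤-trans (lookup≤maximum u j) (m≤n+m _ y)) in
                   trans (lab-on (M≈stage T) x< y<) (trans
                     (hub-lab (inv T) u (λ j → kind← T (u< j) (H j)) (λ j → adj← T (u< j) x< (A j))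
                         (λ j → adj← T (u< j) y< (A′ j))
                       (kind← T x< kx) (kind← T y< ky) x≢y)
                     (cong (node ∘ restrict (s ⊔ t)) (sym (br-on (M≈stage T) u u<))))
    ; br-valid = λ u p → let T = maximum u ; u< = λ j → bound₂≤ 0 (lookup≤maximum u j) in
                   br-valid (inv T) u (trans (sym (br-on (M≈stage T) u u<)) p)
    }
    where
    open Below
    open Invariants
    inv = stage-invariants
    kind← : ∀ T {a κ} → a < h + T → M.kind a ≡ κ → Structure.kind (stage T) a ≡ κ
    kind← T a< p = trans (sym (kind-on (M≈stage T) a<)) p
    adj← : ∀ T {a b β} → a < h + T → b < h + T → M.adj a b ≡ β → Structure.adj (stage T) a b ≡ β
    adj← T a< b< p = trans (sym (adj-on (M≈stage T) a< b<)) p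
    lab← : ∀ T {a b ℓ} → a < h + T → b < h + T → M.lab a b ≡ ℓ → Structure.lab (stage T) a b ≡ ℓ
    lab← T a< b< p = trans (sym (lab-on (M≈stage T) a< b<)) p
    bound₁ : ∀ a b → a < h + (a + b)
    bound₁ a b = s≤s (≤-trans (m≤m+n a b) (m≤n+m (a + b) (suc m)))
    bound₂≤ : ∀ a {b c} → b ≤ c → b < h + (a + c)
    bound₂≤ a {b} {c} l = s≤s (≤-trans l (≤-trans (m≤n+m c a) (m≤n+m (a + c) (suc m))))
    bound₂ : ∀ a b → b < h + (a + b)
    bound₂ a b = bound₂≤ a ≤-refl
    bound₂₁ : ∀ a b c → b < h + (a + (b + c))
    bound₂₁ a b c = bound₂≤ a (m≤m+n b c)
    bound₂₂ : ∀ a b c → c < h + (a + (b + c))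
    bound₂₂ a b c = bound₂≤ a (m≤n+m c b)

  record CopyableM (c : ℕ) (g f : Fin h → ℕ) (l : Fin h → Label) : Set where
    open M
    field
      g≢c    : ∀ q → g q ≢ c
      sh     : Sh M g f
      shape  : ∀ q → SameShape (lab c (g q)) (l q)
      l-cong : ∀ {q q′} → f q ≡ f q′ → l q ≡ l q′
      l-node : ∀ {q s t e} → kind c ≡ X s → kind (f q) ≡ X t → l q ≡ node e → length e ≡ s ⊔ t × Valid e
      l-tri  : ∀ {q q′ e e′ e″} → l q ≡ node e → l q′ ≡ node e′ → lab (f q) (f q′) ≡ node e″ →
               Compat e e′ × Compat e e″

  -- The challenge recurs at a step whose new node exceeds `c` and all entries of `g` and `f`. Below
  -- that node the stage coincides with `M`, so what is copyable in `M` is copyable there.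
  copy-M : ∀ {c} (g f : Vec ℕ h) (l : Vec Label h) → CopyableM c (lookup g) (lookup f) (lookup l) →
           ∃[ k ] (∀ q → lookup f q ≢ k) × Copied k c (lookup g) (lookup f) (lookup l) M
  copy-M {c} g f l V with challenge-recurs (inj₁ (c , g , f , l)) (c ⊔ (maximum g ⊔ maximum f))
  ... | T , K≤T , eq = k , (λ q → <⇒≢ (f< q)) ,
    New.sh-on (λ { zero → <-trans c< k< ; (suc q) → <-trans (g< q) k< })
        (λ { zero → k< ; (suc q) → <-trans (f< q) k< }) (proj₁ met) ,
    λ q → trans (sym (New.lab-on k< (<-trans (f< q) k<))) (proj₂ met q)
    where
    k = h + T
    module Old = Below (M≈stage T)
    module New = Below (below-sym (M≈stage (suc T)))
    open CopyableM V
    k< : k < h + suc T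
    k< = +-monoʳ-< h (n<1+n T)
    small : ∀ {a} → a ≤ c ⊔ (maximum g ⊔ maximum f) → a < k
    small l = s≤s (≤-trans l (≤-trans K≤T (m≤n+m T (suc m))))
    c< : c < k
    c< = small (m≤m⊔n c _)
    g< : ∀ q → lookup g q < k
    g< q = small (≤-trans (lookup≤maximum g q) (≤-trans (m≤m⊔n _ (maximum f)) (m≤n⊔m c _)))
    f< : ∀ q → lookup f q < k
    f< q = small (≤-trans (lookup≤maximum f q) (≤-trans (m≤n⊔m (maximum g) _) (m≤n⊔m c _)))
    possible : Copyable (stage T) k c (lookup g) (lookup f) (lookup l)
    possible = record
      { c≢k = <⇒≢ c< ; g≢k = λ q → <⇒≢ (g< q) ; f≢k = λ q → <⇒≢ (f< q) ; g≢c = g≢c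
      ; sh = Old.sh-on g< f< sh
      ; shape = λ q → shape-trans (shape-≡ (sym (Old.lab-on c< (g< q)))) (shape q)
      ; l-cong = l-cong
      ; l-node = λ {q} kc kf → l-node (trans (Old.kind-on c<) kc) (trans (Old.kind-on (f< q)) kf)
      ; l-tri = λ {q} {q′} p p′ r → l-tri p p′ (trans (Old.lab-on (f< q) (f< q′)) r)
      }
    met : Copied k c (lookup g) (lookup f) (lookup l) (stage (suc T))
    met = subst (λ χ → Met k χ (stage (suc T))) eq
        (step-met T (stages T) (subst (Possible (stage T) k) (sym eq) possible))

  seed-M : ∀ u {t} → M.Hub u → Fits t (M.br u) → ∃[ k ] Seeded k u t M
  seed-M u {t} H F with challenge-recurs (inj₂ (u , t)) (maximum u)
  ... | T , l , eq = k , trans (kind-on k<) (proj₁ met) , λ j → trans (adj-on k< (<-trans (u< j) k<))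
      (proj₂ met j)
    where
    k = h + T
    open Below (M≈stage (suc T))
    module Old = Below (M≈stage T)
    k< : k < h + suc T
    k< = +-monoʳ-< h (n<1+n T)
    u< : ∀ j → lookup u j < k
    u< j = s≤s (≤-trans (lookup≤maximum u j) (≤-trans l (m≤n+m T (suc m))))
    possible : Seedable (stage T) k u t
    possible = record { u≢k = λ j → <⇒≢ (u< j) ; hub = λ j → trans (sym (Old.kind-on (u< j))) (H j)
                      ; fits = subst (Fits t) (Old.br-on u u<) F }
    met : Seeded k u t (stage (suc T))
    met = subst (λ χ → Met k χ (stage (suc T))) eq
        (step-met T (stages T) (subst (Possible (stage T) k) (sym eq) possible))

  u₀ : Vec ℕ h
  u₀ = tabulate toℕ

  hub₀ : M.Hub u₀
  hub₀ j = trans (Below.kind-on (M≈stage 0) (u₀< j))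
      (cong W (trans (cong index (lookup∘tabulate toℕ j)) (index-toℕ j)))
    where
    u₀< : ∀ j → lookup u₀ j < h + 0
    u₀< j = subst (_< h + 0) (sym (lookup∘tabulate toℕ j)) (<-≤-trans (toℕ<n j) (m≤m+n h 0))

  br₀ : M.br u₀ ≡ nothing
  br₀ = Below.br-on (M≈stage 0) u₀ λ j → subst (_< h + 0) (sym (lookup∘tabulate toℕ j))
      (<-≤-trans (toℕ<n j) (m≤m+n h 0))

-- The game on tuples of the limit structure.

-- This is what `extend` asks of the family in which it answers; a bound on the copy numbers yields
-- a fresh one.
record Tame {I : Set} (p : I → Node) : Set where
  field
    allValid  : ∀ i → Valid (p i)
    copyBound : ℕ
    copies    : ∀ i → Copies< copyBound (p i)
open Tame

copies-≤ : ∀ {c d} e → c ≤ d → Copies< c e → Copies< d e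
copies-≤ e l = All.map (λ p → <-≤-trans p l)

copies-bound : ∀ e → ∃[ c ] Copies< c e
copies-bound [] = 0 , []
copies-bound (x ∷ e) with copies-bound e
... | c , p = suc (copy x) ⊔ c , m≤m⊔n (suc (copy x)) c ∷ copies-≤ e (m≤n⊔m (suc (copy x)) c) p

common-bound : ∀ {k} (P : Fin k → ℕ → Set) → (∀ i {c d} → c ≤ d → P i c → P i d) →
               (∀ i → ∃[ c ] P i c) → ∃[ c ] (∀ i → P i c)
common-bound {zero} P up f = 0 , λ ()
common-bound {suc k} P up f with f zero | common-bound (P ∘ suc) (up ∘ suc) (f ∘ suc)
... | a , p | b , q = a ⊔ b , λ { zero → up zero (m≤m⊔n a b) p ; (suc i) → up (suc i) (m≤n⊔m a b) (q i) }

tame-Fin : ∀ {k} (p : Fin k → Node) → (∀ i → Valid (p i)) → Tame p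
tame-Fin p v = record { allValid = v ; copyBound = proj₁ b ; copies = proj₂ b }
  where b = common-bound (λ i c → Copies< c (p i)) (λ i → copies-≤ (p i)) (λ i → copies-bound (p i))

tame-Fin² : ∀ {k} (p : Fin k × Fin k → Node) → (∀ i → Valid (p i)) → Tame p
tame-Fin² p v = record { allValid = v ; copyBound = proj₁ b ; copies = λ (i , j) → proj₂ b i j }
  where
  b = common-bound (λ i c → ∀ j → Copies< c (p (i , j))) (λ i l h j → copies-≤ (p (i , j)) l (h j))
        (λ i → common-bound (λ j c → Copies< c (p (i , j))) (λ j → copies-≤ (p (i , j)))
            (λ j → copies-bound (p (i , j))))

tame-⊎ : ∀ {I J : Set} {p : I → Node} {q : J → Node} → Tame p → Tame q → Tame [ p , q ]′
tame-⊎ {p = p} {q} s t = record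
  { allValid  = λ { (inj₁ i) → allValid s i ; (inj₂ j) → allValid t j }
  ; copyBound = copyBound s ⊔ copyBound t
  ; copies = λ { (inj₁ i) → copies-≤ (p i) (m≤m⊔n _ _) (copies s i) ; (inj₂ j) → copies-≤ (q j)
      (m≤n⊔m (copyBound s) _) (copies t j) }
  }

AllNoInf : {I : Set} → (I → Node) → Set
AllNoInf p = ∀ i → NoInf (p i)

noInf-⊎ : ∀ {I J : Set} {p : I → Node} {q : J → Node} → AllNoInf p → AllNoInf q → AllNoInf [ p , q ]′
noInf-⊎ vp vq (inj₁ i) = vp i
noInf-⊎ vp vq (inj₂ j) = vq j

module Similarity (em : ExcludedMiddle 0ℓ) (m : ℕ) where
  open Model em m
  open Copy em m
  open Limit em m
  open Extension em

  opaque
    extend-Fin : ∀ {I : Set} {p q : I → Node} {k r} d → p ~[ k , r + d ] q → Tame q →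
                 (a : Fin d → Node) → (∀ i → Valid (a i)) →
                 Σ[ b ∈ (Fin d → Node) ] (∀ i → Valid (b i)) × ([ p , a ]′ ~[ k , r ] [ q , b ]′) ×
                     (AllNoInf q → AllNoInf b)
    extend-Fin {k = k} {r} zero p~q _ a _ = (λ ()) , (λ ()) ,
      ~-reindex [ id , (λ ()) ]′ (λ { (inj₁ _) → refl }) (λ { (inj₁ _) → refl })
          (subst (λ r → _ ~[ k , r ] _) (+-identityʳ r) p~q) , λ _ ()
    extend-Fin {p = p} {q} {k} {r} (suc d) p~q tq a va
      with extend {δ = k , r + d} (inj₂ (refl , +-monoʳ-< r (n<1+n d))) p~q (allValid tq) (copies tq) (a zero)
          (va zero)
    ... | b₀ , v₀ , p~q′ , f₀
      with extend-Fin d p~q′ (tame-⊎ tq (tame-Fin {1} (const b₀) (const v₀) |>one)) (a ∘ suc) (va ∘ suc)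
      where
      _|>one : Tame {Fin 1} (const b₀) → Tame {⊤} (const b₀)
      t |>one = record { allValid = λ _ → allValid t zero ; copyBound = copyBound t ; copies = λ _ → copies t zero }
    ... | b , v , p~q″ , f = b₀ ◂ b , (λ { zero → v₀ ; (suc i) → v i }) ,
      ~-reindex place (λ { (inj₁ _) → refl ; (inj₂ zero) → refl ; (inj₂ (suc _)) → refl })
                      (λ { (inj₁ _) → refl ; (inj₂ zero) → refl ; (inj₂ (suc _)) → refl }) p~q″ ,
      λ g → λ { zero → f₀ g ; (suc i) → f (λ { (inj₁ i) → g i ; (inj₂ _) → f₀ g }) i }
      where
      place : ∀ {I : Set} → I ⊎ Fin (suc d) → (I ⊎ ⊤) ⊎ Fin d
      place (inj₁ i) = inj₁ (inj₁ i)
      place (inj₂ zero) = inj₁ (inj₂ tt)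
      place (inj₂ (suc i)) = inj₂ i

  -- All thresholds `(k , r)` lie below `(suc k , 0)`, so the number of further nodes and moves may
  -- be chosen after `k` has been fixed.
  extend-low : ∀ {I : Set} {p q : I → Node} {k} r d → p ~[ suc k , 0 ] q → Tame q → (a : Fin d → Node) →
      (∀ i → Valid (a i)) →
               Σ[ b ∈ (Fin d → Node) ] (∀ i → Valid (b i)) × ([ p , a ]′ ~[ k , r ] [ q , b ]′) ×
                   (AllNoInf q → AllNoInf b)
  extend-low {k = k} r d p~q = extend-Fin d (~-weaken (inj₂ (inj₁ (n<1+n k))) p~q)

  nodeOf : Label → Node
  nodeOf (node e) = e
  -- The root is similar only to itself, so labels that are not nodes can be treated uniformly with
  -- those that are.
  nodeOf _        = []

  Λ : ∀ {p} → (Fin p → ℕ) → Fin p × Fin p → Node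
  Λ s (i , j) = nodeOf (M.lab (s i) (s j))

  open Invariants M-invariants

  Λ-valid : ∀ {p} (s : Fin p → ℕ) i → Valid (Λ s i)
  Λ-valid s (i , j) with M.lab (s i) (s j) in eq
  ... | none = []
  ... | white _ = []
  ... | node e = proj₂ (lab-node (proj₂ (lab⇒X eq)) (proj₂ (lab⇒X (trans (lab-sym (s j) (s i)) eq))) eq)

  tame-Λ : ∀ {p} (s : Fin p → ℕ) → Tame (Λ s)
  tame-Λ s = tame-Fin² (Λ s) (Λ-valid s)

  -- The parameters and the nodes on the labels are matched as one family, so that coincidences and
  -- common initial parts between them are preserved too.
  record Sim {I : Set} (γ : Threshold) (F : I → Node) {p : ℕ} (s : Fin p → ℕ) (F′ : I → Node) (t : Fin p → ℕ) : Set where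
    constructor mkSim
    field
      shape : Sh M s t
      nodes : [ F , Λ s ]′ ~[ γ ] [ F′ , Λ t ]′

  module _ {I : Set} where
    Sim-sym : ∀ {γ p} {F F′ : I → Node} {s t : Fin p → ℕ} → Sim γ F s F′ t → Sim γ F′ t F s
    Sim-sym (mkSim σ e) = mkSim (Sh-sym σ) (~-sym e)

    Sim-trans : ∀ {γ p} {F F′ F″ : I → Node} {s t u : Fin p → ℕ} → Sim γ F s F′ t → Sim γ F′ t F″ u →
        Sim γ F s F″ u
    Sim-trans (mkSim σ e) (mkSim τ f) = mkSim (Sh-trans σ τ) (~-trans e f)

    Sim-weaken : ∀ {γ δ p} {F F′ : I → Node} {s t : Fin p → ℕ} → δ ≤ᵗ γ → Sim γ F s F′ t → Sim δ F s F′ t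
    Sim-weaken l (mkSim σ e) = mkSim σ (~-weaken l e)

    Sim-reindex : ∀ {γ p r} {F F′ : I → Node} {s t : Fin p → ℕ} {s′ t′ : Fin r → ℕ} (ρ : Fin r → Fin p) →
                  (∀ q → s′ q ≡ s (ρ q)) → (∀ q → t′ q ≡ t (ρ q)) → Sim γ F s F′ t → Sim γ F s′ F′ t′
    Sim-reindex ρ s≡ t≡ (mkSim σ e) = mkSim (Sh-reindex ρ s≡ t≡ σ) (~-reindex move
      (λ { (inj₁ _) → refl ; (inj₂ (i , j)) → cong₂ (λ a b → nodeOf (M.lab a b)) (s≡ i) (s≡ j) })
      (λ { (inj₁ _) → refl ; (inj₂ (i , j)) → cong₂ (λ a b → nodeOf (M.lab a b)) (t≡ i) (t≡ j) }) e)
      where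
      move : I ⊎ _ → I ⊎ _
      move (inj₁ i) = inj₁ i
      move (inj₂ (i , j)) = inj₂ (ρ i , ρ j)

    Sim-restrict : ∀ {J : Set} {γ p} {F F′ : I → Node} {G G′ : J → Node} {s t : Fin p → ℕ} (f : J → I) →
                   (∀ j → G j ≡ F (f j)) → (∀ j → G′ j ≡ F′ (f j)) → Sim γ F s F′ t → Sim γ G s G′ t
    Sim-restrict f G≡ G′≡ (mkSim σ e) = mkSim σ (~-reindex [ inj₁ ∘ f , inj₂ ]′
      (λ { (inj₁ j) → G≡ j ; (inj₂ _) → refl }) (λ { (inj₁ j) → G′≡ j ; (inj₂ _) → refl }) e)

  Compat-~ : ∀ {I : Set} {γ} {p q : I → Node} → p ~[ γ ] q → ∀ i j → Compat (p i) (p j) → Compat (q i) (q j)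
  Compat-~ {p = p} {q} e i j c = subst (λ ℓ → Agree ℓ (q i) (q j)) (cong₂ _⊓_ (~-length e i) (~-length e j))
      (agree→ e i j _ c)

  length-zero : ∀ {e : Node} → length e ≡ 0 → e ≡ []
  length-zero {[]} _ = refl

  relabel : Label → Node → Label
  relabel (node _) e = node e
  relabel l        _ = l

  relabel-shape : ∀ l e → SameShape l (relabel l e)
  relabel-shape none      e = none
  relabel-shape (white _) e = white
  relabel-shape (node _)  e = node

  nodeOf-relabel : ∀ l e → length (nodeOf l) ≡ length e → nodeOf (relabel l e) ≡ e
  nodeOf-relabel none      e p = sym (length-zero (sym p))
  nodeOf-relabel (white _) e p = sym (length-zero (sym p))
  nodeOf-relabel (node _)  e p = refl

  relabel-node : ∀ {l e e′} → relabel l e ≡ node e′ → l ≡ node (nodeOf l) × e ≡ e′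
  relabel-node {node _} refl = refl , refl

  shape-node : ∀ {l l′ e} → SameShape l l′ → l′ ≡ node e → l ≡ node (nodeOf l)
  shape-node node _ = refl

  nodeOf-node : ∀ {l e} → l ≡ node e → nodeOf l ≡ e
  nodeOf-node refl = refl

  -- The nodes `b` are the answers to those on the labels at `c`. Similarity preserves their
  -- equalities, levels and compatibilities, which is all that `copy-M` asks of prescribed labels.
  module MoveNew {I : Set} {F F′ : I → Node} {δ : Threshold} {g f : Vec ℕ h}
      (σ : Sh M (lookup g) (lookup f)) {c : ℕ}
                 (g∌c : ∀ q → lookup g q ≢ c) (b : Fin n → Node) (vb : ∀ i → Valid (b i))
                 (e : [ [ F , Λ (lookup g) ]′ , (λ i → nodeOf (M.lab c ((c ◂ lookup g) i))) ]′ ~[ δ ] [ [ F′ , Λ (lookup f) ]′ , b ]′) where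
    open Sh σ

    a : Fin n → Node
    a i = nodeOf (M.lab c ((c ◂ lookup g) i))

    len : ∀ i → length (a i) ≡ length (b i)
    len i = ~-length e (inj₂ i)

    l : Fin h → Label
    l q = relabel (M.lab c (lookup g q)) (b (suc q))

    l≡ : ∀ q → lookup (tabulate l) q ≡ l q
    l≡ = lookup∘tabulate l

    source : ∀ q {e} → lookup (tabulate l) q ≡ node e → M.lab c (lookup g q) ≡ node (a (suc q)) × b (suc q) ≡ e
    source q p = relabel-node (trans (sym (l≡ q)) p)

    pair : ∀ q q′ {e} → M.lab (lookup f q) (lookup f q′) ≡ node e → M.lab (lookup g q) (lookup g q′) ≡ node
        (Λ (lookup g) (q , q′))
    pair q q′ p = shape-node (lab≡ q q′) p

    cong-l : ∀ {q q′} → lookup f q ≡ lookup f q′ → lookup (tabulate l) q ≡ lookup (tabulate l) q′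
    cong-l {q} {q′} p = trans (l≡ q) (trans (cong₂ relabel (cong (M.lab c) (same← q q′ p))
      (~-≡ e {inj₂ (suc q)} {inj₂ (suc q′)} (cong (nodeOf ∘ M.lab c) (same← q q′ p)))) (sym (l≡ q′)))

    node-l : ∀ {q s t e} → M.kind c ≡ X s → M.kind (lookup f q) ≡ X t → lookup (tabulate l) q ≡ node e →
        length e ≡ s ⊔ t × Valid e
    node-l {q} {s} {t} kc kf p = subst (λ e → length e ≡ s ⊔ t × Valid e) (proj₂ (source q p))
      (trans (sym (len (suc q))) (proj₁ (lab-node kc (trans (kind≡ q) kf) (proj₁ (source q p)))) , vb (suc q))

    tri-l : ∀ {q q′ e e′ e″} → lookup (tabulate l) q ≡ node e → lookup (tabulate l) q′ ≡ node e′ →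
            M.lab (lookup f q) (lookup f q′) ≡ node e″ → Compat e e′ × Compat e e″
    tri-l {q} {q′} p p′ p″ =
      subst₂ Compat (proj₂ (source q p)) (proj₂ (source q′ p′)) (Compat-~ e (inj₂ (suc q)) (inj₂ (suc q′))
        (lab-tri (proj₁ (source q p)) (proj₁ (source q′ p′)) (pair q q′ p″))) ,
      subst₂ Compat (proj₂ (source q p)) (nodeOf-node p″) (Compat-~ e (inj₂ (suc q)) (inj₁ (inj₂ (q , q′)))
        (lab-tri (trans (lab-sym _ c) (proj₁ (source q p))) (pair q q′ p″) (proj₁ (source q′ p′))))

    copyable : CopyableM c (lookup g) (lookup f) (lookup (tabulate l))
    copyable = record
      { g≢c = g∌c ; sh = σ ; shape = λ q → subst (SameShape (M.lab c (lookup g q))) (sym (l≡ q))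
          (relabel-shape _ _)
      ; l-cong = λ {q} {q′} → cong-l {q} {q′} ; l-node = λ {q} → node-l {q} ; l-tri = λ {q} {q′} →
          tri-l {q} {q′} }

    module _ (c′ : ℕ) (copied : Copied c′ c (lookup g) (lookup f) (lookup (tabulate l)) M) where
      arrange : I ⊎ (Fin n × Fin n) → (I ⊎ (Fin h × Fin h)) ⊎ Fin n
      arrange (inj₁ i) = inj₁ (inj₁ i)
      arrange (inj₂ (zero , j)) = inj₂ j
      arrange (inj₂ (suc i , zero)) = inj₂ (suc i)
      arrange (inj₂ (suc i , suc j)) = inj₁ (inj₂ (i , j))

      b≡ : ∀ i → Λ (c′ ◂ lookup f) (zero , i) ≡ b i
      b≡ zero = trans (cong nodeOf (lab-self c′))
          (sym (length-zero (trans (sym (len zero)) (cong (length ∘ nodeOf) (lab-self c)))))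
      b≡ (suc q) = trans (cong nodeOf (trans (proj₂ copied q) (l≡ q)))
          (nodeOf-relabel (M.lab c (lookup g q)) (b (suc q)) (len (suc q)))

      b≡ʳ : ∀ q → Λ (c′ ◂ lookup f) (suc q , zero) ≡ b (suc q)
      b≡ʳ q = trans (cong nodeOf (lab-sym (lookup f q) c′)) (b≡ (suc q))

      sim : Sim δ F (c ◂ lookup g) F′ (c′ ◂ lookup f)
      sim = mkSim (proj₁ copied) (~-reindex arrange
        (λ { (inj₁ _) → refl ; (inj₂ (zero , _)) → refl ; (inj₂ (suc q , zero)) → cong nodeOf
            (lab-sym (lookup g q) c)
           ; (inj₂ (suc _ , suc _)) → refl })
        (λ { (inj₁ _) → refl ; (inj₂ (zero , i)) → b≡ i ; (inj₂ (suc q , zero)) → b≡ʳ q ;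
            (inj₂ (suc _ , suc _)) → refl }) e)

      noInf : AllNoInf b → AllNoInf (Λ (lookup f)) → AllNoInf (Λ (c′ ◂ lookup f))
      noInf vb′ vf (zero , i) = subst NoInf (sym (b≡ i)) (vb′ i)
      noInf vb′ vf (suc q , zero) = subst NoInf (sym (b≡ʳ q)) (vb′ (suc q))
      noInf vb′ vf (suc q , suc q′) = vf (q , q′)

  Moved : {I : Set} (γ : Threshold) (F F′ : I → Node) (g f : Vec ℕ h) (c c′ : ℕ) → Set
  Moved γ F F′ g f c c′ = Sim γ F (c ◂ lookup g) F′ (c′ ◂ lookup f) ×
    (AllNoInf F′ → AllNoInf (Λ (lookup f)) → AllNoInf (Λ (c′ ◂ lookup f)))

  move-old : ∀ {I : Set} {F F′ : I → Node} {γ} {g f : Vec ℕ h} → Sim γ F (lookup g) F′ (lookup f) → ∀ q →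
      Moved γ F F′ g f (lookup g q) (lookup f q)
  move-old S q = Sim-reindex (q ◂ id) (λ { zero → refl ; (suc _) → refl })
      (λ { zero → refl ; (suc _) → refl }) S ,
    λ _ v → λ { (zero , zero) → v (q , q) ; (zero , suc j) → v (q , j) ; (suc i , zero) → v (i , q) ;
        (suc i , suc j) → v (i , j) }

  -- The drop by `n` pays for matching the nodes on the labels from `c` to the entries of
  -- `c ◂ lookup g`.
  move-new : ∀ {I : Set} {F F′ : I → Node} {k r} {g f : Vec ℕ h} → Tame F′ → Sim (k , r + n) F (lookup g) F′
      (lookup f) → ∀ c →
             (∀ q → lookup g q ≢ c) → ∃[ c′ ] Moved (k , r) F F′ g f c c′
  move-new {F = F} {F′} {k} {r} {g} {f} tF′ (mkSim σ e) c g∌c =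
    let b , vb , e′ , fb = extend-Fin {r = r} n e (tame-⊎ tF′ (tame-Λ (lookup f))) (λ i → nodeOf (M.lab c ((c ◂ lookup g) i)))
                             (λ i → Λ-valid (c ◂ (c ◂ lookup g)) (zero , suc i))
        module N = MoveNew {g = g} {f} σ g∌c b vb e′
        c′ , _ , copied = copy-M g f (tabulate N.l) N.copyable
    in c′ , N.sim c′ copied , λ vF vf → N.noInf c′ copied (fb (noInf-⊎ vF vf)) vf

  move : ∀ {I : Set} {F F′ : I → Node} {k r} {g f : Vec ℕ h} → Tame F′ → Sim (k , r + n) F (lookup g) F′
      (lookup f) → ∀ c →
         ∃[ c′ ] Moved (k , r) F F′ g f c c′
  move {F = F} {F′} {k} {r} {g} {f} tF′ S c with em {∃[ q ] lookup g q ≡ c}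
  ... | yes (q , e) = lookup f q , subst (λ c → Moved (k , r) F F′ g f c (lookup f q)) e
                        (move-old {g = g} {f} (Sim-weaken (inj₂ (inj₂ (refl , m<m+n r (s≤s z≤n)))) S) q)
  ... | no g∌c = move-new {r = r} {g} {f} tF′ S c (λ q e → g∌c (q , e))

  noInf-reindex : ∀ {p r} {t : Fin p → ℕ} {t′ : Fin r → ℕ} (ρ : Fin r → Fin p) → (∀ q → t′ q ≡ t (ρ q)) →
                  AllNoInf (Λ t) → AllNoInf (Λ t′)
  noInf-reindex ρ t≡ v (i , j) = subst NoInf (sym (cong₂ (λ a b → nodeOf (M.lab a b)) (t≡ i) (t≡ j)))
      (v (ρ i , ρ j))

  place : Fin n → Fin n → Fin n
  place i j with i Fin.≟ j
  ... | yes _ = zero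
  ... | no i≢j = suc (punchOut i≢j)

  omit : Fin n → Vec ℕ n → Vec ℕ h
  omit i s = tabulate (lookup s ∘ punchIn i)

  place-omit : ∀ i c (s s′ : Vec ℕ n) → lookup s′ i ≡ c → (∀ j → j ≢ i → lookup s′ j ≡ lookup s j) →
               ∀ j → lookup s′ j ≡ (c ◂ lookup (omit i s)) (place i j)
  place-omit i c s s′ p off j with i Fin.≟ j
  ... | yes refl = p
  ... | no i≢j = trans (off j (i≢j ∘ sym))
      (sym (trans (lookup∘tabulate (lookup s ∘ punchIn i) (punchOut i≢j))
          (cong (lookup s) (punchIn-punchOut i≢j))))

  move-at : ∀ {I : Set} {F F′ : I → Node} {k r} {s t : Vec ℕ n} → Tame F′ → Sim (k , r + n) F (lookup s) F′
      (lookup t) →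
            ∀ i s′ → (∀ j → j ≢ i → lookup s′ j ≡ lookup s j) →
            Σ[ t′ ∈ Vec ℕ n ] (∀ j → j ≢ i → lookup t′ j ≡ lookup t j) × Sim (k , r) F (lookup s′) F′
                (lookup t′) ×
              (AllNoInf F′ → AllNoInf (Λ (lookup t)) → AllNoInf (Λ (lookup t′)))
  move-at {F = F} {F′} {k} {r} {s} {t} tF′ S i s′ off =
    let c′ , S′ , v = move {r = r} {omit i s} {omit i t} tF′
                        (Sim-reindex (punchIn i) (lookup∘tabulate _) (lookup∘tabulate _) S) (lookup s′ i)
        t′ = t [ i ]≔ c′
        off′ = λ j j≢i → lookup∘update′ j≢i t c′
        t′≡ = place-omit i c′ t t′ (lookup∘update i t c′) off′
    in t′ , off′ , Sim-reindex (place i) (place-omit i _ s s′ refl off) t′≡ S′ ,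
       λ vF vt → noInf-reindex (place i) t′≡ (v vF (noInf-reindex (punchIn i) (lookup∘tabulate _) vt))

  constant : Vec ℕ n
  constant = Vec.replicate n 0

  Λ-constant : ∀ i → Λ (lookup constant) i ≡ []
  Λ-constant (i , j) = cong nodeOf
      (trans (cong₂ M.lab (lookup-replicate i 0) (lookup-replicate j 0)) (lab-self 0))

  Sim-constant : ∀ {I : Set} {F F′ : I → Node} {k r} → Tame F′ → F ~[ k , r + 1 ] F′ → Sim (k , r) F
      (lookup constant) F′ (lookup constant)
  Sim-constant {F = F} {F′} {k} {r} tF′ e with extend-Fin {r = r} 1 e tF′ (const []) (const [])
  ... | b , _ , e′ , _ = mkSim Sh-refl (~-reindex [ inj₁ , const (inj₂ zero) ]′
      (λ { (inj₁ _) → refl ; (inj₂ i) → Λ-constant i })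
      (λ { (inj₁ _) → refl ; (inj₂ i) → trans (Λ-constant i)
          (sym (length-zero (sym (~-length e′ (inj₂ zero))))) }) e′)

  -- A move matches one entry when the other n - 1 are matched already. An arbitrary tuple is
  -- therefore reached from a constant one, whose labels are all `none`, by changing one coordinate
  -- after another.
  patch : Vec ℕ n → List (Fin n) → Vec ℕ n
  patch s []      = constant
  patch s (i ∷ L) = patch s L [ i ]≔ lookup s i

  patch-∈ : ∀ s L {j} → j ∈ L → lookup (patch s L) j ≡ lookup s j
  patch-∈ s (i ∷ L) {j} j∈ with j Fin.≟ i
  ... | yes refl = lookup∘update i (patch s L) _
  patch-∈ s (i ∷ L) {j} (here p) | no j≢i = contradiction p j≢i
  patch-∈ s (i ∷ L) {j} (there j∈) | no j≢i = trans (lookup∘update′ j≢i (patch s L) _) (patch-∈ s L j∈)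

  module _ {I : Set} {F F′ : I → Node} (tF′ : Tame F′) where
    Realized : Threshold → Vec ℕ n → Set
    Realized γ s = ∃[ t ] Sim γ F (lookup s) F′ (lookup t) × (AllNoInf F′ → AllNoInf (Λ (lookup t)))

    realized-move : ∀ {k r s} i s′ → (∀ j → j ≢ i → lookup s′ j ≡ lookup s j) → Realized (k , r + n) s →
        Realized (k , r) s′
    realized-move {k} {r} {s} i s′ off (t , S , v) =
      let t′ , _ , S′ , v′ = move-at {r = r} {s} {t} tF′ S i s′ off in t′ , S′ , λ f → v′ f (v f)

    realized-constant : ∀ {k r} → F ~[ k , r + 1 ] F′ → Realized (k , r) constant
    realized-constant {r = r} e = constant , Sim-constant {r = r} tF′ e , λ _ i → subst NoInf
        (sym (Λ-constant i)) []

    realized-patch : ∀ {k} r s L → F ~[ k , r + length L * n + 1 ] F′ → Realized (k , r) (patch s L)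
    realized-patch {k} r s [] e = realized-constant
        (subst (λ x → F ~[ k , x ] F′) (cong (_+ 1) (+-identityʳ r)) e)
    realized-patch {k} r s (i ∷ L) e = realized-move {r = r} {patch s L} i (patch s (i ∷ L))
        (λ j j≢i → lookup∘update′ j≢i (patch s L) _)
      (realized-patch (r + n) s L (subst (λ x → F ~[ k , x ] F′)
          (cong (_+ 1) (sym (+-assoc r n (length L * n)))) e))

    -- Besides relating tuples over different parameters, this is how ∞ is eliminated: over
    -- parameters of finite rank every tuple has a counterpart none of whose labels involves ∞.
    realize : ∀ {k} r → F ~[ suc k , 0 ] F′ → ∀ s → Realized (k , r) s
    realize {k} r e s =
      let t , S , v = realized-patch r s (allFin n) (~-weaken (inj₂ (inj₁ (n<1+n k))) e)
      in t , Sim-reindex id (λ q → sym (patch-∈ s (allFin n) (∈-allFin q))) (λ _ → refl) S , v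

-- Boolean-valued relations and full set algebras.

open import Data.Bool.Base using (_∧_; _∨_)

bool-ext : ∀ {a b} → (a ≡ true → b ≡ true) → (b ≡ true → a ≡ true) → a ≡ b
bool-ext {false} {false} _ _ = refl
bool-ext {false} {true}  _ g = g refl
bool-ext {true}  {false} f _ = sym (f refl)
bool-ext {true}  {true}  _ _ = refl

∧-true : ∀ {a b} → a ≡ true → b ≡ true → a ∧ b ≡ true
∧-true refl refl = refl

∧-trueˡ : ∀ {a b} → a ∧ b ≡ true → a ≡ true
∧-trueˡ {true} _ = refl

∧-trueʳ : ∀ {a b} → a ∧ b ≡ true → b ≡ true
∧-trueʳ {true} p = p

not-true : ∀ {a} → not a ≡ true → a ≢ true
not-true {true} ()

≢true : ∀ {a} → a ≢ true → not a ≡ true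
≢true {true} p = contradiction refl p
≢true {false} _ = refl

module Truth (em : ExcludedMiddle 0ℓ) where
  opaque
    ⌊_⌋ : Set → Bool
    ⌊ P ⌋ = does (em {P})

    true⁺ : ∀ {P} → P → ⌊ P ⌋ ≡ true
    true⁺ {P} p with em {P}
    ... | yes _ = refl
    ... | no ¬p = contradiction p ¬p

    true⁻ : ∀ {P} → ⌊ P ⌋ ≡ true → P
    true⁻ {P} e with em {P}
    ... | yes p = p

  true-ext : ∀ {P Q} → (P → Q) → (Q → P) → ⌊ P ⌋ ≡ ⌊ Q ⌋
  true-ext f g = bool-ext (true⁺ ∘ f ∘ true⁻) (true⁺ ∘ g ∘ true⁻)

lookup-ext : ∀ {A : Set} {n} {u v : Vec A n} → (∀ j → lookup u j ≡ lookup v j) → u ≡ v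
lookup-ext {u = u} {v} p = trans (sym (tabulate∘lookup u)) (trans (tabulate-cong p) (tabulate∘lookup v))

module _ {A : Set} {n : ℕ} where
  Off : Fin n → Vec A n → Vec A n → Set
  Off k t s = ∀ j → j ≢ k → lookup t j ≡ lookup s j

  off-refl : ∀ {k} s → Off k s s
  off-refl _ _ _ = refl

  off-sym : ∀ {k} s t → Off k t s → Off k s t
  off-sym s t o j j≢k = sym (o j j≢k)

  off-trans : ∀ {k} s t u → Off k u t → Off k t s → Off k u s
  off-trans s t u o o′ j j≢k = trans (o j j≢k) (o′ j j≢k)

  off-update : ∀ k s x → Off k (s [ k ]≔ x) s
  off-update k s x j j≢k = lookup∘update′ j≢k s x

  off-swap : ∀ {i j} s t u → Off i t s → Off j u t → Off i u (s [ j ]≔ lookup u j)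
  off-swap {i} {j} s t u o o′ l l≢i with l Fin.≟ j
  ... | yes refl = sym (lookup∘update j s _)
  ... | no l≢j = trans (o′ l l≢j) (trans (o l l≢i) (sym (lookup∘update′ l≢j s _)))

-- The full set algebra on a disjoint union of squares, with Boolean-valued sets so that it is small.
module SetAlgebra (em : ExcludedMiddle 0ℓ) (n : ℕ) {I : Set} (Base : I → Set) where
  open Truth em

  Cyl : Fin n → (Squares n Base → Bool) → Squares n Base → Set
  Cyl k X (i , s) = ∃[ t ] Off k t s × X (i , t) ≡ true

  raw : RawCylindricAlgebra n 0ℓ 0ℓ
  raw = record
    { Carrier = Squares n Base → Bool
    ; _≈_ = λ X Y → ∀ v → X v ≡ Y v
    ; _∨_ = λ X Y v → X v ∨ Y v
    ; _∧_ = λ X Y v → X v ∧ Y v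
    ; ¬_  = λ X v → not (X v)
    ; ⊤   = λ _ → true
    ; ⊥   = λ _ → false
    ; c   = λ k X v → ⌊ Cyl k X v ⌋
    ; d   = λ j k (_ , s) → ⌊ lookup s j ≡ lookup s k ⌋
    }

  open RawCylindricAlgebra raw using (c; d)

  c-comm⇒ : ∀ i j (X : Squares n Base → Bool) v → Cyl i (c j X) v → Cyl j (c i X) v
  c-comm⇒ i j X (a , s) (t , o , p) with true⁻ p
  ... | u , o′ , q = s [ j ]≔ lookup u j , off-update j s _ , true⁺ (u , off-swap s t u o o′ , q)

  d-trans⇒ : ∀ i j k → k ≢ i → k ≢ j → ∀ v → d i j v ≡ true → Cyl k (λ v → d i k v ∧ d k j v) v
  d-trans⇒ i j k k≢i k≢j (a , s) p = s [ k ]≔ lookup s i , off-update k s _ ,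
    ∧-true (true⁺ (trans (lookup∘update′ (k≢i ∘ sym) s _) (sym (lookup∘update k s _))))
           (true⁺ (trans (lookup∘update k s _) (trans (true⁻ p) (sym (lookup∘update′ (k≢j ∘ sym) s _)))))

  d-trans⇐ : ∀ i j k → k ≢ i → k ≢ j → ∀ v → Cyl k (λ v → d i k v ∧ d k j v) v → d i j v ≡ true
  d-trans⇐ i j k k≢i k≢j (a , s) (t , o , p) = true⁺
    (trans (sym (o i (k≢i ∘ sym)))
        (trans (true⁻ (∧-trueˡ p)) (trans (true⁻ (∧-trueʳ {d i k (a , t)} p)) (o j (k≢j ∘ sym)))))

  c-d⇒ : ∀ i j (X : Squares n Base → Bool) → i ≢ j → ∀ v → Cyl i (λ v → d i j v ∧ X v) v → ¬ Cyl i
      (λ v → d i j v ∧ not (X v)) v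
  c-d⇒ i j X i≢j (a , s) (t , o , p) (t′ , o′ , p′) = not-true (∧-trueʳ {d i j (a , t′)} p′)
    (subst (λ t → X (a , t) ≡ true) (lookup-ext same) (∧-trueʳ {d i j (a , t)} p))
    where
    at-i : ∀ t → Off i t s → d i j (a , t) ≡ true → lookup t i ≡ lookup s j
    at-i t o p = trans (true⁻ p) (o j (i≢j ∘ sym))
    same : ∀ l → lookup t l ≡ lookup t′ l
    same l with l Fin.≟ i
    ... | yes refl = trans (at-i t o (∧-trueˡ p)) (sym (at-i t′ o′ (∧-trueˡ p′)))
    ... | no l≢i = trans (o l l≢i) (sym (o′ l l≢i))

  algebra : CylindricAlgebra n
  algebra = record
    { raw = raw
    ; isCylindricAlgebra = record
      { isBooleanAlgebra = record
        { isDistributiveLattice = record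
          { isLattice = record
            { isEquivalence = record { refl = λ _ → refl ; sym = λ p v → sym (p v) ; trans = λ p q v → trans
                (p v) (q v) }
            ; ∨-comm     = λ X Y v → Bool.∨-comm (X v) (Y v)
            ; ∨-assoc    = λ X Y Z v → Bool.∨-assoc (X v) (Y v) (Z v)
            ; ∨-cong     = λ p q v → cong₂ _∨_ (p v) (q v)
            ; ∧-comm     = λ X Y v → Bool.∧-comm (X v) (Y v)
            ; ∧-assoc    = λ X Y Z v → Bool.∧-assoc (X v) (Y v) (Z v)
            ; ∧-cong     = λ p q v → cong₂ _∧_ (p v) (q v)
            ; absorptive = (λ X Y v → Bool.∨-abs-∧ (X v) (Y v)) , (λ X Y v → Bool.∧-abs-∨ (X v) (Y v))
            }
          ; ∨-distrib-∧ = (λ X Y Z v → Bool.∨-distribˡ-∧ (X v) (Y v) (Z v)) ,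
              (λ X Y Z v → Bool.∨-distribʳ-∧ (X v) (Y v) (Z v))
          ; ∧-distrib-∨ = (λ X Y Z v → Bool.∧-distribˡ-∨ (X v) (Y v) (Z v)) ,
              (λ X Y Z v → Bool.∧-distribʳ-∨ (X v) (Y v) (Z v))
          }
        ; ∨-complement = (λ X v → Bool.∨-inverseˡ (X v)) , (λ X v → Bool.∨-inverseʳ (X v))
        ; ∧-complement = (λ X v → Bool.∧-inverseˡ (X v)) , (λ X v → Bool.∧-inverseʳ (X v))
        ; ¬-cong       = λ p v → cong not (p v)
        }
      ; c-cong       = λ k p v → true-ext (λ (t , o , q) → t , o , trans (sym (p _)) q)
          (λ (t , o , q) → t , o , trans (p _) q)
      ; c-⊥          = λ k v → bool-ext (λ p → proj₂ (proj₂ (true⁻ p))) λ ()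
      ; c-increasing = λ k X v → bool-ext (λ p → ∧-true p (true⁺ (proj₂ v , off-refl (proj₂ v) , p))) ∧-trueˡ
      ; c-∧-c        = λ k X Y v → bool-ext
          (λ p → let t , o , q = true⁻ p ; u , o′ , r = true⁻ (∧-trueʳ {X _} q) in
                 ∧-true (true⁺ (t , o , ∧-trueˡ q)) (true⁺ (u , off-trans (proj₂ v) t u o′ o , r)))
          (λ p → let t , o , q = true⁻ (∧-trueˡ p) ; u , o′ , r = true⁻ (∧-trueʳ {⌊ Cyl k X v ⌋} p) in
                 true⁺ (t , o , ∧-true q (true⁺ (u , off-trans t (proj₂ v) u o′ (off-sym (proj₂ v) t o) , r))))
      ; c-comm       = λ i j X v → true-ext (c-comm⇒ i j X v) (c-comm⇒ j i X v)
      ; d-refl       = λ i v → true⁺ refl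
      ; d-trans      = λ i j k k≢i k≢j v → bool-ext (λ p → true⁺ (d-trans⇒ i j k k≢i k≢j v p))
          (λ p → d-trans⇐ i j k k≢i k≢j v (true⁻ p))
      ; c-d-∧        = λ i j X i≢j v → bool-ext
          (λ p → contradiction (true⁻ (∧-trueʳ {⌊ Cyl i (λ v → d i j v ∧ X v) v ⌋} p))
              (c-d⇒ i j X i≢j v (true⁻ (∧-trueˡ p)))) λ ()
      }
    }

≤⇒≤ᵗ : ∀ {k r r′} → r ≤ r′ → (k , r) ≤ᵗ (k , r′)
≤⇒≤ᵗ {r = r} {r′} p with m≤n⇒m<n∨m≡n p
... | inj₁ q    = inj₂ (inj₂ (refl , q))
... | inj₂ refl = inj₁ refl

-- The algebras 𝔄 and 𝔅, the representation of 𝔄, and elementary equivalence.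

module Algebras (em : ExcludedMiddle 0ℓ) (m : ℕ) where
  open Model em m
  open Copy em m
  open Limit em m
  open Similarity em m
  open Truth em
  open SetAlgebra em n {⊤} (λ _ → ℕ) public using () renaming (algebra to 𝔓)
  open SetAlgebra em n {⊤} (λ _ → ℕ) using (Cyl)

  Relation : Set
  Relation = Squares n {⊤} (λ _ → ℕ) → Bool

  -- Only thresholds below ω² measure the depth of a relation; the higher ones are reserved for
  -- quantifiers over relations.
  Matched : {I : Set} → (I → Node) → (I → Node) → ℕ → Relation → Relation → Set
  Matched F F′ r b b′ = ∀ s t → Sim (0 , r) F (lookup s) F′ (lookup t) → b (tt , s) ≡ b′ (tt , t)

  module _ {I : Set} where
    matched-sym : ∀ {F F′ : I → Node} {r b b′} → Matched F F′ r b b′ → Matched F′ F r b′ b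
    matched-sym μ s t S = sym (μ t s (Sim-sym S))

    matched-≤ : ∀ {F F′ : I → Node} {r r′ b b′} → r ≤ r′ → Matched F F′ r b b′ → Matched F F′ r′ b b′
    matched-≤ r≤ μ s t S = μ s t (Sim-weaken (≤⇒≤ᵗ r≤) S)

    matched-restrict : ∀ {J : Set} {F F′ : I → Node} {G G′ : J → Node} {r b b′} (f : J → I) →
                       (∀ j → G j ≡ F (f j)) → (∀ j → G′ j ≡ F′ (f j)) → Matched G G′ r b b′ →
                           Matched F F′ r b b′
    matched-restrict f G≡ G′≡ μ s t S = μ s t (Sim-restrict f G≡ G′≡ S)

    cyl-matched : ∀ {F F′ : I → Node} {r b b′} → Tame F′ → Matched F F′ r b b′ → ∀ i s t →
                  Sim (0 , r + n) F (lookup s) F′ (lookup t) → Cyl i b (tt , s) → Cyl i b′ (tt , t)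
    cyl-matched {r = r} tF′ μ i s t S (s′ , o , p) =
      let t′ , o′ , S′ , _ = move-at {r = r} {s} {t} tF′ S i s′ o in t′ , o′ , trans (sym (μ s′ t′ S′)) p

    -- A cylindrification is one move of the game, hence the increase by `n`.
    matched-c : ∀ {F F′ : I → Node} {r b b′} → Tame F → Tame F′ → Matched F F′ r b b′ → ∀ i →
                Matched F F′ (r + n) (λ v → ⌊ Cyl i b v ⌋) (λ v → ⌊ Cyl i b′ v ⌋)
    matched-c {r = r} {b} {b′} tF tF′ μ i s t S = true-ext (cyl-matched {r = r} {b} {b′} tF′ μ i s t S)
      (cyl-matched {r = r} {b′} {b} tF (matched-sym {b = b} {b′} μ) i t s (Sim-sym S))

    matched-d : ∀ {F F′ : I → Node} {r} i j → Matched F F′ r (CylindricAlgebra.d 𝔓 i j)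
        (CylindricAlgebra.d 𝔓 i j)
    matched-d i j s t (mkSim σ _) = true-ext (Sh.same→ σ i j) (Sh.same← σ i j)

  record Support (Good : Node → Set) (b : Relation) : Set where
    field
      size    : ℕ
      nodes   : Fin size → Node
      valid   : ∀ i → Valid (nodes i)
      good    : ∀ i → Good (nodes i)
      depth   : ℕ
      matched : Matched nodes nodes depth b b

    tame : Tame nodes
    tame = tame-Fin nodes valid

  open Support

  support-map : ∀ {P Q : Node → Set} {b} → (∀ {e} → P e → Q e) → Support P b → Support Q b
  support-map f S = record { Support S ; good = λ i → f (good S i) }

  module _ {Good : Node → Set} where
    support-∪ : ∀ {b b′} (f : Bool → Bool → Bool) → Support Good b → Support Good b′ → Support Good
        (λ v → f (b v) (b′ v))
    support-∪ {b} {b′} f S T = record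
      { size = k + l ; nodes = both ; valid = both-all Valid (valid S) (valid T) ; good = both-all Good
          (good S) (good T)
      ; depth = depth S ⊔ depth T
      ; matched = λ s t e → cong₂ f
          (matched S s t (Sim-weaken (≤⇒≤ᵗ (m≤m⊔n _ _)) (Sim-restrict (_↑ˡ l) left left e)))
          (matched T s t (Sim-weaken (≤⇒≤ᵗ (m≤n⊔m (depth S) _)) (Sim-restrict (k ↑ʳ_) right right e))) }
      where
      k = size S
      l = size T
      both : Fin (k + l) → Node
      both i = [ nodes S , nodes T ]′ (splitAt k i)
      left : ∀ i → nodes S i ≡ both (i ↑ˡ l)
      left i = cong [ nodes S , nodes T ]′ (sym (splitAt-↑ˡ k i l))
      right : ∀ i → nodes T i ≡ both (k ↑ʳ i)
      right i = cong [ nodes S , nodes T ]′ (sym (splitAt-↑ʳ k l i))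
      both-all : (P : Node → Set) → (∀ i → P (nodes S i)) → (∀ i → P (nodes T i)) → ∀ i → P (both i)
      both-all P p q i with splitAt k i
      ... | inj₁ j = p j
      ... | inj₂ j = q j

    support-map₁ : ∀ {b} (f : Bool → Bool) → Support Good b → Support Good (f ∘ b)
    support-map₁ f S = record { Support S ; matched = λ s t e → cong f (matched S s t e) }

    support-Sh : ∀ {b} → (∀ s t → Sh M (lookup s) (lookup t) → b (tt , s) ≡ b (tt , t)) → Support Good b
    support-Sh f = record { size = 0 ; nodes = λ () ; valid = λ () ; good = λ () ; depth = 0 ; matched =
        λ s t e → f s t (Sim.shape e) }

    support-c : ∀ {b} i → Support Good b → Support Good (CylindricAlgebra.c 𝔓 i b)
    support-c {b} i S = record { Support S ; depth = depth S + n ; matched = matched-c {b = b} {b} (tame S)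
        (tame S) (matched S) i }

  supported : (Node → Set) → Subuniverse 𝔓
  supported Good = record
    { Member   = Support Good
    ; resp     = λ p S → record { Support S ; matched = λ s t e → trans (sym (p _))
        (trans (matched S s t e) (p _)) }
    ; ∨-closed = support-∪ _∨_
    ; ∧-closed = support-∪ _∧_
    ; ¬-closed = support-map₁ not
    ; ⊤-closed = support-Sh λ _ _ _ → refl
    ; ⊥-closed = support-Sh λ _ _ _ → refl
    ; c-closed = λ i → support-c i
    ; d-closed = λ i j → support-Sh λ s t σ → true-ext (Sh.same→ σ i j) (Sh.same← σ i j)
    }

  𝔄 𝔅 : CylindricAlgebra n
  𝔄 = subalgebra 𝔓 (supported (const ⊤))
  𝔅 = subalgebra 𝔓 (supported NoInf)

  module 𝔄 = CylindricAlgebra 𝔄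
  module 𝔅 = CylindricAlgebra 𝔅

  -- The exact type of a tuple is an atom of 𝔄, so every point of the base lies in an atom.
  module _ (v : Vec ℕ n) where
    Type : Vec ℕ n → Set
    Type t = Sh M (lookup v) (lookup t) × (∀ i → Λ (lookup v) i ≡ Λ (lookup t) i)

    -- At threshold `(0 , 0)` all ranks are high and none are compared. But the nodes on the labels
    -- of `v` are parameters here, and coinciding with a parameter is preserved at every threshold.
    type-closed : ∀ s t → Sim (0 , 0) (Λ (lookup v) ∘ remQuot {n} n) (lookup s)
        (Λ (lookup v) ∘ remQuot {n} n) (lookup t) → Type s → Type t
    type-closed s t (mkSim σ e) (σ′ , p) = Sh-trans σ′ σ , λ (i , j) →
      let q = cong (Λ (lookup v)) (remQuot-combine {n} {n} i j) in
      trans (sym q) (~-≡ e {inj₁ (combine i j)} {inj₂ (i , j)} (trans q (p (i , j))))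

    type-atom : 𝔄.Carrier
    type-atom = (λ (_ , t) → ⌊ Type t ⌋) , record
      { size = n * n ; nodes = Λ (lookup v) ∘ remQuot {n} n ; valid = λ i → Λ-valid (lookup v)
          (remQuot {n} n i) ; good = λ _ → tt ; depth = 0
      ; matched = λ s t e → true-ext (type-closed s t e) (type-closed t s (Sim-sym e)) }

    -- Tuples of one type are similar at every threshold over any parameters, so no element of 𝔄
    -- separates them.
    type-same : ∀ (b : 𝔄.Carrier) t → Type t → proj₁ b (tt , v) ≡ proj₁ b (tt , t)
    type-same (b , S) t (σ , p) = matched S v t
        (mkSim σ (~-reindex id (λ _ → refl) (λ { (inj₁ _) → refl ; (inj₂ i) → sym (p i) }) ~-refl))

    type-self : Type v
    type-self = Sh-refl , λ _ → refl

  ∨-split : ∀ {a b} → a ∨ b ≡ true → a ≡ true ⊎ b ≡ true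
  ∨-split {true}  _ = inj₁ refl
  ∨-split {false} p = inj₂ p

  ∨-join : ∀ {a b} → a ≡ true ⊎ b ≡ true → a ∨ b ≡ true
  ∨-join (inj₁ refl) = refl
  ∨-join {a} (inj₂ refl) = Bool.∨-zeroʳ a

  representation : CompleteRepresentation 𝔄
  representation = record
    { Index = ⊤
    ; Base  = λ _ → ℕ
    ; rep   = rep
    ; homo  = record
      { cong   = λ p → (λ q → trans (sym (p _)) q) , λ q → trans (p _) q
      ; ∨-homo = λ _ _ → ∨-split , ∨-join
      ; ∧-homo = λ (x , _) _ → (λ p → ∧-trueˡ p , ∧-trueʳ {x _} p) , λ (p , q) → ∧-true p q
      ; ¬-homo = λ _ → not-true , ≢true
      ; ⊤-homo = (λ _ → tt) , λ _ → refl
      ; ⊥-homo = (λ ()) , λ ()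
      ; c-homo = λ _ _ → true⁻ , true⁺
      ; d-homo = λ _ _ → true⁻ , true⁺
      }
    ; inj    = λ (p , q) v → bool-ext p q
    ; sup-⋃  = λ Y s sup → (λ {v} → below Y s sup v) , λ (x , Yx , p) → ∧-trueʳ {proj₁ x _}
        (trans (sym (proj₁ sup Yx _)) p)
    }
    where
    rep : 𝔄.Carrier → Squares n {⊤} (λ _ → ℕ) → Set
    rep (b , _) v = b v ≡ true
    below : ∀ (Y : 𝔄.Carrier → Set) s → 𝔄.IsSupremum Y s → ∀ v → rep s v → ∃[ x ] Y x × rep x v
    below Y s (upper , least) v@(_ , w) p with em {∃[ x ] Y x × rep x v}
    ... | yes q = q
    -- If no member of `Y` contains the point, removing its exact type from `s` leaves a smaller
    -- upper bound.
    ... | no ¬q = contradiction (true⁺ (type-self w))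
        (not-true (∧-trueʳ {proj₁ s v} (∧-trueʳ {proj₁ s v} (trans (sym (least u bound v)) p))))
      where
      u : 𝔄.Carrier
      u = s 𝔄.∧ 𝔄.¬ type-atom w
      bound : ∀ {x} → Y x → x 𝔄.≤ᴬ u
      bound {x} Yx v′ = bool-ext
        (λ q → ∧-true q (∧-true (∧-trueʳ {proj₁ x v′} (trans (sym (upper Yx v′)) q))
          (≢true λ r → ¬q (x , Yx , trans (type-same w x (proj₂ v′) (true⁻ r)) q)))) ∧-trueˡ

  depthᶠ : ∀ {v} → Formula n v → ℕ
  depthᶠ (_ ≈ᶠ _)  = 0
  depthᶠ (¬ᶠ φ)    = depthᶠ φ
  depthᶠ (φ ∧ᶠ ψ)  = depthᶠ φ ⊔ depthᶠ ψ
  depthᶠ (φ ∨ᶠ ψ)  = depthᶠ φ ⊔ depthᶠ ψ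
  depthᶠ (φ ⇒ᶠ ψ)  = depthᶠ φ ⊔ depthᶠ ψ
  depthᶠ (∀ᶠ φ)    = suc (depthᶠ φ)
  depthᶠ (∃ᶠ φ)    = suc (depthᶠ φ)

  MatchedAll : ∀ {v} {I : Set} → (I → Node) → (I → Node) → ℕ → Vec 𝔄.Carrier v → Vec 𝔄.Carrier v → Set
  MatchedAll F F′ r ρ ρ′ = ∀ x → Matched F F′ r (proj₁ (lookup ρ x)) (proj₁ (lookup ρ′ x))

  module _ {I : Set} {F F′ : I → Node} (tF : Tame F) (tF′ : Tame F′) where
    matched-∪ : ∀ {r r′ b b′ c c′} (f : Bool → Bool → Bool) → Matched F F′ r b b′ → Matched F F′ r′ c c′ →
                Matched F F′ (r ⊔ r′) (λ v → f (b v) (c v)) (λ v → f (b′ v) (c′ v))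
    matched-∪ {r} {r′} {b} {b′} {c} {c′} f μ ν s t S = cong₂ f
      (matched-≤ {b = b} {b′} (m≤m⊔n r r′) μ s t S) (matched-≤ {b = c} {c′} (m≤n⊔m r r′) ν s t S)

    MatchedTerm : ∀ {v} → Term n v → Vec 𝔄.Carrier v → Vec 𝔄.Carrier v → Set
    MatchedTerm τ ρ ρ′ = ∃[ r ] Matched F F′ r (proj₁ (⟦_⟧ᵗ 𝔄 τ ρ)) (proj₁ (⟦_⟧ᵗ 𝔄 τ ρ′))

    matched-term : ∀ {v r} (ρ ρ′ : Vec 𝔄.Carrier v) (τ : Term n v) → MatchedAll F F′ r ρ ρ′ → MatchedTerm τ ρ ρ′
    matched-term {r = r} ρ ρ′ (var x) μ = r , μ x
    matched-term ρ ρ′ (σ ∨ᵗ τ) μ = join (matched-term ρ ρ′ σ μ) (matched-term ρ ρ′ τ μ)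
      where
      join : MatchedTerm σ ρ ρ′ → MatchedTerm τ ρ ρ′ → MatchedTerm (σ ∨ᵗ τ) ρ ρ′
      join (r , p) (r′ , q) = r ⊔ r′ ,
        matched-∪ {r} {r′} {proj₁ (⟦_⟧ᵗ 𝔄 σ ρ)} {proj₁ (⟦_⟧ᵗ 𝔄 σ ρ′)} {proj₁ (⟦_⟧ᵗ 𝔄 τ ρ)}
            {proj₁ (⟦_⟧ᵗ 𝔄 τ ρ′)} _∨_ p q
    matched-term ρ ρ′ (σ ∧ᵗ τ) μ = join (matched-term ρ ρ′ σ μ) (matched-term ρ ρ′ τ μ)
      where
      join : MatchedTerm σ ρ ρ′ → MatchedTerm τ ρ ρ′ → MatchedTerm (σ ∧ᵗ τ) ρ ρ′
      join (r , p) (r′ , q) = r ⊔ r′ ,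
        matched-∪ {r} {r′} {proj₁ (⟦_⟧ᵗ 𝔄 σ ρ)} {proj₁ (⟦_⟧ᵗ 𝔄 σ ρ′)} {proj₁ (⟦_⟧ᵗ 𝔄 τ ρ)}
            {proj₁ (⟦_⟧ᵗ 𝔄 τ ρ′)} _∧_ p q
    matched-term ρ ρ′ (¬ᵗ τ) μ = let r , p = matched-term ρ ρ′ τ μ in r , λ s t S → cong not (p s t S)
    matched-term ρ ρ′ ⊤ᵗ μ = 0 , λ _ _ _ → refl
    matched-term ρ ρ′ ⊥ᵗ μ = 0 , λ _ _ _ → refl
    matched-term ρ ρ′ (cᵗ i τ) μ = cylindrify (matched-term ρ ρ′ τ μ)
      where
      cylindrify : MatchedTerm τ ρ ρ′ → MatchedTerm (cᵗ i τ) ρ ρ′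
      cylindrify (r , p) = r + n , matched-c {r = r} {proj₁ (⟦_⟧ᵗ 𝔄 τ ρ)} {proj₁ (⟦_⟧ᵗ 𝔄 τ ρ′)} tF tF′ p i
    matched-term ρ ρ′ (dᵗ i j) μ = 0 , matched-d {r = 0} i j

    -- To compare both sides at a point `t` over `F′`, a counterpart of `t` over `F` is found, where
    -- both sides take the same values as at `t`.
    matched-≈ : ∀ {v r k} (ρ ρ′ : Vec 𝔄.Carrier v) (σ τ : Term n v) → F ~[ suc k , 0 ] F′ →
        MatchedAll F F′ r ρ ρ′ →
                ⟦_⟧ᶠ 𝔄 (σ ≈ᶠ τ) ρ → ⟦_⟧ᶠ 𝔄 (σ ≈ᶠ τ) ρ′
    matched-≈ ρ ρ′ σ τ e μ p (tt , t) = go (matched-term ρ ρ′ σ μ) (matched-term ρ ρ′ τ μ)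
      where
      bottom : ∀ k {d} → (0 , d) ≤ᵗ (k , d)
      bottom zero = inj₁ refl
      bottom (suc k) = inj₂ (inj₁ (s≤s z≤n))
      go : MatchedTerm σ ρ ρ′ → MatchedTerm τ ρ ρ′ → proj₁ (⟦_⟧ᵗ 𝔄 σ ρ′) (tt , t) ≡ proj₁ (⟦_⟧ᵗ 𝔄 τ ρ′) (tt , t)
      go (r , μσ) (r′ , μτ) =
        let s , S , _ = realize tF (r ⊔ r′) (~-sym e) t
            low : ∀ {d} → d ≤ r ⊔ r′ → Sim (0 , d) F (lookup s) F′ (lookup t)
            low l = Sim-sym (Sim-weaken (≤ᵗ-trans (≤⇒≤ᵗ l) (bottom _)) S)
        in trans (sym (μσ s t (low (m≤m⊔n r r′)))) (trans (p (tt , s)) (μτ s t (low (m≤n⊔m r r′))))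

  -- The relation that looks over F′ the way a looks over F, once the nodes supporting a have been copied.
  record Transfer {I : Set} (F F′ : I → Node) (k : ℕ) (a : 𝔄.Carrier) : Set where
    field
      nodes′   : Fin (size (proj₂ a)) → Node
      valid′   : ∀ i → Valid (nodes′ i)
      similar  : [ F , nodes (proj₂ a) ]′ ~[ suc k , 0 ] [ F′ , nodes′ ]′
      noInf    : AllNoInf F′ → AllNoInf nodes′

    relation : Relation
    relation (_ , t) = ⌊ ∃[ s ] proj₁ a (tt , s) ≡ true × Sim (0 , depth (proj₂ a)) (nodes (proj₂ a))
        (lookup s) nodes′ (lookup t) ⌋

    closed : ∀ t u → Sim (0 , depth (proj₂ a)) nodes′ (lookup t) nodes′ (lookup u) → relation
        (tt , t) ≡ relation (tt , u)
    closed t u T = true-ext (λ (s , p , S) → s , p , Sim-trans S T)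
        (λ (s , p , S) → s , p , Sim-trans S (Sim-sym T))

    support : ∀ {Good : Node → Set} → (∀ i → Good (nodes′ i)) → Support Good relation
    support g = record { size = _ ; nodes = nodes′ ; valid = valid′ ; good = g ; depth = depth
        (proj₂ a) ; matched = closed }

    transferred : 𝔄.Carrier
    transferred = relation , support (λ _ → tt)

    -- Two tuples similar to `t` over the copied nodes are similar to each other over the nodes of
    -- `a`, and `a` does not distinguish them; so the choice of the witness in `relation` does not
    -- matter.
    matches : Matched (nodes (proj₂ a)) nodes′ (depth (proj₂ a)) (proj₁ a) relation
    matches s t S = bool-ext (λ p → true⁺ (s , p , S)) λ q →
      let s₁ , p , S₁ = true⁻ q in trans (matched (proj₂ a) s s₁ (Sim-trans S (Sim-sym S₁))) p

  -- The number of nodes that support `a` is arbitrary, and so a whole unit of the first component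
  -- of the threshold is spent on it.
  transfer : ∀ {I : Set} {F F′ : I → Node} {k} → Tame F′ → F ~[ suc (suc k) , 0 ] F′ → ∀ a → Transfer F F′ k a
  transfer tF′ e (b , S) with extend-low 0 (size S) e tF′ (nodes S) (valid S)
  ... | G , v , e′ , f = record { nodes′ = G ; valid′ = v ; similar = e′ ; noInf = f }

  module _ {I : Set} {F F′ : I → Node} {k : ℕ} {a : 𝔄.Carrier} (T : Transfer F F′ k a) where
    open Transfer T

    matched-∷ : ∀ {v r} {ρ ρ′ : Vec 𝔄.Carrier v} → MatchedAll F F′ r ρ ρ′ →
                MatchedAll [ F , nodes (proj₂ a) ]′ [ F′ , nodes′ ]′ (r ⊔ depth (proj₂ a)) (a ∷ ρ)
                    (transferred ∷ ρ′)
    matched-∷ {r = r} μ zero = matched-restrict {b = proj₁ a} {relation} inj₂ (λ _ → refl) (λ _ → refl)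
      (matched-≤ {b = proj₁ a} {relation} (m≤n⊔m r _) matches)
    matched-∷ {r = r} {ρ} {ρ′} μ (suc x) = matched-restrict {b = proj₁ (lookup ρ x)} {proj₁ (lookup ρ′ x)}
        inj₁ (λ _ → refl) (λ _ → refl)
      (matched-≤ {b = proj₁ (lookup ρ x)} {proj₁ (lookup ρ′ x)} (m≤m⊔n r _) (μ x))

  matchedAll-sym : ∀ {v I} {F F′ : I → Node} {r} {ρ ρ′ : Vec 𝔄.Carrier v} → MatchedAll F F′ r ρ ρ′ →
      MatchedAll F′ F r ρ′ ρ
  matchedAll-sym {ρ = ρ} {ρ′} μ x = matched-sym {b = proj₁ (lookup ρ x)} {proj₁ (lookup ρ′ x)} (μ x)

  -- An Ehrenfeucht–Fraïssé argument: each quantifier is answered by a transferred relation.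
  invariance : ∀ {v} (φ : Formula n v) {k r} {I : Set} {F F′ : I → Node} {ρ ρ′ : Vec 𝔄.Carrier v} →
      depthᶠ φ ≤ k →
               Tame F → Tame F′ → F ~[ suc k , 0 ] F′ → MatchedAll F F′ r ρ ρ′ → ⟦_⟧ᶠ 𝔄 φ ρ → ⟦_⟧ᶠ 𝔄 φ ρ′
  invariance (σ ≈ᶠ τ) {ρ = ρ} {ρ′} _ tF tF′ e μ = matched-≈ tF tF′ ρ ρ′ σ τ e μ
  invariance (¬ᶠ φ) {ρ = ρ} {ρ′} l tF tF′ e μ ¬p p =
    ¬p (invariance φ l tF′ tF (~-sym e) (matchedAll-sym {ρ = ρ} {ρ′} μ) p)
  invariance (φ ∧ᶠ ψ) l tF tF′ e μ (p , q) =
    invariance φ (m⊔n≤o⇒m≤o (depthᶠ φ) _ l) tF tF′ e μ p , invariance ψ (m⊔n≤o⇒n≤o (depthᶠ φ) _ l) tF tF′ e μ q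
  invariance (φ ∨ᶠ ψ) l tF tF′ e μ (inj₁ p) = inj₁ (invariance φ (m⊔n≤o⇒m≤o (depthᶠ φ) _ l) tF tF′ e μ p)
  invariance (φ ∨ᶠ ψ) l tF tF′ e μ (inj₂ q) = inj₂ (invariance ψ (m⊔n≤o⇒n≤o (depthᶠ φ) _ l) tF tF′ e μ q)
  invariance (φ ⇒ᶠ ψ) {ρ = ρ} {ρ′} l tF tF′ e μ f p = invariance ψ (m⊔n≤o⇒n≤o (depthᶠ φ) _ l) tF tF′ e μ
    (f (invariance φ (m⊔n≤o⇒m≤o (depthᶠ φ) _ l) tF′ tF (~-sym e) (matchedAll-sym {ρ = ρ} {ρ′} μ) p))
  invariance (∀ᶠ φ) {suc k} {ρ = ρ} {ρ′} (s≤s l) tF tF′ e μ f a = invariance φ l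
    (tame-⊎ tF (tame-Fin (nodes′) (valid′))) (tame-⊎ tF′ (tame (proj₂ a))) (~-sym similar)
    (matchedAll-sym {ρ = a ∷ ρ′} {transferred ∷ ρ}
        (matched-∷ T {ρ = ρ′} {ρ} (matchedAll-sym {ρ = ρ} {ρ′} μ))) (f transferred)
    where
    T = transfer tF (~-sym e) a
    open Transfer T
  invariance (∃ᶠ φ) {suc k} {ρ = ρ} {ρ′} (s≤s l) tF tF′ e μ (a , p) = transferred , invariance φ l
    (tame-⊎ tF (tame (proj₂ a))) (tame-⊎ tF′ (tame-Fin (nodes′) (valid′))) similar
        (matched-∷ T {ρ = ρ} {ρ′} μ) p
    where
    T = transfer tF′ e a
    open Transfer T

  include : 𝔅.Carrier → 𝔄.Carrier
  include (b , S) = b , support-map (λ _ → tt) S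

  include-term : ∀ {v} (τ : Term n v) (ρ : Vec 𝔅.Carrier v) → proj₁ (⟦_⟧ᵗ 𝔅 τ ρ) ≡ proj₁
      (⟦_⟧ᵗ 𝔄 τ (Vec.map include ρ))
  include-term (var x) ρ = cong proj₁ (sym (lookup-map x include ρ))
  include-term (σ ∨ᵗ τ) ρ = cong₂ (λ f g v → f v ∨ g v) (include-term σ ρ) (include-term τ ρ)
  include-term (σ ∧ᵗ τ) ρ = cong₂ (λ f g v → f v ∧ g v) (include-term σ ρ) (include-term τ ρ)
  include-term (¬ᵗ τ) ρ = cong (λ f v → not (f v)) (include-term τ ρ)
  include-term ⊤ᵗ ρ = refl
  include-term ⊥ᵗ ρ = refl
  include-term (cᵗ i τ) ρ = cong (CylindricAlgebra.c 𝔓 i) (include-term τ ρ)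
  include-term (dᵗ i j) ρ = refl

  -- The parameters of a formula are supported by finitely many nodes of finite rank, and by transfer
  -- over these a witness in 𝔄 can be replaced by one in 𝔅.
  module Witness {v} (ρ : Vec 𝔅.Carrier v) where
    Params : Set
    Params = Σ[ x ∈ Fin v ] Fin (size (proj₂ (lookup ρ x)))

    params : Params → Node
    params (x , i) = nodes (proj₂ (lookup ρ x)) i

    params-tame : Tame params
    params-tame = record { allValid = λ (x , i) → valid (proj₂ (lookup ρ x)) i ; copyBound = proj₁ c ; copies = λ
        (x , i) → proj₂ c x i }
      where
      c = common-bound (λ x c → ∀ i → Copies< c (params (x , i)))
          (λ x l p i → copies-≤ (params (x , i)) l (p i))
            (λ x → common-bound (λ i c → Copies< c (params (x , i))) (λ i → copies-≤ (params (x , i)))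
                (λ i → copies-bound (params (x , i))))

    depths : ∃[ r ] (∀ x → depth (proj₂ (lookup ρ x)) ≤ r)
    depths = common-bound (λ x r → depth (proj₂ (lookup ρ x)) ≤ r) (λ _ l p → ≤-trans p l) (λ x → _ , ≤-refl)

    self-matched : MatchedAll params params (proj₁ depths) (Vec.map include ρ) (Vec.map include ρ)
    self-matched x = subst (λ b → Matched params params (proj₁ depths) (proj₁ b) (proj₁ b))
        (sym (lookup-map x include ρ))
      (matched-≤ {b = b} {b} (proj₂ depths x)
          (matched-restrict {b = b} {b} (x ,_) (λ _ → refl) (λ _ → refl) (matched (proj₂ (lookup ρ x)))))
      where b = proj₁ (lookup ρ x)

    module _ (φ : Formula n (suc v)) (a : 𝔄.Carrier) where
      T : Transfer params params (depthᶠ φ) a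
      T = transfer params-tame ~-refl a
      open Transfer T

      witness : 𝔅.Carrier
      witness = relation , support (noInf λ (x , i) → good (proj₂ (lookup ρ x)) i)

      to : ⟦_⟧ᶠ 𝔄 φ (a ∷ Vec.map include ρ) → ⟦_⟧ᶠ 𝔄 φ (include witness ∷ Vec.map include ρ)
      to = invariance φ ≤-refl (tame-⊎ params-tame (tame (proj₂ a)))
          (tame-⊎ params-tame (tame-Fin nodes′ valid′)) similar
             (matched-∷ T {ρ = Vec.map include ρ} {Vec.map include ρ} self-matched)

      from : ⟦_⟧ᶠ 𝔄 φ (include witness ∷ Vec.map include ρ) → ⟦_⟧ᶠ 𝔄 φ (a ∷ Vec.map include ρ)
      from = invariance φ ≤-refl (tame-⊎ params-tame (tame-Fin nodes′ valid′))
          (tame-⊎ params-tame (tame (proj₂ a))) (~-sym similar)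
             (matchedAll-sym {ρ = a ∷ Vec.map include ρ} {transferred ∷ Vec.map include ρ}
               (matched-∷ T {ρ = Vec.map include ρ} {Vec.map include ρ} self-matched))

  -- Negation and implication exchange the two directions, which are therefore proved together. As
  -- in the Tarski-Vaught test, the substance lies in the quantifiers, where an element of 𝔄 is
  -- traded for a `witness` in 𝔅.
  elementary→ : ∀ {v} (φ : Formula n v) (ρ : Vec 𝔅.Carrier v) → ⟦_⟧ᶠ 𝔅 φ ρ → ⟦_⟧ᶠ 𝔄 φ (Vec.map include ρ)
  elementary← : ∀ {v} (φ : Formula n v) (ρ : Vec 𝔅.Carrier v) → ⟦_⟧ᶠ 𝔄 φ (Vec.map include ρ) → ⟦_⟧ᶠ 𝔅 φ ρ

  elementary→ (σ ≈ᶠ τ) ρ p v = trans (cong (λ f → f v) (sym (include-term σ ρ)))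
      (trans (p v) (cong (λ f → f v) (include-term τ ρ)))
  elementary→ (¬ᶠ φ) ρ ¬p p = ¬p (elementary← φ ρ p)
  elementary→ (φ ∧ᶠ ψ) ρ (p , q) = elementary→ φ ρ p , elementary→ ψ ρ q
  elementary→ (φ ∨ᶠ ψ) ρ (inj₁ p) = inj₁ (elementary→ φ ρ p)
  elementary→ (φ ∨ᶠ ψ) ρ (inj₂ q) = inj₂ (elementary→ ψ ρ q)
  elementary→ (φ ⇒ᶠ ψ) ρ f p = elementary→ ψ ρ (f (elementary← φ ρ p))
  elementary→ (∀ᶠ φ) ρ f a = Witness.from ρ φ a (elementary→ φ _ (f (Witness.witness ρ φ a)))
  elementary→ (∃ᶠ φ) ρ (b , p) = include b , elementary→ φ (b ∷ ρ) p

  elementary← (σ ≈ᶠ τ) ρ p v = trans (cong (λ f → f v) (include-term σ ρ))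
      (trans (p v) (cong (λ f → f v) (sym (include-term τ ρ))))
  elementary← (¬ᶠ φ) ρ ¬p p = ¬p (elementary→ φ ρ p)
  elementary← (φ ∧ᶠ ψ) ρ (p , q) = elementary← φ ρ p , elementary← ψ ρ q
  elementary← (φ ∨ᶠ ψ) ρ (inj₁ p) = inj₁ (elementary← φ ρ p)
  elementary← (φ ∨ᶠ ψ) ρ (inj₂ q) = inj₂ (elementary← ψ ρ q)
  elementary← (φ ⇒ᶠ ψ) ρ f p = elementary← ψ ρ (f (elementary→ φ ρ p))
  elementary← (∀ᶠ φ) ρ f b = elementary← φ (b ∷ ρ) (f (include b))
  elementary← (∃ᶠ φ) ρ (a , p) = Witness.witness ρ φ a , elementary← φ _ (Witness.to ρ φ a p)

-- The cone system of 𝔅.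

module Obstruction (em : ExcludedMiddle 0ℓ) (m : ℕ) where
  open Model em m
  open Copy em m
  open Limit em m
  open Similarity em m
  open Truth em
  open SetAlgebra em n {⊤} (λ _ → ℕ) using (Cyl)
  open Algebras em m
  open ConeSystems em m
  open Invariants M-invariants

  private
    module CB = Calculus 𝔅
  open CB using () renaming (_⟨_≔_⟩ to _⟪_≔_⟫; Fixed to Fixedᴮ)

  define : (P : Vec ℕ n → Set) → Relation
  define P (_ , s) = ⌊ P s ⌋

  byShape : (P : Vec ℕ n → Set) → (∀ s t → Sh M (lookup s) (lookup t) → P s → P t) → 𝔅.Carrier
  byShape P inv = define P , support-Sh λ s t σ → true-ext (inv s t σ) (inv t s (Sh-sym σ))

  hubOf : Vec ℕ n → Vec ℕ h
  hubOf s = tabulate (lookup s ∘ suc)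

  IsHub IsTop : Vec ℕ n → Set
  IsHub s = ∀ j → M.kind (lookup s (suc j)) ≡ W j
  IsTop s = IsHub s × M.br (hubOf s) ≡ nothing

  IsTint : ℕ → Vec ℕ n → Set
  IsTint t s = M.kind (lookup s 0ᶠ) ≡ X t

  IsEdge : Fin h → Vec ℕ n → Set
  IsEdge j s = M.kind (lookup s (suc j)) ≡ W j × M.adj (lookup s (suc j)) (lookup s 0ᶠ) ≡ true

  IsCone : ℕ → Vec ℕ n → Set
  IsCone t s = (∀ j → IsEdge j s) × IsTint t s

  IsLabel : Label → Fin n → Fin n → Vec ℕ n → Set
  IsLabel l a b s = M.lab (lookup s a) (lookup s b) ≡ l

  module _ {s t : Vec ℕ n} (σ : Sh M (lookup s) (lookup t)) where
    open Sh σ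

    tint-Sh : ∀ {k} → IsTint k s → IsTint k t
    tint-Sh p = trans (sym (kind≡ 0ᶠ)) p

    edge-Sh : ∀ j → IsEdge j s → IsEdge j t
    edge-Sh j (p , q) = trans (sym (kind≡ (suc j))) p , trans (sym (adj≡ (suc j) 0ᶠ)) q

    top-Sh : IsTop s → IsTop t
    top-Sh (p , q) = (λ j → trans (sym (kind≡ (suc j))) (p j)) , no-height (trans (sym ht) (cong height q))
      where
      no-height : ∀ {b} → height b ≡ nothing → b ≡ nothing
      no-height {nothing} _ = refl
      ht : height (M.br (hubOf s)) ≡ height (M.br (hubOf t))
      ht = trans (cong (height ∘ M.br) (tabulate-∘ (lookup s) suc))
             (trans (ht≡ (tabulate suc)) (cong (height ∘ M.br) (sym (tabulate-∘ (lookup t) suc))))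

    label-Sh : ∀ {l a b} → (∀ e → l ≢ node e) → IsLabel l a b s → IsLabel l a b t
    label-Sh {l} {a} {b} ¬node p = go (lab≡ a b) p
      where
      go : ∀ {x y} → SameShape x y → x ≡ l → y ≡ l
      go none  p = p
      go white p = p
      go node  p = contradiction (sym p) (¬node _)

  Top : 𝔅.Carrier
  Top = byShape IsTop (λ s t σ → top-Sh {s} {t} σ)

  Tint : ℕ → 𝔅.Carrier
  Tint k = byShape (IsTint k) (λ s t σ → tint-Sh {s} {t} σ)

  Edge : Fin h → 𝔅.Carrier
  Edge j = byShape (IsEdge j) (λ s t σ → edge-Sh {s} {t} σ j)

  Cone : ℕ → 𝔅.Carrier
  Cone k = byShape (IsCone k) (λ s t σ (p , q) → (λ j → edge-Sh {s} {t} σ j (p j)) , tint-Sh {s} {t} σ q)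

  -- With `e` itself as the parameter, carrying the label `e` is preserved at the lowest threshold
  -- already.
  label-node : ∀ e a b s t → Sim (0 , 0) (λ (_ : Fin 1) → e) (lookup s) (λ _ → e) (lookup t) → IsLabel
      (node e) a b s → IsLabel (node e) a b t
  label-node e a b s t (mkSim σ sim) p = go (Sh.lab≡ σ a b) p
      (~-≡ sim {inj₁ zero} {inj₂ (a , b)} (sym (cong nodeOf p)))
    where
    go : ∀ {x y} → SameShape x y → x ≡ node e → e ≡ nodeOf y → y ≡ node e
    go node refl q = cong node (sym q)

  label-support : ∀ l a b → Small l → Support NoInf (define (IsLabel l a b))
  label-support none a b _ = support-Sh λ s t σ → true-ext (label-Sh {s} {t} σ λ _ ())
      (label-Sh {t} {s} (Sh-sym σ) λ _ ())
  label-support (white j) a b _ = support-Sh λ s t σ → true-ext (label-Sh {s} {t} σ λ _ ())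
      (label-Sh {t} {s} (Sh-sym σ) λ _ ())
  label-support (node e) a b (v , f) = record
    { size = 1 ; nodes = λ _ → e ; valid = λ _ → v ; good = λ _ → f ; depth = 0
    ; matched = λ s t S → true-ext (label-node e a b s t S) (label-node e a b t s (Sim-sym S)) }

  Lab : ∀ l → Small l → Fin n → Fin n → 𝔅.Carrier
  Lab l sl a b = define (IsLabel l a b) , label-support l a b sl

  private
    module 𝔓 = CylindricAlgebra 𝔓

  disjoint : ∀ {x y z : Relation} → (∀ s → x (tt , s) ≡ true → y (tt , s) ≡ true → z (tt , s) ≡ true → ⊥) →
             x 𝔓.∧ (y 𝔓.∧ z) 𝔓.≈ 𝔓.⊥
  disjoint {x} {y} {z} f (_ , s) = bool-ext
    (λ p → contradiction (∧-trueʳ {y (tt , s)} (∧-trueʳ {x (tt , s)} p))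
        (f s (∧-trueˡ p) (∧-trueˡ (∧-trueʳ {x (tt , s)} p)))) λ ()

  define-fixed : ∀ {P : Vec ℕ n → Set} k → (∀ s t → Off k t s → P t → P s) → 𝔓.c k (define P) 𝔓.≈ define P
  define-fixed k f (_ , s) = bool-ext
    (λ p → let t , o , q = true⁻ p in true⁺ (f s t o (true⁻ q))) (λ p → true⁺ (s , off-refl s , p))

  substituted : ∀ {x : Relation} {a b s} → 𝔓.c a (𝔓.d a b 𝔓.∧ x) (tt , s) ≡ true →
                ∃[ t ] Off a t s × lookup t a ≡ lookup t b × x (tt , t) ≡ true
  substituted {x} {a} {b} p = let t , o , q = true⁻ p in
    t , o , true⁻ (∧-trueˡ q) , ∧-trueʳ {𝔓.d a b (tt , t)} q

  define-substituted : ∀ {P Q : Vec ℕ n → Set} {a b} → a ≢ b → (∀ s → Q s → P (s [ a ]≔ lookup s b)) →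
                       (∀ s t → Off a t s → lookup t a ≡ lookup t b → P t → Q s) →
                       define Q 𝔓.≈ 𝔓.c a (𝔓.d a b 𝔓.∧ define P)
  define-substituted {P} {a = a} {b} a≢b to from (_ , s) = bool-ext
    (λ p → true⁺ (s [ a ]≔ lookup s b , off-update a s _ , ∧-true
      (true⁺ (trans (lookup∘update a s _) (sym (lookup∘update′ (a≢b ∘ sym) s _)))) (true⁺ (to s (true⁻ p)))))
    (λ p → let t , o , e , q = substituted {define P} {a} {b} {s} p in true⁺ (from s t o e (true⁻ q)))

  Lab-02 : ∀ l sl → Lab l sl 0ᶠ 2ᶠ 𝔅.≈ (Lab l sl 0ᶠ 1ᶠ) ⟪ 1ᶠ ≔ 2ᶠ ⟫
  Lab-02 l sl = define-substituted (λ ())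
    (λ s p → trans (cong₂ M.lab (lookup∘update′ {i = 0ᶠ} {1ᶠ} (λ ()) s _) (lookup∘update 1ᶠ s _)) p)
    (λ s t o e p → trans (cong₂ M.lab (sym (o 0ᶠ λ ())) (sym (trans e (o 2ᶠ λ ())))) p)

  Lab-12 : ∀ l sl → Lab l sl 1ᶠ 2ᶠ 𝔅.≈ (Lab l sl 0ᶠ 2ᶠ) ⟪ 0ᶠ ≔ 1ᶠ ⟫
  Lab-12 l sl = define-substituted (λ ())
    (λ s p → trans (cong₂ M.lab (lookup∘update 0ᶠ s _) (lookup∘update′ {i = 2ᶠ} {0ᶠ} (λ ()) s _)) p)
    (λ s t o e p → trans (cong₂ M.lab (sym (trans e (o 1ᶠ λ ()))) (sym (o 2ᶠ λ ()))) p)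

  Lab-fixed : ∀ l sl {a b} k → a ≢ k → b ≢ k → Fixedᴮ k (Lab l sl a b)
  Lab-fixed l sl {a} {b} k a≢k b≢k = define-fixed k λ s t o p → trans
      (cong₂ M.lab (sym (o a a≢k)) (sym (o b b≢k))) p

  Tint-fixed : ∀ t k → 0ᶠ ≢ k → Fixedᴮ k (Tint t)
  Tint-fixed t k 0≢k = define-fixed k λ s s′ o p → trans (cong M.kind (sym (o 0ᶠ 0≢k))) p

  Edge-fixed : ∀ j k → 0ᶠ ≢ k → suc j ≢ k → Fixedᴮ k (Edge j)
  Edge-fixed j k 0≢k j≢k = define-fixed k λ s s′ o (p , q) →
    trans (cong M.kind (sym (o (suc j) j≢k))) p , trans (cong₂ M.adj (sym (o (suc j) j≢k)) (sym (o 0ᶠ 0≢k))) q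

  -- An infinite branch fits every tint, so `seed-M` provides the apex that is put at coordinate 0.
  Top≤Cone : ∀ t → Top 𝔅.≤ᴬ 𝔅.c 0ᶠ (Cone t)
  Top≤Cone t (_ , s) = bool-ext (λ p → ∧-true p (true⁺ (grow (true⁻ p)))) ∧-trueˡ
    where
    grow : IsTop s → Cyl 0ᶠ (define (IsCone t)) (tt , s)
    grow (p , q) = s [ 0ᶠ ]≔ k , off-update 0ᶠ s k ,
      true⁺ ((λ j → trans (cong M.kind (kept j)) (p j) ,
                    trans (cong₂ M.adj (trans (kept j) (sym (lookup∘tabulate (lookup s ∘ suc) j)))
                        (lookup∘update 0ᶠ s k))
                      (trans (adj-sym _ k) (proj₂ (proj₂ seed) j))) ,
             trans (cong M.kind (lookup∘update 0ᶠ s k)) (proj₁ (proj₂ seed)))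
      where
      seed : ∃[ k ] Seeded k (hubOf s) t M
      seed = seed-M (hubOf s) (λ j → trans (cong M.kind (lookup∘tabulate (lookup s ∘ suc) j)) (p j))
          (subst (Fits t) (sym q) tt)
      k = proj₁ seed
      kept : ∀ j → lookup (s [ 0ᶠ ]≔ k) (suc j) ≡ lookup s (suc j)
      kept j = lookup∘update′ {i = suc j} {0ᶠ} (λ ()) s k

  Top≉⊥ : ¬ (Top 𝔅.≈ 𝔅.⊥)
  Top≉⊥ p = contradiction (trans (sym (true⁺ top)) (p (tt , 0 ∷ u₀))) λ ()
    where
    top : IsTop (0 ∷ u₀)
    top = hub₀ , trans (cong M.br (tabulate∘lookup u₀)) br₀

  Cone≤Edge : ∀ t j → Cone t 𝔅.≤ᴬ Edge j
  Cone≤Edge t j (_ , s) = bool-ext (λ p → ∧-true p (true⁺ (proj₁ (true⁻ p) j))) ∧-trueˡ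

  Cone≤Tint : ∀ t → Cone t 𝔅.≤ᴬ Tint t
  Cone≤Tint t (_ , s) = bool-ext (λ p → ∧-true p (true⁺ (proj₂ (true⁻ p)))) ∧-trueˡ

  edges-white : ∀ j k sl → 0ᶠ ≢ k → Edge j 𝔅.∧ ((Edge j) ⟪ 0ᶠ ≔ k ⟫ 𝔅.∧ Lab (white j) sl 0ᶠ k) 𝔅.≈ 𝔅.⊥
  edges-white j k sl 0≢k = disjoint {proj₁ (Edge j)} {proj₁ ((Edge j) ⟪ 0ᶠ ≔ k ⟫)}
      {define (IsLabel (white j) 0ᶠ k)} λ s p q r →
    let kd , ad = true⁻ p
        t , o , e , q′ = substituted {proj₁ (Edge j)} {0ᶠ} {k} {s} q
        _ , ad′ = true⁻ q′
    in lab-adj kd ad (trans (cong₂ M.adj (sym (o (suc j) λ ())) (sym (trans e (o k (0≢k ∘ sym))))) ad′)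
        (true⁻ r)

  tints-label : ∀ t t′ l sl → (∀ {x y} → M.kind x ≡ X t → M.kind y ≡ X t′ → M.lab x y ≢ l) →
                Tint t 𝔅.∧ ((Tint t′) ⟪ 0ᶠ ≔ 1ᶠ ⟫ 𝔅.∧ Lab l sl 0ᶠ 1ᶠ) 𝔅.≈ 𝔅.⊥
  tints-label t t′ l sl f = disjoint {proj₁ (Tint t)} {proj₁ ((Tint t′) ⟪ 0ᶠ ≔ 1ᶠ ⟫)}
      {define (IsLabel l 0ᶠ 1ᶠ)} λ s p q r →
    let s′ , o , e , q′ = substituted {proj₁ (Tint t′)} {0ᶠ} {1ᶠ} {s} q
    in f (true⁻ p) (trans (cong M.kind (sym (trans e (o 1ᶠ λ ())))) (true⁻ q′)) (true⁻ r)

  labels-triangle : ∀ e e′ e″ s s′ s″ → ¬ Compat e e′ →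
                    Lab (node e′) s′ 1ᶠ 2ᶠ 𝔅.∧ (Lab (node e) s 0ᶠ 1ᶠ 𝔅.∧ Lab (node e″) s″ 0ᶠ 2ᶠ) 𝔅.≈ 𝔅.⊥
  labels-triangle e e′ e″ s s′ s″ ¬c = disjoint {define (IsLabel (node e′) 1ᶠ 2ᶠ)}
      {define (IsLabel (node e) 0ᶠ 1ᶠ)} {define (IsLabel (node e″) 0ᶠ 2ᶠ)}
    λ v p q r → ¬c (lab-tri (trans (lab-sym _ _) (true⁻ q)) (true⁻ p) (true⁻ r))

  IsSmallLab : 𝔅.Carrier → Set
  IsSmallLab x = ∃[ l ] Σ[ sl ∈ Small l ] x 𝔅.≈ Lab l sl 0ᶠ 1ᶠ

  -- Every relation in 𝔅 is invariant under lowering infinite ranks, so the labels of finite rank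
  -- cannot be separated in 𝔅 from the remaining ones.
  small-labels : 𝔅.IsSupremum IsSmallLab 𝔅.⊤
  small-labels = (λ {x} _ v → sym (Bool.∧-identityʳ (proj₁ x v))) , λ u bound (_ , s) → sym
      (at u (λ {x} → bound {x}) s)
    where
    at : ∀ (u : 𝔅.Carrier) → (∀ {x} → IsSmallLab x → x 𝔅.≤ᴬ u) → ∀ s → proj₁ u (tt , s) ≡ true
    at u@(b , S) bound s = trans (Support.matched S s t sim) (∧-trueʳ {define (IsLabel l 0ᶠ 1ᶠ) (tt , t)}
        (trans (sym (bound {Lab l small 0ᶠ 1ᶠ} (l , small , λ _ → refl) (tt , t))) (true⁺ refl)))
      where
      r = realize {F = Support.nodes S} (Support.tame S) {k = 0} (Support.depth S) ~-refl s
      t = proj₁ r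
      sim = proj₁ (proj₂ r)
      l = M.lab (lookup t 0ᶠ) (lookup t 1ᶠ)
      small-node : ∀ l → M.lab (lookup t 0ᶠ) (lookup t 1ᶠ) ≡ l → Small l
      small-node none _ = tt
      small-node (white _) _ = tt
      small-node (node e) p = subst (λ e → Valid e × NoInf e) (cong nodeOf p)
        (Λ-valid (lookup t) (0ᶠ , 1ᶠ) , proj₂ (proj₂ r) (Support.good S) (0ᶠ , 1ᶠ))
      small : Small l
      small = small-node l refl

  cone-system : ConeSystem 𝔅
  cone-system = record
    { Top = Top ; Tint = Tint ; Edge = Edge ; Cone = Cone ; Lab = Lab
    ; Lab-02 = Lab-02 ; Lab-12 = Lab-12 ; Lab-fixed = Lab-fixed ; Tint-fixed = Tint-fixed ; Edge-fixed
        = Edge-fixed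
    ; Top≉⊥ = Top≉⊥ ; Top≤Cone = Top≤Cone ; Cone≤Edge = Cone≤Edge ; Cone≤Tint = Cone≤Tint ; edges-white
        = edges-white
    ; tints-none = λ {t} {t′} sl t<t′ → tints-label t t′ none sl λ kx ky → lab-X kx ky
        λ { refl → ℕ.<⇒≢ t<t′ (X-injective (trans (sym kx) ky)) }
    ; tints-node = λ {t} {t′} e sl t<t′ l → tints-label t t′ (node e) sl λ kx ky p → l
        (trans (proj₁ (lab-node kx ky p)) (ℕ.m≤n⇒m⊔n≡n (ℕ.<⇒≤ t<t′)))
    ; labels-triangle = labels-triangle
    ; small-labels = small-labels
    }
    where
    X-injective : ∀ {s t} → X s ≡ X t → s ≡ t
    X-injective refl = refl

  not-embeddable : ¬ NeatEmbedding 𝔅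
  not-embeddable E = Descent.contradictory cone-system E

-- Neat embeddings from strong subalgebras and from complete representations.

module _ {n : ℕ} {A B : CylindricAlgebra n} where
  private
    module A  = CylindricAlgebra A
    module B  = CylindricAlgebra B
    module CA = Calculus A
    module CB = Calculus B

  Image : (A.Carrier → B.Carrier) → (A.Carrier → Set) → B.Carrier → Set
  Image g X b = ∃[ x ] X x × g x B.≈ b

  image-supremum : (φ : A ≅ B) (X : A.Carrier → Set) → A.IsSupremum X A.⊤ → B.IsSupremum (Image (proj₁ φ) X) B.⊤
  image-supremum (g , homo , injective , surjective) X (_ , least) =
    (λ {b} _ → B.sym (∧-identityʳ b)) , λ u bound →
      let y , gy = surjective u
          bounded : ∀ {x} → X x → x A.≤ᴬ y
          bounded {x} Xx = injective (B.trans (bound (x , Xx , B.refl))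
              (B.sym (B.trans (H.∧-homo x y) (B.∧-cong B.refl (gy A.refl)))))
      in CB.≤ᴬ-trans (CB.≤ᴬ-reflexive (B.sym H.⊤-homo))
           (CB.≤ᴬ-trans (B.trans (H.cong (least y bounded)) (H.∧-homo A.⊤ y)) (CB.≤ᴬ-reflexive (gy A.refl)))
    where
    module H = IsHomomorphism homo
    open BooleanProperties B.booleanAlgebra using (∧-identityʳ)

module DualCylindrification {n : ℕ} (C : CylindricAlgebra (n + 3)) where
  open CylindricAlgebra C using (Carrier; c)
  private module C = CylindricAlgebra C
  open Calculus C

  ε : Fin 3 → Fin (n + 3)
  ε = n ↑ʳ_

  cyl₃ : Carrier → Carrier
  cyl₃ x = c (ε zero) (c (ε (suc zero)) (c (ε (suc (suc zero))) x))

  cyl₃-fixed : ∀ x j → Fixed (ε j) (cyl₃ x)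
  cyl₃-fixed x zero = c-idem C _ _
  cyl₃-fixed x (suc zero) = c-fixed-c C _ _ (c-idem C _ _)
  cyl₃-fixed x (suc (suc zero)) = c-fixed-c C _ _ (c-fixed-c C _ _ (c-idem C _ _))

  ε-covers : ∀ i → n ≤ toℕ i → ∃[ j ] ε j ≡ i
  ε-covers i n≤i = reduce≥ i n≤i , Fin.splitAt⁻¹-↑ʳ (Fin.splitAt-≥ n i n≤i)

  Neat : Carrier → Set
  Neat x = ∀ i → n ≤ toℕ i → Fixed i x

  inner-neat : ∀ x → Neat (C.¬ cyl₃ x)
  inner-neat x i n≤i with ε-covers i n≤i
  ... | j , refl = c-fixed-¬ C (ε j) (cyl₃-fixed x j)

  neat-ε : ∀ {x} → Neat x → ∀ j → Fixed (ε j) x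
  neat-ε p j = p (ε j) (subst (n ≤_) (sym (toℕ-↑ʳ n j)) (m≤m+n n (toℕ j)))

  inner-disjoint : ∀ {x y} → Neat x → x C.∧ y C.≈ C.⊥ → x C.∧ cyl₃ y C.≈ C.⊥
  inner-disjoint p q = push zero (push (suc zero) (push (suc (suc zero)) q))
    where
    push : ∀ j {y} → _ C.∧ y C.≈ C.⊥ → _ C.∧ c (ε j) y C.≈ C.⊥
    push j q = C.trans (C.sym (c-fixed-∧ˡ (ε j) (neat-ε p j))) (C.trans (C.c-cong (ε j) q) (C.c-⊥ (ε j)))

  -- ¬ cyl₃ (¬ u) is the largest neat element below u.
  neat-supremum : ∀ {I : Set} (x : I → Carrier) → (∀ i → Neat (x i)) →
                  (∀ v → Neat v → (∀ i → x i C.≤ᴬ v) → v C.≈ C.⊤) → ∀ u → (∀ i → x i C.≤ᴬ u) → u C.≈ C.⊤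
  neat-supremum x neat least u bound = C.trans (C.sym (¬-involutive u)) (C.trans (C.¬-cong ¬u≈⊥) ¬⊥≈⊤)
    where
    open BooleanProperties C.booleanAlgebra using (¬-involutive; ¬⊥≈⊤; ∧-zeroʳ)
    below : ∀ i → x i C.∧ C.¬ u C.≈ C.⊥
    below i = C.trans (C.∧-cong (bound i) C.refl)
        (C.trans (C.∧-assoc _ _ _) (C.trans (C.∧-cong C.refl (C.∧-complementʳ u)) (∧-zeroʳ (x i))))
    ¬u≈⊥ : C.¬ u C.≈ C.⊥
    ¬u≈⊥ = ≈⊥⇐c _ (≈⊥⇐c _ (≈⊥⇐c _ (¬≈⊤⇒≈⊥ (least (C.¬ cyl₃ (C.¬ u)) (inner-neat (C.¬ u))
      λ i → disjoint⇒≤¬ (C.trans (C.∧-comm _ _) (inner-disjoint (neat i) (below i)))))))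

-- A supremum equal to 1 is carried from `A` to its isomorphic image, by strength to `B`, along the
-- second isomorphism to the neat reduct, and by `neat-supremum` to all of `C`.
strong⇒embedding : ∀ {n} {A : CylindricAlgebra n} → Sc (Nr (m≤m+n n 3)) A → NeatEmbedding A
strong⇒embedding {n} {A} (B , (C , k@(k′ , k-homo , k-inj , _)) , S , strong , g@(g′ , g-homo , g-inj , _))
    = record
  { C = C
  ; f = f
  ; homo = record
    { cong = λ p → K.cong (G.cong p)
    ; ∨-homo = λ x y → C.trans (K.cong (G.∨-homo x y)) (K.∨-homo _ _)
    ; ∧-homo = λ x y → C.trans (K.cong (G.∧-homo x y)) (K.∧-homo _ _)
    ; ¬-homo = λ x → C.trans (K.cong (G.¬-homo x)) (K.¬-homo _)
    ; ⊤-homo = C.trans (K.cong G.⊤-homo) K.⊤-homo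
    ; ⊥-homo = C.trans (K.cong G.⊥-homo) K.⊥-homo
    ; c-homo = λ i x → C.trans (K.cong (G.c-homo i x)) (K.c-homo i _)
    ; d-homo = λ i j → C.trans (K.cong (G.d-homo i j)) (K.d-homo i j)
    }
  ; neat = λ x → proj₂ (k′ (proj₁ (g′ x)))
  ; faithful = λ p → g-inj (B.trans (k-inj (C.trans p (C.sym K.⊥-homo))) (B.sym G.⊥-homo))
  ; complete = complete
  }
  where
  module A = CylindricAlgebra A
  module B = CylindricAlgebra B
  module C = CylindricAlgebra C
  module G = IsHomomorphism g-homo
  module K = IsHomomorphism k-homo
  open DualCylindrification {n} C
  module CC = Calculus C
  f : A.Carrier → C.Carrier
  f x = proj₁ (k′ (proj₁ (g′ x)))
  complete : ∀ (X : A.Carrier → Set) → A.IsSupremum X A.⊤ → ∀ u → (∀ {x} → X x → f x C.≤ᴬ u) → u C.≈ C.⊤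
  complete X sup u bound = neat-supremum {Σ A.Carrier X} (f ∘ proj₁)
      (λ (x , _) → proj₂ (k′ (proj₁ (g′ x)))) least u (λ (x , Xx) → bound Xx)
    where
    Y : B.Carrier → Set
    Y b = ∃[ x ] X x × proj₁ (g′ x) B.≈ b
    supʸ : B.IsSupremum Y B.⊤
    supʸ = strong Y (λ (x , _ , p) → Subuniverse.resp S p (proj₂ (g′ x)))
        (image-supremum {A = A} {subalgebra B S} g X sup)
    supᶻ = image-supremum {A = B} {neatReduct (m≤m+n n 3) C} k Y supʸ
    least : ∀ v → Neat v → (∀ i → f (proj₁ i) C.≤ᴬ v) → v C.≈ C.⊤
    least v neat-v bounded = CC.⊤-below (proj₂ supᶻ (v , neat-v)
      λ { (b , (x , Xx , p) , q) → CC.≤ᴬ-trans (CC.≤ᴬ-reflexive (C.sym (C.trans (K.cong p) q)))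
          (bounded (x , Xx)) })

module _ (em : ExcludedMiddle 0ℓ) where
  open Truth em

  -- The full set algebra of dimension n + 3 on the same bases receives `A` by letting elements
  -- ignore the last three entries of a tuple. Suprema are unions, and these survive in every
  -- dimension.
  representation⇒embedding : ∀ {n} {A : CylindricAlgebra (suc n)} → CompleteRepresentation A → NeatEmbedding A
  representation⇒embedding {n′} {A} 𝓡 = record
    { C = SetAlgebra.algebra em (n + 3) Base
    ; f = f
    ; homo = record
      { cong   = λ p v → true-ext (proj₁ (H.cong p)) (proj₂ (H.cong p))
      ; ∨-homo = λ x y v → bool-ext (λ p → or (proj₁ (H.∨-homo x y) (true⁻ p)))
          (λ p → true⁺ (proj₂ (H.∨-homo x y) (unor p)))
      ; ∧-homo = λ x y v → bool-ext (λ p → let a , b = proj₁ (H.∧-homo x y) (true⁻ p) in ∧-true (true⁺ a) (true⁺ b))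
                   (λ p → true⁺ (proj₂ (H.∧-homo x y) (true⁻ (∧-trueˡ p) , true⁻ (∧-trueʳ {f x v} p))))
      ; ¬-homo = λ x v → bool-ext (λ p → ≢true λ q → proj₁ (H.¬-homo x) (true⁻ p) (true⁻ q))
                   (λ p → true⁺ (proj₂ (H.¬-homo x) λ q → not-true p (true⁺ q)))
      ; ⊤-homo = λ v → bool-ext (λ _ → refl) (λ _ → true⁺ (proj₂ H.⊤-homo tt))
      ; ⊥-homo = λ v → bool-ext (λ p → contradiction (proj₁ H.⊥-homo (true⁻ p)) λ ()) λ ()
      ; c-homo = c-homo
      ; d-homo = λ i j (a , s) → true-ext
          (λ p → trans (sym (at s i)) (trans (proj₁ (H.d-homo i j) p) (at s j)))
          (λ p → proj₂ (H.d-homo i j) (trans (at s i) (trans p (sym (at s j)))))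
      }
    ; neat = neat
    ; faithful = faithful
    ; complete = complete
    }
    where
    open CompleteRepresentation 𝓡
    module H = IsHomomorphism homo
    module A = CylindricAlgebra A
    n = suc n′
    f : A.Carrier → Squares (n + 3) Base → Bool
    f x (a , s) = ⌊ rep x (a , Vec.take n s) ⌋
    ι : Fin n → Fin (n + 3)
    ι i = inject≤ i (m≤m+n n 3)
    at : ∀ {a} (s : Vec (Base a) (n + 3)) i → lookup (Vec.take n s) i ≡ lookup s (ι i)
    at s i = lookup-take-inject≤ s i
    or : ∀ {P Q} → P ⊎ Q → ⌊ P ⌋ ∨ ⌊ Q ⌋ ≡ true
    or {P} {Q} (inj₁ p) with ⌊ P ⌋ | true⁺ p
    ... | true | _ = refl
    or {P} {Q} (inj₂ q) with ⌊ P ⌋ | ⌊ Q ⌋ | true⁺ q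
    ... | true  | _    | _ = refl
    ... | false | true | _ = refl
    unor : ∀ {P Q} → ⌊ P ⌋ ∨ ⌊ Q ⌋ ≡ true → P ⊎ Q
    unor {P} {Q} p with ⌊ P ⌋ in eq
    ... | true  = inj₁ (true⁻ eq)
    ... | false = inj₂ (true⁻ p)
    ι-injective : ∀ {i j} → ι i ≡ ι j → i ≡ j
    ι-injective = inject≤-injective _ _ _ _
    c-homo : ∀ k x v → f (A.c k x) v ≡ ⌊ SetAlgebra.Cyl em (n + 3) Base (ι k) (f x) v ⌋
    c-homo k x (a , s) = true-ext to from
      where
      to : rep (A.c k x) (a , Vec.take n s) → SetAlgebra.Cyl em (n + 3) Base (ι k) (f x) (a , s)
      to p with proj₁ (H.c-homo k x) p
      ... | t , o , q = t′ , off-update (ι k) s _ , true⁺ (subst (λ u → rep x (a , u)) (lookup-ext same) q)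
        where
        t′ = s [ ι k ]≔ lookup t k
        same : ∀ j → lookup t j ≡ lookup (Vec.take n t′) j
        same j with j Fin.≟ k
        ... | yes refl = sym (trans (at t′ j) (lookup∘update (ι k) s _))
        ... | no j≢k = trans (o j j≢k)
            (trans (at s j) (sym (trans (at t′ j) (lookup∘update′ (j≢k ∘ ι-injective) s _))))
      from : SetAlgebra.Cyl em (n + 3) Base (ι k) (f x) (a , s) → rep (A.c k x) (a , Vec.take n s)
      from (t , o , p) = proj₂ (H.c-homo k x)
          (Vec.take n t , (λ j j≢k → trans (at t j) (trans (o (ι j) (j≢k ∘ ι-injective)) (sym (at s j)))) ,
              true⁻ p)
    neat : ∀ x i → n ≤ toℕ i → ∀ v → ⌊ SetAlgebra.Cyl em (n + 3) Base i (f x) v ⌋ ≡ f x v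
    neat x i n≤i (a , s) = bool-ext
      (λ p → let t , o , q = true⁻ p in trans (cong (λ u → ⌊ rep x (a , u) ⌋) (lookup-ext {u = Vec.take n s} {Vec.take n t} (same t o))) q)
      (λ p → true⁺ (s , off-refl s , p))
      where
      new : ∀ j → ι j ≢ i
      new j refl = ℕ.<⇒≱ (toℕ<n j) (subst (n ≤_) (toℕ-inject≤ j _) n≤i)
      same : ∀ t → Off i t s → ∀ j → lookup (Vec.take n s) j ≡ lookup (Vec.take n t) j
      same t o j = trans (at s j) (trans (sym (o (ι j) (new j))) (sym (at t j)))
    faithful : ∀ {x} → (∀ v → f x v ≡ false) → x A.≈ A.⊥
    faithful {x} p = inj ((λ {v} q → contradiction (empty v q) λ ()) , λ q → contradiction
        (proj₁ H.⊥-homo q) λ ())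
      where
      empty : ∀ v → rep x v → true ≡ false
      empty (a , s) q = trans (sym (true⁺
          (subst (λ u → rep x (a , u)) (sym (++-injectiveˡ (Vec.take n s′) s (Vec.take++drop≡id n s′))) q)))
              (p (a , s′))
        -- An entry of `s` is repeated in the three new places; a positive dimension guarantees that
        -- there is one.
        where s′ = s Vec.++ Vec.replicate 3 (lookup s zero)
    complete : ∀ (X : A.Carrier → Set) → A.IsSupremum X A.⊤ → ∀ u →
        (∀ {x} → X x → ∀ v → f x v ≡ f x v ∧ u v) → ∀ v → u v ≡ true
    complete X sup u bound v@(a , s) = let x , Xx , p = proj₁ (sup-⋃ X A.⊤ sup) (proj₂ H.⊤-homo tt) in
      ∧-trueʳ {f x v} (trans (sym (bound Xx v)) (true⁺ p))

theorem5p2 : (∀ {ℓ} → ExcludedMiddle ℓ) →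
    ∀ (k : Level) (n : ℕ) → n > 2 →
    (∀ (K : Pred (CylindricAlgebra n) k) →
    CompletelyRepresentable ⊆ K →
    K ⊆ Sc (Nr (m≤m+n n 3)) →
    ¬ Elementary K)
    × ¬ Elementary (CompletelyRepresentable {n})
theorem5p2 em k (suc (suc (suc m))) (s≤s (s≤s (s≤s z≤n))) =
  (λ K CR⊆K K⊆Sc el → not-embeddable (strong⇒embedding (K⊆Sc (elementary el (CR⊆K representation))))) ,
  λ el → not-embeddable (representation⇒embedding em (elementary el representation))
  where
  open Algebras em m
  open Obstruction em m
  open Equivalence
  elementary : ∀ {k} {K : Pred (CylindricAlgebra (3 + m)) k} → Elementary K → K 𝔄 → K 𝔅
  elementary (T , models) p = from (models 𝔅) λ φ Tφ → elementary← φ [] (to (models 𝔄) p φ Tφ)
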